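{- Let $c = \frac{1}{100}$. For every $\epsilon > 0$ there exists $n_0(\epsilon)$ such that for all $n \geq n_0(\epsilon)$ the following holds. If $G$ is a graph on $n$ vertices that is $\epsilon$-far from every disjoint union of cliques, then $$\mathsf{sp}(G) \geq n^{1 + c}.$$
   Context: Graphs are finite, simple and undirected. For a graph $G$ with $m$ edges, the max-cut $\mathsf{mc}(G)$ is the largest number of edges in a bipartite subgraph of $G$, and the surplus is $\mathsf{sp}(G) = \mathsf{mc}(G) - \frac{m}{2}$. Two graphs $G$ and $H$ on $n$ vertices are $\epsilon$-close if starting from $G$ one can obtain a graph isomorphic to $H$ by adding or removing at most $\epsilon n^2$ edges; otherwise they are $\epsilon$-far. "$\epsilon$-far from every disjoint union of cliques" means $\epsilon$-far from every graph on $n$ vertices each of whose connected components is a complete graph. -}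

module Defs where

open import Data.Nat using (ℕ; zero; suc; _+_; _*_; _∸_; _^_; _⊔_; _<ᵇ_)
open import Data.Bool using (Bool; true; false; _∧_; _xor_; if_then_else_)
open import Data.Fin using (Fin; toℕ)

import Data.Fin as F
open import Data.List using (List; []; _∷_; map; foldr; allFin; concatMap)
open import Data.Nat.ListAction using (sum)
open import Data.Integer using (+_)
open import Data.Rational using (ℚ; _/_; _≤_)
  renaming (_*_ to _*ℚ_)
open import Data.Fin.Permutation using (Permutation′; _⟨$⟩ʳ_)
open import Relation.Binary.PropositionalEquality using (_≡_; _≢_)
open import Relation.Nullary using (¬_)
open import Data.Product using (Σ)

record Graph (n : ℕ) : Set where
  field
    adj   : Fin n → Fin n → Bool
    sym   : ∀ i j → adj i j ≡ adj j i
    irrefl : ∀ i → adj i i ≡ false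
open Graph public

pairCount : (n : ℕ) → (Fin n → Fin n → Bool) → ℕ
pairCount n P =
  sum (map (λ i → sum (map (λ j → if (toℕ i <ᵇ toℕ j) ∧ P i j then 1 else 0)
                           (allFin n)))
           (allFin n))

edges : ∀ {n} → Graph n → ℕ
edges {n} G = pairCount n (adj G)

allColourings : (n : ℕ) → List (Fin n → Bool)
allColourings zero = (λ ()) ∷ []
allColourings (suc n) =
  concatMap (λ f → (λ { F.zero → false ; (F.suc i) → f i })
                 ∷ (λ { F.zero → true ; (F.suc i) → f i }) ∷ [])
            (allColourings n)

cut : ∀ {n} → Graph n → (Fin n → Bool) → ℕ
cut {n} G S = pairCount n (λ i j → adj G i j ∧ (S i xor S j))

mc : ∀ {n} → Graph n → ℕ
mc {n} G = foldr _⊔_ 0 (map (cut G) (allColourings n))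

-- twice the surplus: 2 sp(G) = 2 mc(G) - m  (always ≥ 0, so ∸ is exact)
twiceSp : ∀ {n} → Graph n → ℕ
twiceSp G = 2 * mc G ∸ edges G

data Reachable {n : ℕ} (G : Graph n) : Fin n → Fin n → Set where
  here : ∀ {i} → Reachable G i i
  step : ∀ {i j k} → adj G i j ≡ true → Reachable G j k → Reachable G i k

IsDisjointUnionOfCliques : ∀ {n} → Graph n → Set
IsDisjointUnionOfCliques G =
  ∀ i j → i ≢ j → Reachable G i j → adj G i j ≡ true

editDist : ∀ {n} → Graph n → Graph n → Permutation′ n → ℕ
editDist {n} G H π = pairCount n (λ i j → adj G i j xor adj H (π ⟨$⟩ʳ i) (π ⟨$⟩ʳ j))

Close : ∀ {n} → ℚ → Graph n → Graph n → Set
Close {n} ε G H =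
  Σ (Permutation′ n) (λ π → (+ editDist G H π) / 1 ≤ ε *ℚ ((+ (n ^ 2)) / 1))


Far : ∀ {n} → ℚ → Graph n → Graph n → Set
Far ε G H = ¬ Close ε G H

FarFromCliqueUnions : ∀ {n} → ℚ → Graph n → Set
FarFromCliqueUnions {n} ε G =
  (H : Graph n) → IsDisjointUnionOfCliques H → Far ε G H

{-# OPTIONS --safe #-}
module Submission where

-- Write A for the adjacency matrix. A small surplus bounds xᵀAx from below on the cube, and by random-sign rounding and
-- linear programming duality there is a diagonal D of small trace with M = A + D positive semidefinite. Off the
-- diagonal M is 0/1, so M ∘ M is M up to the diagonal. If b = ∑ w g gᵀ ⪯ M has rank r and trace τn, the Schur product theorem
-- gives b ∘ b ⪯ M ∘ M; restricting M to the range of b ∘ b produces a matrix below M of rank at most r² and trace at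
-- least about τ²n. Iterating, τ ≥ 1 + r^(1/3) for some r ≥ 8 would make the trace of M too large. Hence a greedy choice
-- of directions approximates M in Frobenius norm by a matrix of bounded rank. Bucketing its coordinates splits the vertices into
-- boundedly many cells; a cherry u - v - w with all three pairs typical would give cells U, V, W on which the vector
-- 1_U/|U| - 1_V/|V| + 1_W/|W| makes M negative. So induced cherries are rare, and clustering around pivots of large
-- degree edits G into a disjoint union of cliques at small cost.

-- The diagonal bound K is a power of n, so the trace of M may be as large as nK, and a bounded-rank
-- approximation is not to be expected from the trace alone. The squaring step supplies it: a matrix
-- below M with x³ rank-one terms has trace at most n(1 + x), whatever K is, and K enters only
-- through the condition K⁸ ≤ n. The exponent 3 has to exceed 2: greedy directions at scale x then
-- carry about n/x² each, the Frobenius loss at that scale is about n²/x, and dyadic losses sum up.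
-- Eigenvectors need not be rational, so Cholesky factors replace spectral projections, and D comes
-- from a finite linear program over a grid instead of semidefinite duality. Violating directions
-- cannot be searched for effectively, so the greedy choice is made under double negation, which
-- decidable inequalities remove. The exponent 1/100 has this origin: with Q about n^(1/100),
-- truncation at Q⁴ standard deviations is controlled by a moment of order 28, the sum of D is then
-- about nQ⁹, and K = Q¹⁰ keeps K⁸ = Q⁸⁰ far enough below n to absorb all constants.

module Development where
  open import Algebra.Bundles using (CommutativeRing; RawRing)
  open import Algebra.Structures using (IsCommutativeRing)
  open import Algebra.Solver.Ring.AlmostCommutativeRing using (fromCommutativeRing; _-Raw-AlmostCommutative⟶_)
  import Algebra.Solver.Ring as RingSolver
  open import Data.Bool using (Bool; true; false; _∧_; _∨_; _xor_; if_then_else_; not)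
  import Data.Bool.Properties as Boolₚ
  open import Data.Empty using (⊥; ⊥-elim)
  open import Data.Fin using (Fin; zero; suc)
  import Data.Fin as F
  import Data.Fin.Permutation as Perm
  import Data.Fin.Properties as Finₚ
  open import Data.Integer as ℤ using (ℤ; +_; -[1+_])
  import Data.Integer.Properties as ℤₚ
  open import Data.List using (List; []; _∷_; _++_; length; map; concatMap; allFin; foldr; tabulate)
  open import Data.List.Membership.Propositional using (_∈_)
  open import Data.List.Membership.Propositional.Properties using (∈-allFin; ∈-map⁺; ∈-lookup)
  import Data.List.Properties as Listₚ
  open import Data.List.Relation.Unary.All as All using (All; []; _∷_)
  import Data.List.Relation.Unary.All.Properties as Allₚ
  open import Data.List.Relation.Unary.Any as Any using (Any; here; there)
  import Data.List.Relation.Unary.Any.Properties as Anyₚ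
  open import Data.Maybe using (Maybe; just; nothing)
  open import Data.Nat as ℕ using (ℕ; zero; suc; _<ᵇ_)
  open import Data.Nat.ListAction using () renaming (sum to ℕsum)
  import Data.Nat.Properties as ℕₚ
  open import Data.Nat.Solver using (module +-*-Solver)
  open import Data.Product using (Σ; _×_; _,_; proj₁; proj₂)
  open import Data.Rational as Rat using (ℚ)
  import Data.Rational.Properties as Ratₚ
  import Data.Rational.Unnormalised as ℚᵘ
  import Data.Rational.Unnormalised.Properties as ℚᵘₚ
  open import Data.Sum using (_⊎_; inj₁; inj₂; [_,_]′)
  open import Defs using (Graph; adj; irrefl; pairCount; edges; allColourings; cut; mc; twiceSp; Reachable; IsDisjointUnionOfCliques; editDist; Close; FarFromCliqueUnions) renaming (sym to adj-sym; here to r-here; step to r-step)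
  open import Relation.Binary.PropositionalEquality using (_≡_; _≢_; refl; sym; trans; cong; cong₂; subst; subst₂)
  open import Relation.Nullary using (¬_; Dec; yes; no)
  open import Relation.Nullary.Decidable using (⌊_⌋)

  module NS = +-*-Solver

  -- Rational arithmetic and its order

  infixl 6 _+_ _-_
  infixl 7 _*_
  infix  8 -_
  infix  4 _≤_ _<_ _≤?_ _≟_

  -- Sealed, since unfolding the normalisation of fractions makes conversion checking explode.
  opaque
    _+_ _*_ : ℚ → ℚ → ℚ
    _+_ = Rat._+_
    _*_ = Rat._*_
    -_ : ℚ → ℚ
    -_ = Rat.-_
    _≤_ _<_ : ℚ → ℚ → Set
    _≤_ = Rat._≤_
    _<_ = Rat._<_
    ι : ℤ → ℚ
    ι i = i Rat./ 1
    -- Total, with value 0 at 0, so that formulas can contain inverses without carrying proofs; the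
    -- inverse law asks for a nonzero argument.
    inv : ℚ → ℚ
    inv x with x Ratₚ.≟ Rat.0ℚ
    ... | yes _ = Rat.0ℚ
    ... | no ne = Rat.1/_ x {{Rat.≢-nonZero ne}}

  # : ℕ → ℚ
  # n = ι (+ n)

  _-_ : ℚ → ℚ → ℚ
  x - y = x + - y

  opaque
    unfolding _+_

    private
      toι : ∀ i → Rat.toℚᵘ (ι i) ℚᵘ.≃ ℚᵘ.mkℚᵘ i 0
      toι i = Ratₚ.toℚᵘ-fromℚᵘ (ℚᵘ.mkℚᵘ i 0)

    ι-+ : ∀ i j → ι (i ℤ.+ j) ≡ ι i + ι j
    ι-+ i j = Ratₚ.toℚᵘ-injective (ℚᵘₚ.≃-trans (toι (i ℤ.+ j)) (ℚᵘₚ.≃-trans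
        (ℚᵘ.*≡* (cong₂ ℤ._*_ (cong₂ ℤ._+_ (sym (ℤₚ.*-identityʳ i)) (sym (ℤₚ.*-identityʳ j))) refl))
        (ℚᵘₚ.≃-sym (ℚᵘₚ.≃-trans (Ratₚ.toℚᵘ-homo-+ (ι i) (ι j)) (ℚᵘₚ.+-cong (toι i) (toι j))))))

    ι-* : ∀ i j → ι (i ℤ.* j) ≡ ι i * ι j
    ι-* i j = Ratₚ.toℚᵘ-injective (ℚᵘₚ.≃-trans (toι (i ℤ.* j)) (ℚᵘₚ.≃-trans (ℚᵘ.*≡* refl)
        (ℚᵘₚ.≃-sym (ℚᵘₚ.≃-trans (Ratₚ.toℚᵘ-homo-* (ι i) (ι j)) (ℚᵘₚ.*-cong (toι i) (toι j))))))

    ι-neg : ∀ i → ι (ℤ.- i) ≡ - ι i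
    ι-neg i = Ratₚ.toℚᵘ-injective (ℚᵘₚ.≃-trans (toι (ℤ.- i)) (ℚᵘₚ.≃-sym
        (ℚᵘₚ.≃-trans (Ratₚ.toℚᵘ-homo‿- (ι i)) (ℚᵘₚ.-‿cong (toι i)))))

    ι-mono : ∀ {i j} → i ℤ.≤ j → ι i ≤ ι j
    ι-mono {i} {j} i≤j = Ratₚ.toℚᵘ-cancel-≤ (ℚᵘₚ.≤-respˡ-≃ (ℚᵘₚ.≃-sym (toι i))
        (ℚᵘₚ.≤-respʳ-≃ (ℚᵘₚ.≃-sym (toι j)) (ℚᵘ.*≤* (ℤₚ.*-monoʳ-≤-nonNeg (+ 1) i≤j))))

    ι-mono-< : ∀ {i j} → i ℤ.< j → ι i < ι j
    ι-mono-< {i} {j} i<j = Ratₚ.toℚᵘ-cancel-< (ℚᵘₚ.<-respˡ-≃ (ℚᵘₚ.≃-sym (toι i))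
        (ℚᵘₚ.<-respʳ-≃ (ℚᵘₚ.≃-sym (toι j)) (ℚᵘ.*<* (ℤₚ.*-monoʳ-<-pos (+ 1) i<j))))

    isCommutativeRing : IsCommutativeRing _≡_ _+_ _*_ -_ (# 0) (# 1)
    isCommutativeRing = Ratₚ.+-*-isCommutativeRing

    ≤-refl : ∀ {x} → x ≤ x
    ≤-refl = Ratₚ.≤-refl
    ≤-trans : ∀ {x y z} → x ≤ y → y ≤ z → x ≤ z
    ≤-trans = Ratₚ.≤-trans
    ≤-antisym : ∀ {x y} → x ≤ y → y ≤ x → x ≡ y
    ≤-antisym = Ratₚ.≤-antisym
    ≤-total : ∀ x y → x ≤ y ⊎ y ≤ x
    ≤-total = Ratₚ.≤-total
    <⇒≤ : ∀ {x y} → x < y → x ≤ y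
    <⇒≤ = Ratₚ.<⇒≤
    <-irrefl : ∀ {x} → x < x → ⊥
    <-irrefl = Ratₚ.<-irrefl refl
    <-≤-trans : ∀ {x y z} → x < y → y ≤ z → x < z
    <-≤-trans = Ratₚ.<-≤-trans
    ≤-<-trans : ∀ {x y z} → x ≤ y → y < z → x < z
    ≤-<-trans = Ratₚ.≤-<-trans
    ≰⇒> : ∀ {x y} → ¬ (x ≤ y) → y < x
    ≰⇒> = Ratₚ.≰⇒>
    _≤?_ : ∀ x y → Dec (x ≤ y)
    _≤?_ = Ratₚ._≤?_
    _≟_ : (x y : ℚ) → Dec (x ≡ y)
    _≟_ = Ratₚ._≟_
    +-mono : ∀ {a b c d} → a ≤ b → c ≤ d → a + c ≤ b + d
    +-mono = Ratₚ.+-mono-≤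
    +-mono-<-≤ : ∀ {a b c d} → a < b → c ≤ d → a + c < b + d
    +-mono-<-≤ = Ratₚ.+-mono-<-≤
    *-nonneg : ∀ {a b} → # 0 ≤ a → # 0 ≤ b → # 0 ≤ a * b
    *-nonneg {a} {b} p q = Ratₚ.nonNegative⁻¹ _ {{Ratₚ.nonNeg*nonNeg⇒nonNeg a {{Rat.nonNegative p}} b {{Rat.nonNegative q}}}}
    *-pos : ∀ {a b} → # 0 < a → # 0 < b → # 0 < a * b
    *-pos {a} {b} p q = Ratₚ.positive⁻¹ _ {{Ratₚ.pos*pos⇒pos a {{Rat.positive p}} b {{Rat.positive q}}}}
    inv-inverse : ∀ {x} → x ≢ # 0 → x * inv x ≡ # 1
    inv-inverse {x} ne with x Ratₚ.≟ Rat.0ℚ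
    ... | yes e = ⊥-elim (ne e)
    ... | no ne′ = Ratₚ.*-inverseʳ x {{Rat.≢-nonZero ne′}}

    -- Clearing the denominator is the bridge to the integers: square roots, the rescaling of Gram
    -- matrices and the choice of `e` all start here.
    fraction : ∀ x → Σ ℤ λ p → Σ ℕ λ q → x * # (suc q) ≡ ι p
    fraction x@record{} = Rat.ℚ.numerator x , Rat.ℚ.denominator-1 x , Ratₚ.toℚᵘ-injective
        (ℚᵘₚ.≃-trans (Ratₚ.toℚᵘ-homo-* x (# (suc (Rat.ℚ.denominator-1 x))))
        (ℚᵘₚ.≃-trans (ℚᵘₚ.*-cong (ℚᵘₚ.≃-refl {Rat.toℚᵘ x}) (toι (+ suc (Rat.ℚ.denominator-1 x))))
        (ℚᵘₚ.≃-trans (ℚᵘ.*≡* lem) (ℚᵘₚ.≃-sym (toι (Rat.ℚ.numerator x))))))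
      where
      lem : (Rat.↥ x ℤ.* + suc (Rat.ℚ.denominator-1 x)) ℤ.* + 1 ≡ Rat.↥ x ℤ.* + (suc (Rat.ℚ.denominator-1 x) ℕ.* 1)
      lem = trans (ℤₚ.*-identityʳ _) (cong (λ z → Rat.↥ x ℤ.* + z) (sym (ℕₚ.*-identityʳ _)))

  ℚ-ring : CommutativeRing _ _
  ℚ-ring = record { isCommutativeRing = isCommutativeRing }

  ℤ-rawRing : RawRing _ _
  ℤ-rawRing = record { Carrier = ℤ ; _≈_ = _≡_ ; _+_ = ℤ._+_ ; _*_ = ℤ._*_ ; -_ = ℤ.-_ ; 0# = + 0 ; 1# = + 1 }

  -- Integer coefficients can be computed and compared while the operations on ℚ stay sealed;
  -- numerals are images under `ι`.
  ι-morphism : ℤ-rawRing -Raw-AlmostCommutative⟶ fromCommutativeRing ℚ-ring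
  ι-morphism = record { ⟦_⟧ = ι ; +-homo = ι-+ ; *-homo = ι-* ; -‿homo = ι-neg ; 0-homo = refl ; 1-homo = refl }

  ι-≟ : ∀ i j → Maybe (ι i ≡ ι j)
  ι-≟ i j with i ℤ.≟ j
  ... | yes e = just (cong ι e)
  ... | no _ = nothing

  open RingSolver ℤ-rawRing (fromCommutativeRing ℚ-ring) ι-morphism ι-≟ using (solve; _:=_; con; _:+_; _:*_; _:-_; :-_)

  open CommutativeRing ℚ-ring using (+-comm; +-assoc; +-identityˡ; +-identityʳ; *-comm; *-assoc; *-identityˡ; *-identityʳ;
      zeroˡ; zeroʳ; distribˡ; distribʳ)

  infixr 2 _≤⟨_⟩_ _=⟨_⟩_ _≡⟨_⟩_
  infix  3 _∎ _□

  _≤⟨_⟩_ : ∀ x {y z} → x ≤ y → y ≤ z → x ≤ z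
  _ ≤⟨ p ⟩ q = ≤-trans p q

  _=⟨_⟩_ : ∀ x {y z} → x ≡ y → y ≤ z → x ≤ z
  _ =⟨ refl ⟩ q = q

  _∎ : ∀ x → x ≤ x
  _ ∎ = ≤-refl

  _≡⟨_⟩_ : ∀ (x : ℚ) {y z} → x ≡ y → y ≡ z → x ≡ z
  _ ≡⟨ p ⟩ q = trans p q

  _□ : ∀ (x : ℚ) → x ≡ x
  _ □ = refl

  +-congʳ : ∀ {a b c} → b ≡ c → a + b ≡ a + c
  +-congʳ refl = refl

  +-congˡ : ∀ {a b c} → a ≡ b → a + c ≡ b + c
  +-congˡ refl = refl

  ≡⇒≤ : ∀ {x y} → x ≡ y → x ≤ y
  ≡⇒≤ refl = ≤-refl

  ≤-by : ∀ {x y e} → # 0 ≤ e → y ≡ x + e → x ≤ y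
  ≤-by {x} {y} {e} p refl = x =⟨ sym (+-identityʳ x) ⟩ x + # 0 ≤⟨ +-mono ≤-refl p ⟩ x + e ∎

  ≤⇒0≤- : ∀ {x y} → x ≤ y → # 0 ≤ y - x
  ≤⇒0≤- {x} {y} p = # 0 =⟨ solve 1 (λ x → con (+ 0) := x :- x) refl x ⟩ x - x ≤⟨ +-mono p ≤-refl ⟩ y - x ∎

  ≤∧>⇒⊥ : ∀ {x y} → x ≤ y → y < x → ⊥
  ≤∧>⇒⊥ p q = <-irrefl (≤-<-trans p q)

  ≮⇒≥ : ∀ {x y} → ¬ (x < y) → y ≤ x
  ≮⇒≥ {x} {y} h with y ≤? x
  ... | yes p = p
  ... | no np = ⊥-elim (h (≰⇒> np))

  #-mono : ∀ {m n} → m ℕ.≤ n → # m ≤ # n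
  #-mono p = ι-mono (ℤ.+≤+ p)

  #-mono-< : ∀ {m n} → m ℕ.< n → # m < # n
  #-mono-< p = ι-mono-< (ℤ.+<+ p)

  #-+ : ∀ m n → # (m ℕ.+ n) ≡ # m + # n
  #-+ m n = ι-+ (+ m) (+ n)

  #-* : ∀ m n → # (m ℕ.* n) ≡ # m * # n
  #-* m n = trans (cong ι (ℤₚ.pos-* m n)) (ι-* (+ m) (+ n))

  0≤# : ∀ n → # 0 ≤ # n
  0≤# n = #-mono ℕ.z≤n

  0<#suc : ∀ n → # 0 < # (suc n)
  0<#suc n = #-mono-< (ℕ.s≤s ℕ.z≤n)

  pos⇒≢0 : ∀ {x} → # 0 < x → x ≢ # 0
  pos⇒≢0 p refl = <-irrefl p

  ≤0⇒0≤- : ∀ {x} → x ≤ # 0 → # 0 ≤ - x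
  ≤0⇒0≤- {x} p = subst (# 0 ≤_) (+-identityˡ (- x)) (≤⇒0≤- p)

  sq≥0 : ∀ x → # 0 ≤ x * x
  sq≥0 x with ≤-total (# 0) x
  ... | inj₁ p = *-nonneg p p
  ... | inj₂ p = subst (# 0 ≤_) (solve 1 (λ x → (:- x) :* (:- x) := x :* x) refl x) (*-nonneg (≤0⇒0≤- p) (≤0⇒0≤- p))

  +-nonneg : ∀ {a b} → # 0 ≤ a → # 0 ≤ b → # 0 ≤ a + b
  +-nonneg {a} {b} p q = # 0 =⟨ sym (+-identityˡ (# 0)) ⟩ # 0 + # 0 ≤⟨ +-mono p q ⟩ a + b ∎

  *-monoˡ : ∀ {a b c} → # 0 ≤ a → b ≤ c → a * b ≤ a * c
  *-monoˡ {a} {b} {c} p q = ≤-by (*-nonneg p (≤⇒0≤- q)) (solve 3 (λ a b c → a :* c := a :* b :+ a :* (c :- b)) refl a b c)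

  *-monoʳ : ∀ {a b c} → # 0 ≤ a → b ≤ c → b * a ≤ c * a
  *-monoʳ {a} {b} {c} p q = subst₂ _≤_ (*-comm a b) (*-comm a c) (*-monoˡ p q)

  *-mono : ∀ {a b c d} → # 0 ≤ a → # 0 ≤ c → a ≤ b → c ≤ d → a * c ≤ b * d
  *-mono 0≤a 0≤c p q = ≤-trans (*-monoʳ 0≤c p) (*-monoˡ (≤-trans 0≤a p) q)

  *-cancel : ∀ {a b c} → # 0 < a → a * b ≤ a * c → b ≤ c
  *-cancel {a} {b} {c} p q with b ≤? c
  ... | yes r = r
  ... | no r = ⊥-elim (≤∧>⇒⊥ q (≤-<-trans (≡⇒≤ (sym (+-identityʳ (a * c)))) (subst (a * c + # 0 <_) e lt)))
    where
    d>0 : # 0 < b - c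
    d>0 = subst (_< b - c) (solve 1 (λ c → c :- c := con (+ 0)) refl c) (+-mono-<-≤ (≰⇒> r) ≤-refl)
    lt : a * c + # 0 < a * c + a * (b - c)
    lt = subst₂ _<_ (+-comm _ _) (+-comm _ _) (+-mono-<-≤ (*-pos p d>0) ≤-refl)
    e : a * c + a * (b - c) ≡ a * b
    e = solve 3 (λ a b c → a :* c :+ a :* (b :- c) := a :* b) refl a b c

  <⇒0<- : ∀ {x y} → x < y → # 0 < y - x
  <⇒0<- {x} {y} p = subst (_< y - x) (solve 1 (λ c → c :- c := con (+ 0)) refl x) (+-mono-<-≤ p ≤-refl)

  inv-posʳ : ∀ {x} → # 0 < x → x * inv x ≡ # 1
  inv-posʳ p = inv-inverse (pos⇒≢0 p)

  inv-pos : ∀ {x} → # 0 < x → # 0 < inv x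
  inv-pos {x} p with inv x ≤? # 0
  ... | no h = ≰⇒> h
  ... | yes h = ⊥-elim (≤∧>⇒⊥ bad (0<#suc 0))
    where
    bad : # 1 ≤ # 0
    bad = # 1 =⟨ sym (inv-posʳ p) ⟩ x * inv x ≤⟨ *-monoˡ (<⇒≤ p) h ⟩ x * # 0 =⟨ zeroʳ x ⟩ # 0 ∎

  sq≡0 : ∀ {x} → x * x ≡ # 0 → x ≡ # 0
  sq≡0 {x} e with x ≟ # 0
  ... | yes p = p
  ... | no p = x ≡⟨ sym (*-identityʳ x) ⟩ x * # 1 ≡⟨ cong (x *_) (sym (inv-inverse p)) ⟩ x * (x * inv x) ≡⟨ sym
      (*-assoc x x (inv x)) ⟩ x * x * inv x ≡⟨ cong (_* inv x) e ⟩ # 0 * inv x ≡⟨ zeroˡ _ ⟩ # 0 □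

  -- Finite sums

  opaque
    sum : ∀ {n} → (Fin n → ℚ) → ℚ
    sum {zero} f = # 0
    sum {suc n} f = f zero + sum (λ i → f (suc i))

  opaque
    unfolding sum

    sum-suc : ∀ {n} (f : Fin (suc n) → ℚ) → sum f ≡ f zero + sum (λ i → f (suc i))
    sum-suc f = refl

    sum-empty : (f : Fin 0 → ℚ) → sum f ≡ # 0
    sum-empty f = refl

    sum-cong : ∀ {n} {f g : Fin n → ℚ} → (∀ i → f i ≡ g i) → sum f ≡ sum g
    sum-cong {zero} h = refl
    sum-cong {suc n} h = cong₂ _+_ (h zero) (sum-cong (λ i → h (suc i)))

    sum-+ : ∀ {n} (f g : Fin n → ℚ) → sum (λ i → f i + g i) ≡ sum f + sum g
    sum-+ {zero} f g = sym (+-identityˡ _)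
    sum-+ {suc n} f g = trans (+-congʳ (sum-+ (λ i → f (suc i)) (λ i → g (suc i))))
      (solve 4 (λ a b c d → (a :+ b) :+ (c :+ d) := (a :+ c) :+ (b :+ d)) refl (f zero) (g zero) _ _)

    sum-*ˡ : ∀ {n} c (f : Fin n → ℚ) → sum (λ i → c * f i) ≡ c * sum f
    sum-*ˡ {zero} c f = sym (zeroʳ c)
    sum-*ˡ {suc n} c f = trans (+-congʳ (sum-*ˡ c (λ i → f (suc i)))) (sym (distribˡ c _ _))

    sum-*ʳ : ∀ {n} c (f : Fin n → ℚ) → sum (λ i → f i * c) ≡ sum f * c
    sum-*ʳ c f = trans (sum-cong (λ i → *-comm (f i) c)) (trans (sum-*ˡ c f) (*-comm c _))

    sum-neg : ∀ {n} (f : Fin n → ℚ) → sum (λ i → - f i) ≡ - sum f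
    sum-neg {zero} f = solve 0 (con (+ 0) := :- con (+ 0)) refl
    sum-neg {suc n} f = trans (+-congʳ (sum-neg (λ i → f (suc i)))) (solve 2 (λ a b → :- a :+ :- b := :- (a :+ b)) refl (f zero)
        _)

    sum-- : ∀ {n} (f g : Fin n → ℚ) → sum (λ i → f i - g i) ≡ sum f - sum g
    sum-- f g = trans (sum-+ f (λ i → - g i)) (+-congʳ (sum-neg g))

    sum-zero : ∀ {n} → sum {n} (λ _ → # 0) ≡ # 0
    sum-zero {zero} = refl
    sum-zero {suc n} = trans (+-identityˡ _) (sum-zero {n})

    sum-≡0 : ∀ {n} {f : Fin n → ℚ} → (∀ i → f i ≡ # 0) → sum f ≡ # 0
    sum-≡0 {n} h = trans (sum-cong h) (sum-zero {n})

    sum-const : ∀ {n} c → sum {n} (λ _ → c) ≡ # n * c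
    sum-const {zero} c = sym (zeroˡ c)
    sum-const {suc n} c = trans (+-congʳ (sum-const {n} c)) (trans (solve 2 (λ c m → c :+ m :* c := (con (+ 1) :+ m) :* c) refl
        c (# n)) (cong (_* c) (sym (#-+ 1 n))))

    sum-swap : ∀ {m n} (f : Fin m → Fin n → ℚ) → sum (λ i → sum (f i)) ≡ sum (λ j → sum (λ i → f i j))
    sum-swap {zero} {n} f = sym (sum-zero {n})
    sum-swap {suc m} f = trans (+-congʳ (sum-swap (λ i → f (suc i)))) (sym (sum-+ (f zero) (λ j → sum (λ i → f (suc i) j))))

    sum-mono : ∀ {n} {f g : Fin n → ℚ} → (∀ i → f i ≤ g i) → sum f ≤ sum g
    sum-mono {zero} h = ≤-refl
    sum-mono {suc n} h = +-mono (h zero) (sum-mono (λ i → h (suc i)))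

    sum-nonneg : ∀ {n} {f : Fin n → ℚ} → (∀ i → # 0 ≤ f i) → # 0 ≤ sum f
    sum-nonneg {n} {f} h = sum-zero-≤
      where
      sum-zero-≤ : # 0 ≤ sum f
      sum-zero-≤ = # 0 =⟨ sym (sum-zero {n}) ⟩ sum {n} (λ _ → # 0) ≤⟨ sum-mono h ⟩ sum f ∎

    term≤sum : ∀ {n} {f : Fin n → ℚ} → (∀ i → # 0 ≤ f i) → ∀ i → f i ≤ sum f
    term≤sum {suc n} {f} h zero = ≤-by (sum-nonneg (λ i → h (suc i))) refl
    term≤sum {suc n} {f} h (suc i) = ≤-trans (term≤sum (λ i → h (suc i)) i) (≤-by (h zero) (+-comm _ _))

  -- Vectors and matrices

  Vect : ℕ → Set
  Vect n = Fin n → ℚ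

  Mat : ℕ → Set
  Mat n = Fin n → Fin n → ℚ

  dot : ∀ {n} → Vect n → Vect n → ℚ
  dot x y = sum (λ i → x i * y i)

  mv : ∀ {n} → Mat n → Vect n → Vect n
  mv M x i = dot (M i) x

  form : ∀ {n} → Mat n → Vect n → Vect n → ℚ
  form M x y = dot x (mv M y)

  Symm : ∀ {n} → Mat n → Set
  Symm M = ∀ i j → M i j ≡ M j i

  PSD : ∀ {n} → Mat n → Set
  PSD M = ∀ x → # 0 ≤ form M x x

  tr : ∀ {n} → Mat n → ℚ
  tr M = sum (λ i → M i i)

  dot-cong : ∀ {n} {x x′ y y′ : Vect n} → (∀ i → x i ≡ x′ i) → (∀ i → y i ≡ y′ i) → dot x y ≡ dot x′ y′
  dot-cong p q = sum-cong (λ i → cong₂ _*_ (p i) (q i))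

  dot-comm : ∀ {n} (x y : Vect n) → dot x y ≡ dot y x
  dot-comm x y = sum-cong (λ i → *-comm (x i) (y i))

  dot-+ʳ : ∀ {n} (x y z : Vect n) → dot x (λ i → y i + z i) ≡ dot x y + dot x z
  dot-+ʳ x y z = trans (sum-cong (λ i → distribˡ (x i) (y i) (z i))) (sum-+ _ _)

  dot--ʳ : ∀ {n} (x y z : Vect n) → dot x (λ i → y i - z i) ≡ dot x y - dot x z
  dot--ʳ x y z = trans (sum-cong (λ i → solve 3 (λ x y z → x :* (y :- z) := x :* y :- x :* z) refl (x i) (y i) (z i)))
      (sum-- _ _)

  dot-*ʳ : ∀ {n} (x y : Vect n) c → dot x (λ i → c * y i) ≡ c * dot x y
  dot-*ʳ x y c = trans (sum-cong (λ i → solve 3 (λ x y c → x :* (c :* y) := c :* (x :* y)) refl (x i) (y i) c)) (sum-*ˡ c _)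

  dot-+ˡ : ∀ {n} (x y z : Vect n) → dot (λ i → y i + z i) x ≡ dot y x + dot z x
  dot-+ˡ x y z = trans (dot-comm _ _) (trans (dot-+ʳ x y z) (cong₂ _+_ (dot-comm x y) (dot-comm x z)))

  dot--ˡ : ∀ {n} (x y z : Vect n) → dot (λ i → y i - z i) x ≡ dot y x - dot z x
  dot--ˡ x y z = trans (dot-comm _ _) (trans (dot--ʳ x y z) (cong₂ _-_ (dot-comm x y) (dot-comm x z)))

  dot-*ˡ : ∀ {n} (x y : Vect n) c → dot (λ i → c * y i) x ≡ c * dot y x
  dot-*ˡ x y c = trans (dot-comm _ _) (trans (dot-*ʳ x y c) (cong (c *_) (dot-comm x y)))

  dot-zeroʳ : ∀ {n} (x : Vect n) {y : Vect n} → (∀ i → y i ≡ # 0) → dot x y ≡ # 0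
  dot-zeroʳ x h = sum-≡0 (λ i → trans (cong (x i *_) (h i)) (zeroʳ (x i)))

  dot-self : ∀ {n} (x : Vect n) → # 0 ≤ dot x x
  dot-self x = sum-nonneg (λ i → sq≥0 (x i))

  form-sum : ∀ {n} (M : Mat n) x y → form M x y ≡ sum (λ i → sum (λ j → M i j * (x i * y j)))
  form-sum M x y = sum-cong (λ i → trans (sym (sum-*ˡ (x i) _)) (sum-cong
      (λ j → solve 3 (λ x m y → x :* (m :* y) := m :* (x :* y)) refl (x i) (M i j) (y j))))

  form-sym : ∀ {n} {M : Mat n} → Symm M → ∀ x y → form M x y ≡ form M y x
  form-sym {M = M} s x y = trans (form-sum M x y) (trans (sum-swap _) (trans
      (sum-cong (λ i → sum-cong (λ j → cong₂ _*_ (s j i) (*-comm (x j) (y i))))) (sym (form-sum M y x))))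

  form-cong : ∀ {n} {M N : Mat n} {x x′ y y′ : Vect n} → (∀ i j → M i j ≡ N i j) → (∀ i → x i ≡ x′ i) → (∀ i → y i ≡ y′ i) →
      form M x y ≡ form N x′ y′
  form-cong p q r = dot-cong q (λ i → dot-cong (p i) r)

  form-+ʳ : ∀ {n} (M : Mat n) x y z → form M x (λ i → y i + z i) ≡ form M x y + form M x z
  form-+ʳ M x y z = trans (dot-cong {x = x} (λ _ → refl) (λ i → dot-+ʳ (M i) y z)) (dot-+ʳ x _ _)

  form-*ʳ : ∀ {n} (M : Mat n) x y c → form M x (λ i → c * y i) ≡ c * form M x y
  form-*ʳ M x y c = trans (dot-cong {x = x} (λ _ → refl) (λ i → dot-*ʳ (M i) y c)) (dot-*ʳ x _ c)

  form-+ˡ : ∀ {n} (M : Mat n) x y z → form M (λ i → y i + z i) x ≡ form M y x + form M z x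
  form-+ˡ M x y z = dot-+ˡ (mv M x) y z

  form-*ˡ : ∀ {n} (M : Mat n) x y c → form M (λ i → c * y i) x ≡ c * form M y x
  form-*ˡ M x y c = dot-*ˡ (mv M x) y c

  form-lin : ∀ {n} {M : Mat n} → Symm M → ∀ s t x y →
    form M (λ i → s * x i + t * y i) (λ i → s * x i + t * y i)
      ≡ s * s * form M x x + # 2 * (s * t) * form M x y + t * t * form M y y
  form-lin {M = M} sy s t x y =
    form M z z ≡⟨ form-+ˡ M z (λ i → s * x i) (λ i → t * y i) ⟩
    form M (λ i → s * x i) z + form M (λ i → t * y i) z ≡⟨ cong₂ _+_ (trans (form-*ˡ M z x s) (cong (s *_) (e x)))
        (trans (form-*ˡ M z y t) (cong (t *_) (e y))) ⟩
    s * (s * form M x x + t * form M x y) + t * (s * form M y x + t * form M y y) ≡⟨ cong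
        (λ u → s * (s * form M x x + t * form M x y) + t * (s * u + t * form M y y)) (form-sym sy y x) ⟩
    s * (s * form M x x + t * form M x y) + t * (s * form M x y + t * form M y y)
      ≡⟨ solve 5 (λ s t a g b → s :* (s :* a :+ t :* g) :+ t :* (s :* g :+ t :* b) := s :* s :* a :+ con (+ 2) :* (s :* t) :* g
          :+ t :* t :* b) refl s t _ _ _ ⟩
    s * s * form M x x + # 2 * (s * t) * form M x y + t * t * form M y y □
    where
    z : Vect _
    z i = s * x i + t * y i
    e : ∀ u → form M u z ≡ s * form M u x + t * form M u y
    e u = trans (form-+ʳ M u (λ i → s * x i) (λ i → t * y i)) (cong₂ _+_ (form-*ʳ M u x s) (form-*ʳ M u y t))

  -- The discriminant argument with a = M(x, x), b = M(y, y), g = M(x, y): the vector bx - gy has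
  -- form b(ab - g²). If b = 0, the vector gx - (a/2 + 1)y has form -2g², which forces g = 0.
  cauchy-schwarz : ∀ {n} {M : Mat n} → Symm M → PSD M → ∀ x y → form M x y * form M x y ≤ form M x x * form M y y
  cauchy-schwarz {M = M} sy psd x y with form M y y ≟ # 0
  ... | yes β≡0 = g * g ≤⟨ *-cancel (0<#suc 1) bound ⟩ # 0 =⟨ sym (trans (cong (a *_) β≡0) (zeroʳ a)) ⟩ a * form M y y ∎
    where
    a g : ℚ
    a = form M x x
    g = form M x y
    bound : # 2 * (g * g) ≤ # 2 * # 0
    bound = ≤-by (psd (λ i → g * x i + (- (a * inv (# 2) + # 1)) * y i))
      (sym (trans (+-congʳ (trans (form-lin sy g (- (a * inv (# 2) + # 1)) x y)
          (cong (λ b → g * g * a + # 2 * (g * (- (a * inv (# 2) + # 1))) * g + (- (a * inv (# 2) + # 1)) *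
          (- (a * inv (# 2) + # 1)) * b) β≡0)))
       (trans (solve 3 (λ g a h → con (+ 2) :* (g :* g) :+ (g :* g :* a :+ con (+ 2) :* (g :* (:- (a :* h :+ con (+ 1)))) :* g
           :+ (:- (a :* h :+ con (+ 1))) :* (:- (a :* h :+ con (+ 1))) :* con (+ 0)) := g :* g :* a :*
           (con (+ 1) :- con (+ 2) :* h)) refl g a (inv (# 2)))
         (trans (cong (λ u → g * g * a * (# 1 - u)) (inv-posʳ (0<#suc 1)))
             (solve 1 (λ u → u :* (con (+ 1) :- con (+ 1)) := con (+ 2) :* con (+ 0)) refl (g * g * a))))))
  ... | no β≢0 = *-cancel β>0 (≤-by (psd (λ i → b * x i + (- g) * y i))
      (trans (solve 3 (λ a b g → b :* (a :* b) := b :* (g :* g) :+ b :* (a :* b :- g :* g)) refl a b g) (+-congʳ (sym e))))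
      where
      a b g : ℚ
      a = form M x x
      b = form M y y
      g = form M x y
      β>0 : # 0 < b
      β>0 = ≰⇒> (λ h → β≢0 (≤-antisym h (psd y)))
      e : form M (λ i → b * x i + (- g) * y i) (λ i → b * x i + (- g) * y i) ≡ b * (a * b - g * g)
      e = trans (form-lin sy b (- g) x y) (solve 3 (λ a b g → b :* b :* a :+ con (+ 2) :* (b :* (:- g)) :* g :+ (:- g) :* (:- g)
          :* b := b :* (a :* b :- g :* g)) refl a b g)

  -- Positive semidefinite matrices and Cholesky factors

  _⊖_ : ∀ {n} → Mat n → Mat n → Mat n
  (M ⊖ N) i j = M i j - N i j

  form-⊖ : ∀ {n} (M N : Mat n) x y → form (M ⊖ N) x y ≡ form M x y - form N x y
  form-⊖ M N x y = trans (dot-cong {x = x} (λ _ → refl) (λ i → dot--ˡ y (M i) (N i))) (dot--ʳ x _ _)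

  mv-⊖ : ∀ {n} (M N : Mat n) x i → mv (M ⊖ N) x i ≡ mv M x i - mv N x i
  mv-⊖ M N x i = dot--ˡ x (M i) (N i)

  mv--ʳ : ∀ {n} (M : Mat n) x y i → mv M (λ j → x j - y j) i ≡ mv M x i - mv M y i
  mv--ʳ M x y i = dot--ʳ (M i) x y

  -- Recursive, so that `mv-Id` is an induction. It doubles as the equality indicator on vertices
  -- and on cell codes.
  Id : ∀ {n} → Mat n
  Id zero zero = # 1
  Id zero (suc j) = # 0
  Id (suc i) zero = # 0
  Id (suc i) (suc j) = Id i j

  mv-Id : ∀ {n} (x : Vect n) i → mv Id x i ≡ x i
  mv-Id {suc n} x zero = trans (sum-suc _) (trans (cong₂ _+_ (*-identityˡ (x zero)) (sum-≡0 (λ j → zeroˡ (x (suc j)))))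
      (+-identityʳ _))
  mv-Id {suc n} x (suc i) = trans (sum-suc _) (trans (cong₂ _+_ (zeroˡ (x zero)) (mv-Id (λ j → x (suc j)) i)) (+-identityˡ _))

  Id-symm : ∀ {n} → Symm (Id {n})
  Id-symm zero zero = refl
  Id-symm zero (suc j) = refl
  Id-symm (suc i) zero = refl
  Id-symm (suc i) (suc j) = Id-symm i j

  form-Id : ∀ {n} (x y : Vect n) → form Id x y ≡ dot x y
  form-Id x y = dot-cong {x = x} (λ _ → refl) (mv-Id y)

  Id-psd : ∀ {n} → PSD (Id {n})
  Id-psd x = subst (# 0 ≤_) (sym (form-Id x x)) (dot-self x)

  mv-column : ∀ {n} (M : Mat n) i j → mv M (Id j) i ≡ M i j
  mv-column M i j = trans (dot-comm (M i) (Id j)) (mv-Id (M i) j)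

  form-column : ∀ {n} (M : Mat n) i → form M (Id i) (Id i) ≡ M i i
  form-column M i = trans (mv-Id (mv M (Id i)) i) (mv-column M i i)

  psd-diag : ∀ {n} {M : Mat n} → PSD M → ∀ i → # 0 ≤ M i i
  psd-diag {M = M} psd i = subst (# 0 ≤_) (form-column M i) (psd (Id i))

  -- A list of pairs (g , w) stands for the matrix ∑ w g gᵀ.
  Rank1s : ℕ → Set
  Rank1s n = List (Vect n × ℚ)

  bm : ∀ {n} → Rank1s n → Mat n
  bm [] i j = # 0
  bm ((g , w) ∷ L) i j = w * (g i * g j) + bm L i j

  NonNeg : ∀ {n} → Rank1s n → Set
  NonNeg = All (λ gw → # 0 ≤ proj₂ gw)

  bm-symm : ∀ {n} (L : Rank1s n) → Symm (bm L)
  bm-symm [] i j = refl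
  bm-symm ((g , w) ∷ L) i j = cong₂ _+_ (cong (w *_) (*-comm (g i) (g j))) (bm-symm L i j)

  ⊖-symm : ∀ {n} {M N : Mat n} → Symm M → Symm N → Symm (M ⊖ N)
  ⊖-symm p q i j = cong₂ _-_ (p i j) (q i j)

  mv-bm : ∀ {n} g w (L : Rank1s n) x i → mv (bm ((g , w) ∷ L)) x i ≡ w * dot g x * g i + mv (bm L) x i
  mv-bm g w L x i = trans (dot-+ˡ x (λ j → w * (g i * g j)) (bm L i)) (cong₂ _+_
    (trans (sum-cong (λ j → solve 4 (λ w a b x → w :* (a :* b) :* x := w :* a :* (b :* x)) refl w (g i) (g j) (x j)))
      (trans (sum-*ˡ (w * g i) (λ j → g j * x j)) (solve 3 (λ w a d → w :* a :* d := w :* d :* a) refl w (g i) (dot g x))))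
          refl)

  form-bm : ∀ {n} g w (L : Rank1s n) x y → form (bm ((g , w) ∷ L)) x y ≡ w * (dot g x * dot g y) + form (bm L) x y
  form-bm g w L x y = trans (dot-cong {x = x} (λ _ → refl) (mv-bm g w L y)) (trans (dot-+ʳ x _ _) (cong₂ _+_
    (trans (dot-*ʳ x g (w * dot g y)) (trans (cong (w * dot g y *_) (dot-comm x g))
        (solve 3 (λ w a b → w :* a :* b := w :* (b :* a)) refl w (dot g y) (dot g x)))) refl))

  bm-psd : ∀ {n} {L : Rank1s n} → NonNeg L → PSD (bm L)
  bm-psd {L = []} [] x = ≡⇒≤ (sym (dot-zeroʳ x (λ i → sum-≡0 (λ j → zeroˡ (x j)))))
  bm-psd {L = (g , w) ∷ L} (0≤w ∷ nn) x = subst (# 0 ≤_) (sym (form-bm g w L x x))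
      (+-nonneg (*-nonneg 0≤w (sq≥0 (dot g x))) (bm-psd nn x))

  upd-form : ∀ {n} (M : Mat n) g w L x y → form (M ⊖ bm ((g , w) ∷ L)) x y ≡ form (M ⊖ bm L) x y - w * (dot g x * dot g y)
  upd-form M g w L x y = trans (form-⊖ M (bm ((g , w) ∷ L)) x y) (trans (cong (λ u → form M x y - u) (form-bm g w L x y))
    (trans (solve 3 (λ m a b → m :- (a :+ b) := m :- b :- a) refl (form M x y) _ (form (bm L) x y))
        (+-congˡ (sym (form-⊖ M (bm L) x y)))))

  upd-mv : ∀ {n} (M : Mat n) g w L x i → mv (M ⊖ bm ((g , w) ∷ L)) x i ≡ mv (M ⊖ bm L) x i - w * dot g x * g i
  upd-mv M g w L x i = trans (mv-⊖ M (bm ((g , w) ∷ L)) x i) (trans (cong (λ u → mv M x i - u) (mv-bm g w L x i))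
    (trans (solve 3 (λ m a b → m :- (a :+ b) := m :- b :- a) refl (mv M x i) _ (mv (bm L) x i))
        (+-congˡ (sym (mv-⊖ M (bm L) x i)))))

  dot-self≡0 : ∀ {n} {x : Vect n} → dot x x ≡ # 0 → ∀ i → x i ≡ # 0
  dot-self≡0 {x = x} e i = sq≡0 (≤-antisym (≤-trans (term≤sum (λ j → sq≥0 (x j)) i) (≡⇒≤ e)) (sq≥0 (x i)))

  -- Cauchy-Schwarz for g = Mc against c bounds (g · g)² by M(g, g) times 0.
  psd-kernel : ∀ {n} {M : Mat n} → Symm M → PSD M → ∀ c → form M c c ≡ # 0 → ∀ i → mv M c i ≡ # 0
  psd-kernel {M = M} sy psd c e = dot-self≡0 (sq≡0 (≤-antisym
    (dot g g * dot g g ≤⟨ cauchy-schwarz sy psd g c ⟩ form M g g * form M c c =⟨ trans (cong (form M g g *_) e) (zeroʳ _) ⟩ # 0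
        ∎) (sq≥0 _)))
    where
    g : Vect _
    g = mv M c

  -- One Cholesky step. With g = M′c and α = M′(c, c), the term g gᵀ / α is the largest multiple of
  -- g gᵀ that can be subtracted within the semidefinite cone, and the remainder kills c.
  module Pivot {n} {M : Mat n} (M-symm : Symm M) (L : Rank1s n) (psd : PSD (M ⊖ bm L)) (c : Vect n)
      (α>0 : # 0 < form (M ⊖ bm L) c c) where
    M′ : Mat n
    M′ = M ⊖ bm L
    M′-symm : Symm M′
    M′-symm = ⊖-symm M-symm (bm-symm L)
    α w : ℚ
    α = form M′ c c
    w = inv α
    g : Vect n
    g = mv M′ c
    g·x : ∀ x → dot g x ≡ form M′ c x
    g·x x = trans (dot-comm g x) (form-sym M′-symm x c)
    L′ : Rank1s n
    L′ = (g , w) ∷ L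
    0<w : # 0 < w
    0<w = inv-pos α>0

    pivot-psd : PSD (M ⊖ bm L′)
    pivot-psd x = subst (# 0 ≤_) (sym (upd-form M g w L x x)) (≤⇒0≤- (*-cancel α>0
      (α * (w * (dot g x * dot g x)) =⟨ trans (sym (*-assoc α w _)) (trans (cong (_* (dot g x * dot g x)) (inv-posʳ α>0))
          (*-identityˡ _)) ⟩
       dot g x * dot g x =⟨ cong₂ _*_ (g·x x) (g·x x) ⟩
       form M′ c x * form M′ c x ≤⟨ cauchy-schwarz M′-symm psd c x ⟩
       α * form M′ x x ∎)))

    pivot-kills : ∀ i → mv (M ⊖ bm L′) c i ≡ # 0
    pivot-kills i = trans (upd-mv M g w L c i) (trans (cong (λ u → g i - w * u * g i) (g·x c))
        (trans (cong (λ u → g i - u * g i) (trans (*-comm w α) (inv-posʳ α>0)))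
      (solve 1 (λ g → g :- con (+ 1) :* g := con (+ 0)) refl (g i))))

    pivot-keeps : ∀ d → (∀ i → mv M′ d i ≡ # 0) → ∀ i → mv (M ⊖ bm L′) d i ≡ # 0
    pivot-keeps d h i = trans (upd-mv M g w L d i) (trans (cong₂ (λ u v → u - w * v * g i) (h i)
        (trans (g·x d) (dot-zeroʳ c h)))
      (solve 2 (λ w g → con (+ 0) :- w :* con (+ 0) :* g := con (+ 0)) refl w (g i)))

  -- An isotropic c is skipped, since the remainder already kills it. For the identity matrix this
  -- is Gram-Schmidt without normalisation: the factors form the orthogonal projector onto the span
  -- of the list.
  cholesky : ∀ {n} → Mat n → List (Vect n) → Rank1s n
  cholesky M [] = []
  cholesky M (c ∷ cs) with form (M ⊖ bm (cholesky M cs)) c c ≟ # 0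
  ... | yes _ = cholesky M cs
  ... | no _ = (mv (M ⊖ bm (cholesky M cs)) c , inv (form (M ⊖ bm (cholesky M cs)) c c)) ∷ cholesky M cs

  Kills : ∀ {n} → Mat n → Vect n → Set
  Kills M c = ∀ i → mv M c i ≡ # 0

  ⊖[]-psd : ∀ {n} {M : Mat n} → PSD M → PSD (M ⊖ bm [])
  ⊖[]-psd {M = M} psd x = subst (# 0 ≤_) (form-cong {M = M} {x = x} {y = x}
      (λ i j → solve 1 (λ m → m := m :- con (+ 0)) refl (M i j)) (λ _ → refl) (λ _ → refl)) (psd x)

  nonneg≢0⇒pos : ∀ {x} → # 0 ≤ x → x ≢ # 0 → # 0 < x
  nonneg≢0⇒pos p q = ≰⇒> (λ h → q (≤-antisym h p))

  module Cholesky {n} {M : Mat n} (M-symm : Symm M) (M-psd : PSD M) where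
    cholesky-psd : ∀ cs → PSD (M ⊖ bm (cholesky M cs))
    cholesky-psd [] = ⊖[]-psd M-psd
    cholesky-psd (c ∷ cs) with form (M ⊖ bm (cholesky M cs)) c c ≟ # 0
    ... | yes _ = cholesky-psd cs
    ... | no ne = Pivot.pivot-psd M-symm (cholesky M cs) (cholesky-psd cs) c (nonneg≢0⇒pos (cholesky-psd cs c) ne)

    cholesky-nonneg : ∀ cs → NonNeg (cholesky M cs)
    cholesky-nonneg [] = []
    cholesky-nonneg (c ∷ cs) with form (M ⊖ bm (cholesky M cs)) c c ≟ # 0
    ... | yes _ = cholesky-nonneg cs
    ... | no ne = <⇒≤ (inv-pos (nonneg≢0⇒pos (cholesky-psd cs c) ne)) ∷ cholesky-nonneg cs

    cholesky-length : ∀ cs → length (cholesky M cs) ℕ.≤ length cs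
    cholesky-length [] = ℕ.z≤n
    cholesky-length (c ∷ cs) with form (M ⊖ bm (cholesky M cs)) c c ≟ # 0
    ... | yes _ = ℕₚ.m≤n⇒m≤1+n (cholesky-length cs)
    ... | no ne = ℕ.s≤s (cholesky-length cs)

    cholesky-kills : ∀ cs → All (Kills (M ⊖ bm (cholesky M cs))) cs
    cholesky-kills [] = []
    cholesky-kills (c ∷ cs) with form (M ⊖ bm (cholesky M cs)) c c ≟ # 0
    ... | yes e = psd-kernel (⊖-symm M-symm (bm-symm (cholesky M cs))) (cholesky-psd cs) c e ∷ cholesky-kills cs
    ... | no ne = P.pivot-kills ∷ All.map (λ {d} → P.pivot-keeps d) (cholesky-kills cs)
      where module P = Pivot M-symm (cholesky M cs) (cholesky-psd cs) c (nonneg≢0⇒pos (cholesky-psd cs c) ne)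

  kills-bm : ∀ {n} {N : Mat n} {L : Rank1s n} → All (λ gw → Kills N (proj₁ gw)) L → ∀ c → Kills N (mv (bm L) c)
  kills-bm {N = N} {[]} [] c i = dot-zeroʳ (N i) (λ j → sum-≡0 (λ k → zeroˡ (c k)))
  kills-bm {N = N} {(g , w) ∷ L} (k ∷ ks) c i = trans (dot-cong {x = N i} (λ _ → refl) (mv-bm g w L c))
      (trans (dot-+ʳ (N i) _ _)
    (trans (cong₂ _+_ (trans (dot-*ʳ (N i) g (w * dot g c)) (trans (cong (w * dot g c *_) (k i)) (zeroʳ _))) (kills-bm ks c i))
        (+-identityˡ _)))

  module Projector {n : ℕ} where
    open Cholesky (Id-symm {n}) (Id-psd {n})

    -- Each factor is c minus its projection onto the span of the others, hence a combination of the
    -- given vectors, all killed by `N`.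
    projector-span : ∀ {N : Mat n} cs → All (Kills N) cs → All (λ gw → Kills N (proj₁ gw)) (cholesky Id cs)
    projector-span [] [] = []
    projector-span {N} (c ∷ cs) (k ∷ ks) with form (Id ⊖ bm (cholesky Id cs)) c c ≟ # 0
    ... | yes _ = projector-span cs ks
    ... | no _ = (λ i → trans (dot-cong {x = N i} (λ _ → refl) (λ j → trans (mv-⊖ Id (bm (cholesky Id cs)) c j)
        (+-congˡ (mv-Id c j))))
           (trans (mv--ʳ N c (mv (bm (cholesky Id cs)) c) i) (trans (cong₂ _-_ (k i) (kills-bm ih c i))
               (solve 0 (con (+ 0) :- con (+ 0) := con (+ 0)) refl)))) ∷ ih
      where
      ih : All (λ gw → Kills N (proj₁ gw)) (cholesky Id cs)
      ih = projector-span cs ks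

    -- A projector onto a line has trace one. Semidefiniteness after the pivot gives w(g · g)² ≤ (Id
    -- - L)(g, g) ≤ g · g, and one factor g · g cancels.
    projector-unit : ∀ cs → All (λ gw → proj₂ gw * dot (proj₁ gw) (proj₁ gw) ≤ # 1) (cholesky Id cs)
    projector-unit [] = []
    projector-unit (c ∷ cs) with form (Id ⊖ bm (cholesky Id cs)) c c ≟ # 0
    ... | yes _ = projector-unit cs
    ... | no ne = unit ∷ projector-unit cs
      where
      L : Rank1s n
      L = cholesky Id cs
      module P = Pivot (Id-symm {n}) L (cholesky-psd cs) c (nonneg≢0⇒pos (cholesky-psd cs c) ne)
      d : ℚ
      d = dot P.g P.g
      key : d * (P.w * d) ≤ d * # 1
      key = d * (P.w * d) =⟨ solve 2 (λ w d → d :* (w :* d) := w :* (d :* d)) refl P.w d ⟩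
        P.w * (d * d) ≤⟨ ≤-by (P.pivot-psd P.g) (trans (solve 2 (λ a b → a := b :+ (a :- b)) refl (form P.M′ P.g P.g)
            (P.w * (d * d))) (+-congʳ (sym (upd-form Id P.g P.w L P.g P.g)))) ⟩
        form P.M′ P.g P.g ≤⟨ ≤-by (bm-psd (cholesky-nonneg cs) P.g) (trans
            (solve 2 (λ a b → a := a :- b :+ b) refl (form Id P.g P.g) (form (bm L) P.g P.g))
            (+-congˡ (sym (form-⊖ Id (bm L) P.g P.g)))) ⟩
        form Id P.g P.g =⟨ trans (form-Id P.g P.g) (sym (*-identityʳ d)) ⟩
        d * # 1 ∎
      unit : P.w * d ≤ # 1
      unit with d ≟ # 0
      ... | yes e = P.w * d =⟨ trans (cong (P.w *_) e) (zeroʳ _) ⟩ # 0 ≤⟨ 0≤# 1 ⟩ # 1 ∎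
      ... | no ne = *-cancel (nonneg≢0⇒pos (dot-self P.g) ne) key

  -- The trace inner product of `N` with `bm L`, expanded over rank-one terms so that no matrix
  -- product appears.
  pair : ∀ {n} → Mat n → Rank1s n → ℚ
  pair N [] = # 0
  pair N ((g , w) ∷ L) = w * form N g g + pair N L

  pair-nonneg : ∀ {n} {N : Mat n} {L} → PSD N → NonNeg L → # 0 ≤ pair N L
  pair-nonneg psd [] = ≤-refl
  pair-nonneg {L = (g , w) ∷ L} psd (p ∷ nn) = +-nonneg (*-nonneg p (psd g)) (pair-nonneg psd nn)

  pair-⊖ : ∀ {n} (N N′ : Mat n) L → pair (N ⊖ N′) L ≡ pair N L - pair N′ L
  pair-⊖ N N′ [] = solve 0 (con (+ 0) := con (+ 0) :- con (+ 0)) refl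
  pair-⊖ N N′ ((g , w) ∷ L) = trans (cong₂ (λ u v → w * u + v) (form-⊖ N N′ g g) (pair-⊖ N N′ L))
    (solve 5 (λ w a b c d → w :* (a :- b) :+ (c :- d) := w :* a :+ c :- (w :* b :+ d)) refl w _ _ _ _)

  pair-bm-∷ : ∀ {n} g w (L : Rank1s n) P → pair (bm ((g , w) ∷ L)) P ≡ w * form (bm P) g g + pair (bm L) P
  pair-bm-∷ g w L [] = sym (trans (cong (λ u → w * u + # 0) (dot-zeroʳ g (λ i → sum-≡0 (λ j → zeroˡ (g j)))))
      (solve 1 (λ w → w :* con (+ 0) :+ con (+ 0) := con (+ 0)) refl w))
  pair-bm-∷ g w L ((h , v) ∷ P) = trans (cong₂ (λ a b → v * a + b) (form-bm g w L h h) (pair-bm-∷ g w L P))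
    (trans (solve 6 (λ v w d f s r → v :* (w :* (d :* d) :+ f) :+ (w :* s :+ r) := w :* (v :* (d :* d) :+ s) :+ (v :* f :+ r))
        refl v w (dot g h) (form (bm L) h h) (form (bm P) g g) (pair (bm L) P))
      (cong (λ a → w * a + _) (trans (cong (λ d → v * (d * d) + form (bm P) g g) (dot-comm g h)) (sym (form-bm h v P g g)))))

  pair-comm : ∀ {n} (L P : Rank1s n) → pair (bm L) P ≡ pair (bm P) L
  pair-comm [] [] = refl
  pair-comm [] ((h , v) ∷ P) = trans (cong₂ (λ a b → v * a + b) (dot-zeroʳ h (λ i → sum-≡0 (λ j → zeroˡ (h j))))
      (pair-comm [] P)) (solve 1 (λ w → w :* con (+ 0) :+ con (+ 0) := con (+ 0)) refl v)
  pair-comm ((g , w) ∷ L) P = trans (pair-bm-∷ g w L P) (+-congʳ (pair-comm L P))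

  pair-kills : ∀ {n} {N : Mat n} {L} → All (λ gw → Kills N (proj₁ gw)) L → pair N L ≡ # 0
  pair-kills [] = refl
  pair-kills {L = (g , w) ∷ L} (k ∷ ks) = trans (cong₂ (λ a b → w * a + b) (dot-zeroʳ g k) (pair-kills ks))
      (solve 1 (λ w → w :* con (+ 0) :+ con (+ 0) := con (+ 0)) refl w)

  tr-bm : ∀ {n} (L : Rank1s n) → tr (bm L) ≡ pair Id L
  tr-bm [] = sum-≡0 (λ _ → refl)
  tr-bm ((g , w) ∷ L) = trans (sum-+ _ _) (cong₂ _+_ (trans (sum-*ˡ w _) (cong (w *_) (sym (form-Id g g)))) (tr-bm L))

  -- Passing from C to a matrix below M costs only δ per rank-one term, however large δ is compared with the entries of M.
  module Reset {n} {M : Mat n} (M-symm : Symm M) (M-psd : PSD M) (C : Rank1s n) (C-nonneg : NonNeg C) (δ : ℚ) (0≤δ : # 0 ≤ δ)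
    (C≤M+δ : ∀ x → form (bm C) x x ≤ form M x x + δ * dot x x) where
    cs : List (Vect n)
    cs = map proj₁ C
    L P : Rank1s n
    L = cholesky M cs
    P = cholesky Id cs
    open Cholesky M-symm M-psd
    private module I = Cholesky (Id-symm {n}) (Id-psd {n})

    reset-length : length L ℕ.≤ length C
    reset-length = subst (length L ℕ.≤_) (Listₚ.length-map proj₁ C) (cholesky-length cs)

    pairM≥ : ∀ {P} → NonNeg P → pair (bm C) P ≤ pair M P + δ * pair Id P
    pairM≥ [] = ≡⇒≤ (solve 1 (λ d → con (+ 0) := con (+ 0) :+ d :* con (+ 0)) refl δ)
    pairM≥ {(g , w) ∷ P} (0≤w ∷ nn) = ≤-trans (+-mono (*-monoˡ 0≤w (≤-trans (C≤M+δ g)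
        (≡⇒≤ (cong (λ u → form M g g + δ * u) (sym (form-Id g g)))))) (pairM≥ nn))
      (≡⇒≤ (solve 6 (λ w m d i p q → w :* (m :+ d :* i) :+ (p :+ d :* q) := w :* m :+ p :+ d :* (w :* i :+ q)) refl w
          (form M g g) δ (form Id g g) (pair M P) (pair Id P)))

    pairId≤ : ∀ {P : Rank1s n} → All (λ gw → proj₂ gw * dot (proj₁ gw) (proj₁ gw) ≤ # 1) P → pair Id P ≤ # (length P)
    pairId≤ [] = ≤-refl
    pairId≤ {(g , w) ∷ P} (p ∷ ps) = ≤-trans (+-mono (≤-trans (≡⇒≤ (cong (w *_) (form-Id g g))) p) (pairId≤ ps))
        (≡⇒≤ (sym (#-+ 1 (length P))))

    -- With P the projector onto the span of C: tr C = ⟨C, P⟩ ≤ ⟨M, P⟩ + δ tr P = ⟨L, P⟩ + δ tr P ≤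
    -- tr L + δ |C|. The equalities hold since Id - P and M - L kill the span; the last step uses P
    -- ≤ Id and that each factor of P has trace at most 1.
    reset-trace : tr (bm C) - δ * # (length C) ≤ tr (bm L)
    reset-trace = ≤-trans (≤-by (+-nonneg h1 (+-nonneg h2 h3)) refl) (≡⇒≤ e)
      where
      p1 p2 p3 : ℚ
      h1 : # 0 ≤ pair Id L - pair (bm P) L
      h1 = subst (# 0 ≤_) (pair-⊖ Id (bm P) L) (pair-nonneg (I.cholesky-psd cs) (cholesky-nonneg cs))
      h2 : # 0 ≤ pair M P + δ * pair Id P - pair (bm C) P
      h2 = ≤⇒0≤- (pairM≥ (I.cholesky-nonneg cs))
      h3 : # 0 ≤ δ * (# (length C) - pair Id P)
      h3 = *-nonneg 0≤δ (≤⇒0≤- (≤-trans (pairId≤ (Projector.projector-unit cs))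
          (#-mono (subst (length P ℕ.≤_) (Listₚ.length-map proj₁ C) (I.cholesky-length cs)))))
      k1 : pair M P - pair (bm L) P ≡ # 0
      k1 = trans (sym (pair-⊖ M (bm L) P)) (pair-kills (Projector.projector-span cs (cholesky-kills cs)))
      k2 : pair Id C - pair (bm P) C ≡ # 0
      k2 = trans (sym (pair-⊖ Id (bm P) C)) (pair-kills (Allₚ.map⁻ (I.cholesky-kills cs)))
      p1 = pair (bm P) L
      p2 = pair M P
      p3 = pair (bm P) C
      e : tr (bm C) - δ * # (length C) + (pair Id L - pair (bm P) L + (pair M P + δ * pair Id P - pair (bm C) P + δ *
          (# (length C) - pair Id P))) ≡ tr (bm L)
      e = trans (cong₂ (λ a b → a - δ * # (length C) + (pair Id L - p1 +
          (p2 + δ * pair Id P - b + δ * (# (length C) - pair Id P)))) (tr-bm C) (pair-comm C P))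
        (trans (solve 8 (λ c δ l idl p1 p2 i p3 → c :- δ :* l :+ (idl :- p1 :+ (p2 :+ δ :* i :- p3 :+ δ :* (l :- i))) := idl :+
            (p2 :- p1) :+ (c :- p3)) refl (pair Id C) δ (# (length C)) (pair Id L) p1 p2 (pair Id P) p3)
        (trans (cong₂ (λ a b → pair Id L + a + b) (trans (cong (λ u → p2 - u) (pair-comm P L)) k1) k2)
            (trans (solve 1 (λ a → a :+ con (+ 0) :+ con (+ 0) := a) refl (pair Id L)) (sym (tr-bm L)))))

  -- Schur products and the squaring step

  had : ∀ {n} → Mat n → Mat n → Mat n
  had X Y i j = X i j * Y i j

  form-+ᴹ : ∀ {n} (X Y : Mat n) x y → form (λ i j → X i j + Y i j) x y ≡ form X x y + form Y x y
  form-+ᴹ X Y x y = trans (dot-cong {x = x} (λ _ → refl) (λ i → dot-+ˡ y (X i) (Y i))) (dot-+ʳ x _ _)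

  *-interchange : ∀ a b c d → (a * b) * (c * d) ≡ (a * c) * (b * d)
  *-interchange = solve 4 (λ a b c d → (a :* b) :* (c :* d) := (a :* c) :* (b :* d)) refl

  form-scale : ∀ {n} (X : Mat n) w (g x : Vect n) → form (λ i j → X i j * (w * (g i * g j))) x x ≡ w * form X (λ i → x i * g i)
      (λ i → x i * g i)
  form-scale X w g x = trans (form-sum _ x x) (trans (sum-cong (λ i → trans (sum-cong (λ j →
      trans (solve 4 (λ m w p q → m :* (w :* p) :* q := w :* (m :* (q :* p))) refl (X i j) w (g i * g j) (x i * x j))
          (cong (λ u → w * (X i j * u)) (*-interchange (x i) (x j) (g i) (g j))))) (sum-*ˡ w _)))
    (trans (sum-*ˡ w _) (cong (w *_) (sym (form-sum X _ _)))))

  -- For a rank-one term the Schur product is a congruence: X ∘ (w g gᵀ) at x equals w X(x ∘ g, x ∘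
  -- g).
  schur : ∀ {n} {X : Mat n} {L} → PSD X → NonNeg L → PSD (had X (bm L))
  schur {X = X} {[]} psd [] x = ≡⇒≤ (sym (dot-zeroʳ x (λ i → sum-≡0 (λ j → trans (cong (_* x j) (zeroʳ (X i j)))
      (zeroˡ (x j))))))
  schur {X = X} {(g , w) ∷ L} psd (0≤w ∷ nn) x = subst (# 0 ≤_)
    (sym (trans (form-cong {x = x} {y = x} (λ i j → distribˡ (X i j) (w * (g i * g j)) (bm L i j)) (λ _ → refl) (λ _ → refl))
      (trans (form-+ᴹ _ (had X (bm L)) x x) (+-congˡ (form-scale X w g x)))))
    (+-nonneg (*-nonneg 0≤w (psd _)) (schur psd nn x))

  -- Cholesky along the standard basis leaves a remainder that kills every basis vector, so it
  -- vanishes.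
  psd-factor : ∀ {n} {M : Mat n} → Symm M → PSD M → Σ (Rank1s n) λ L → NonNeg L × (∀ i j → M i j ≡ bm L i j)
  psd-factor {n} {M} sy psd = cholesky M basis , cholesky-nonneg basis , λ i j →
      trans (solve 2 (λ m b → m := (m :- b) :+ b) refl (M i j) _) (trans
          (+-congˡ (trans (sym (mv-column (M ⊖ bm (cholesky M basis)) i j)) (All-lookup j i))) (+-identityˡ _))
    where
    open Cholesky sy psd
    basis : List (Vect n)
    basis = map Id (allFin n)
    All-lookup : ∀ j → Kills (M ⊖ bm (cholesky M basis)) (Id j)
    All-lookup j = All.lookup (Allₚ.map⁻ (cholesky-kills basis)) (∈-allFin j)

  bm-++ : ∀ {n} (L L′ : Rank1s n) i j → bm (L ++ L′) i j ≡ bm L i j + bm L′ i j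
  bm-++ [] L′ i j = sym (+-identityˡ _)
  bm-++ ((g , w) ∷ L) L′ i j = trans (+-congʳ (bm-++ L L′ i j)) (sym (+-assoc _ _ _))

  scale1 : ∀ {n} → Vect n × ℚ → Vect n × ℚ → Vect n × ℚ
  scale1 (g , w) (h , v) = (λ i → g i * h i) , w * v

  hadL : ∀ {n} → Rank1s n → Rank1s n → Rank1s n
  hadL [] L′ = []
  hadL (gw ∷ L) L′ = map (scale1 gw) L′ ++ hadL L L′

  bm-scale1 : ∀ {n} g w (L : Rank1s n) i j → bm (map (scale1 (g , w)) L) i j ≡ w * (g i * g j) * bm L i j
  bm-scale1 g w [] i j = sym (zeroʳ _)
  bm-scale1 g w ((h , v) ∷ L) i j = trans (+-congʳ (bm-scale1 g w L i j))
    (trans (+-congˡ (cong (w * v *_) (*-interchange (g i) (h i) (g j) (h j))))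
        (solve 5 (λ w v p q r → w :* v :* (p :* q) :+ w :* p :* r := w :* p :* (v :* q :+ r)) refl w v (g i * g j) (h i * h j)
        (bm L i j)))

  bm-hadL : ∀ {n} (L L′ : Rank1s n) i j → bm (hadL L L′) i j ≡ had (bm L) (bm L′) i j
  bm-hadL [] L′ i j = sym (zeroˡ _)
  bm-hadL ((g , w) ∷ L) L′ i j = trans (bm-++ (map (scale1 (g , w)) L′) (hadL L L′) i j)
      (trans (cong₂ _+_ (bm-scale1 g w L′ i j) (bm-hadL L L′ i j)) (sym (distribʳ _ _ _)))

  hadL-length : ∀ {n} (L L′ : Rank1s n) → length (hadL L L′) ≡ length L ℕ.* length L′
  hadL-length [] L′ = refl
  hadL-length (gw ∷ L) L′ = trans (Listₚ.length-++ (map (scale1 gw) L′))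
      (cong₂ ℕ._+_ (Listₚ.length-map (scale1 gw) L′) (hadL-length L L′))

  hadL-nonneg : ∀ {n} {L L′ : Rank1s n} → NonNeg L → NonNeg L′ → NonNeg (hadL L L′)
  hadL-nonneg [] nn′ = []
  hadL-nonneg (p ∷ nn) nn′ = Allₚ.++⁺ (Allₚ.map⁺ (All.map (*-nonneg p) nn′)) (hadL-nonneg nn nn′)

  Below : ∀ {n} → Mat n → Rank1s n → Set
  Below M L = NonNeg L × PSD (M ⊖ bm L)

  below-tr : ∀ {n} {M : Mat n} {L} → Below M L → tr (bm L) ≤ tr M
  below-tr {M = M} {L} (_ , psd) = ≤-by (sum-nonneg (psd-diag psd)) (trans
      (sym (solve 2 (λ b m → b :+ (m :- b) := m) refl (tr (bm L)) (tr M)))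
      (+-congʳ (sym (sum-- (λ i → M i i) (λ i → bm L i i)))))

  sum-square : ∀ {n} (f : Fin n → ℚ) → sum f * sum f ≤ # n * sum (λ i → f i * f i)
  sum-square {n} f = sum f * sum f =⟨ cong₂ _*_ e e ⟩ form Id f (λ _ → # 1) * form Id f (λ _ → # 1) ≤⟨ cauchy-schwarz Id-symm
      Id-psd f (λ _ → # 1) ⟩
    form Id f f * form Id (λ _ → # 1) (λ _ → # 1) =⟨ cong₂ _*_ (form-Id f f)
        (trans (form-Id {n} (λ _ → # 1) (λ _ → # 1)) (trans (sum-cong {n} (λ _ → *-identityˡ (# 1)))
        (trans (sum-const {n} (# 1)) (*-identityʳ _)))) ⟩
    sum (λ i → f i * f i) * # n =⟨ *-comm _ _ ⟩ # n * sum (λ i → f i * f i) ∎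
    where
    e : sum f ≡ form Id f (λ _ → # 1)
    e = sym (trans (form-Id f (λ _ → # 1)) (sum-cong (λ i → *-identityʳ (f i))))

  module Squaring {n} {M : Mat n} (M-symm : Symm M) (M-psd : PSD M) (δ : ℚ) (0≤δ : # 0 ≤ δ)
    (M∘M≤M+δ : ∀ x → form (had M M) x x ≤ form M x x + δ * dot x x) where

    -- M ∘ M - b ∘ b = (M - b) ∘ M + (M - b) ∘ b, and both products are semidefinite by `schur`,
    -- once M itself is factored.
    had-below : ∀ {L} → Below M L → ∀ x → form (bm (hadL L L)) x x ≤ form (had M M) x x
    had-below {L} (nn , psd) x = ≤-by (+-nonneg (subst (# 0 ≤_) (form-cong {x = x} {y = x}
        (λ i j → cong ((M ⊖ bm L) i j *_) (sym (eqM i j))) (λ _ → refl) (λ _ → refl)) (schur psd nnM x)) (schur psd nn x))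
      (trans (form-cong {x = x} {y = x} (λ i j → trans (solve 2 (λ m b → m :* m := b :* b :+ ((m :- b) :* m :+ (m :- b) :* b))
          refl (M i j) (bm L i j)) (+-congˡ (sym (bm-hadL L L i j)))) (λ _ → refl) (λ _ → refl))
        (trans (form-+ᴹ (bm (hadL L L)) _ x x) (+-congʳ (form-+ᴹ (had (M ⊖ bm L) M) (had (M ⊖ bm L) (bm L)) x x))))
      where
      LM : Rank1s n
      LM = proj₁ (psd-factor M-symm M-psd)
      nnM : NonNeg LM
      nnM = proj₁ (proj₂ (psd-factor M-symm M-psd))
      eqM : ∀ i j → M i j ≡ bm LM i j
      eqM = proj₂ (proj₂ (psd-factor M-symm M-psd))

    -- By Cauchy-Schwarz the trace of b ∘ b is at least (tr b)²/n. It lies below M + δ, and `Reset`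
    -- turns it into factors below M with no more terms.
    squaring : ∀ {L} → Below M L → Σ (Rank1s n) λ L′ → Below M L′ × length L′ ℕ.≤ length L ℕ.* length L ×
      tr (bm L) * tr (bm L) ≤ # n * (tr (bm L′) + δ * # (length L ℕ.* length L))
    squaring {L} below@(nn , psd) = R.L , (Cholesky.cholesky-nonneg M-symm M-psd R.cs , Cholesky.cholesky-psd M-symm M-psd R.cs)
      , subst (length R.L ℕ.≤_) (hadL-length L L) R.reset-length
      , (tr (bm L) * tr (bm L) ≤⟨ sum-square (λ i → bm L i i) ⟩
         # n * sum (λ i → bm L i i * bm L i i) =⟨ cong (# n *_) (sum-cong (λ i → sym (bm-hadL L L i i))) ⟩
         # n * tr (bm (hadL L L)) ≤⟨ *-monoˡ (0≤# n) (≤-by (≤⇒0≤- R.reset-trace)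
             (solve 3 (λ t d l → l :+ d := t :+ (l :- (t :- d))) refl (tr (bm (hadL L L))) (δ * # (length (hadL L L)))
             (tr (bm R.L)))) ⟩
         # n * (tr (bm R.L) + δ * # (length (hadL L L))) =⟨ cong (λ l → # n * (tr (bm R.L) + δ * # l)) (hadL-length L L) ⟩
         # n * (tr (bm R.L) + δ * # (length L ℕ.* length L)) ∎)
      where module R = Reset M-symm M-psd (hadL L L) (hadL-nonneg nn nn) δ 0≤δ (λ x → ≤-trans (had-below below x) (M∘M≤M+δ x))

  Id-diag : ∀ {n} (i : Fin n) → Id i i ≡ # 1
  Id-diag zero = refl
  Id-diag (suc i) = Id-diag i

  Id-off : ∀ {n} (i j : Fin n) → i ≢ j → Id i j ≡ # 0
  Id-off zero zero ne = ⊥-elim (ne refl)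
  Id-off zero (suc j) ne = refl
  Id-off (suc i) zero ne = refl
  Id-off (suc i) (suc j) ne = Id-off i j (λ e → ne (cong suc e))

  -- Entrywise squaring moves only the diagonal, each entry upwards by at most K².
  had-boolean : ∀ {n} {M : Mat n} (K : ℚ) → (∀ i j → i ≢ j → M i j * M i j ≡ M i j) → (∀ i → # 0 ≤ M i i) → (∀ i → M i i ≤ K) →
    ∀ x → form (had M M) x x ≤ form M x x + K * K * dot x x
  had-boolean {n} {M} K off 0≤d d≤K x = form (had M M) x x =⟨ trans (form-cong {x = x} {y = x} entry (λ _ → refl) (λ _ → refl))
      (form-+ᴹ M _ x x) ⟩
    form M x x + form (λ i j → Id i j * e i) x x =⟨ +-congʳ diag ⟩
    form M x x + sum (λ i → e i * (x i * x i)) ≤⟨ +-mono ≤-refl (≤-trans (sum-mono (λ i → *-monoʳ (sq≥0 (x i)) (e≤ i)))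
        (≡⇒≤ (sum-*ˡ (K * K) _))) ⟩
    form M x x + K * K * dot x x ∎
    where
    e : Vect n
    e i = M i i * M i i - M i i
    e≤ : ∀ i → e i ≤ K * K
    e≤ i = ≤-trans (≤-by (0≤d i) (solve 1 (λ a → a :* a := a :* a :- a :+ a) refl (M i i)))
        (*-mono (0≤d i) (0≤d i) (d≤K i) (d≤K i))
    entry : ∀ i j → had M M i j ≡ M i j + Id i j * e i
    entry i j with i F.≟ j
    ... | yes refl = trans (solve 1 (λ a → a :* a := a :+ con (+ 1) :* (a :* a :- a)) refl (M i i))
        (+-congʳ (cong (_* e i) (sym (Id-diag i))))
    ... | no ne = trans (off i j ne) (sym (trans (+-congʳ (trans (cong (_* e i) (Id-off i j ne)) (zeroˡ (e i))))
        (+-identityʳ (M i j))))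
    diag : form (λ i j → Id i j * e i) x x ≡ sum (λ i → e i * (x i * x i))
    diag = sum-cong (λ i → trans (cong (x i *_) (trans (sum-cong (λ j → solve 3 (λ d e y → d :* e :* y := e :* (d :* y)) refl
        (Id i j) (e i) (x j))) (trans (sum-*ˡ (e i) _) (cong (e i *_) (mv-Id x i)))))
      (solve 2 (λ x e → x :* (e :* x) := e :* (x :* x)) refl (x i) (e i)))

  -- The trace bound from iterated squaring

  record Bounded01 {n : ℕ} (K : ℕ) (M : Mat n) : Set where
    field
      symm : Symm M
      psd : PSD M
      off : ∀ i j → i ≢ j → M i j * M i j ≡ M i j
      diag≤ : ∀ i → M i i ≤ # K

    tr≤ : tr M ≤ # n * # K
    tr≤ = ≤-trans (sum-mono diag≤) (≡⇒≤ (sum-const {n} (# K)))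

  module Bootstrap {n : ℕ} {K : ℕ} {M : Mat n} (B : Bounded01 K M) (1≤K : 1 ℕ.≤ K) (K⁸≤n : K ℕ.^ 8 ℕ.≤ n) where
    open Bounded01 B
    open Squaring symm psd (# K * # K) (*-nonneg (0≤# K) (0≤# K)) (had-boolean (# K) off (psd-diag psd) diag≤)

    1≤n : 1 ℕ.≤ n
    1≤n = ℕₚ.≤-trans (ℕₚ.^-monoˡ-≤ 8 1≤K) K⁸≤n

    0<n : # 0 < # n
    0<n = #-mono-< 1≤n

    -- Length x³ and trace n(1 + x) become length (x²)³ and trace n(1 + x²): (1 + x)² exceeds 1 + x²
    -- by 2x ≥ 1, and this surplus pays for the reset error K²x⁶ ≤ K⁸ ≤ n. Here the exponent 8
    -- originates.
    module SquareStep (x : ℕ) (2≤x : 2 ℕ.≤ x) (x≤K : x ℕ.≤ K) (L : Rank1s n) (len : length L ℕ.≤ x ℕ.^ 3)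
        (large : # n * # (1 ℕ.+ x) ≤ tr (bm L))
      (L′ : Rank1s n) (len′ : length L′ ℕ.≤ length L ℕ.* length L) (big : tr (bm L) * tr (bm L) ≤ # n *
          (tr (bm L′) + # K * # K * # (length L ℕ.* length L))) where
      x+1≤x² : x ℕ.+ 1 ℕ.≤ x ℕ.* x
      x+1≤x² = ℕₚ.≤-trans (ℕₚ.+-monoʳ-≤ x (ℕₚ.≤-trans (ℕ.s≤s ℕ.z≤n) 2≤x))
          (ℕₚ.≤-trans (ℕₚ.≤-reflexive (cong (x ℕ.+_) (sym (ℕₚ.+-identityʳ x)))) (ℕₚ.*-monoˡ-≤ x 2≤x))
      len² : length L ℕ.* length L ℕ.≤ (x ℕ.* x) ℕ.^ 3
      len² = ℕₚ.≤-trans (ℕₚ.*-mono-≤ len len) (ℕₚ.≤-reflexive (sym (pow x)))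
        where
        pow : ∀ x → (x ℕ.* x) ℕ.^ 3 ≡ x ℕ.^ 3 ℕ.* x ℕ.^ 3
        pow = NS.solve 1 (λ x → (x NS.:* x) NS.:^ 3 NS.:= x NS.:^ 3 NS.:* x NS.:^ 3) refl
      length′ : length L′ ℕ.≤ (x ℕ.* x) ℕ.^ 3
      length′ = ℕₚ.≤-trans len′ len²
      err : K ℕ.* K ℕ.* (length L ℕ.* length L) ℕ.≤ n
      err = ℕₚ.≤-trans (ℕₚ.*-monoʳ-≤ (K ℕ.* K) (ℕₚ.≤-trans len² (ℕₚ.^-monoˡ-≤ 3 (ℕₚ.*-mono-≤ x≤K x≤K))))
          (ℕₚ.≤-trans (ℕₚ.≤-reflexive (pow K)) K⁸≤n)
        where
        pow : ∀ x → x ℕ.* x ℕ.* (x ℕ.* x) ℕ.^ 3 ≡ x ℕ.^ 8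
        pow = NS.solve 1 (λ x → x NS.:* x NS.:* (x NS.:* x) NS.:^ 3 NS.:= x NS.:^ 8) refl
      T E : ℚ
      T = tr (bm L′)
      E = # K * # K * # (length L ℕ.* length L)
      E≤n : E ≤ # n
      E≤n = ≤-trans (≡⇒≤ (trans (cong (_* # (length L ℕ.* length L)) (sym (#-* K K)))
          (sym (#-* (K ℕ.* K) (length L ℕ.* length L))))) (#-mono err)
      step : # n * (# n * (# (1 ℕ.+ x) * # (1 ℕ.+ x))) ≤ # n * (T + E)
      step = # n * (# n * (# (1 ℕ.+ x) * # (1 ℕ.+ x))) =⟨ solve 2 (λ n y → n :* (n :* (y :* y)) := (n :* y) :* (n :* y)) refl
          (# n) (# (1 ℕ.+ x)) ⟩
        (# n * # (1 ℕ.+ x)) * (# n * # (1 ℕ.+ x)) ≤⟨ *-mono 0≤ 0≤ large large ⟩ tr (bm L) * tr (bm L) ≤⟨ big ⟩ # n * (T + E) ∎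
        where
        0≤ : # 0 ≤ # n * # (1 ℕ.+ x)
        0≤ = *-nonneg (0≤# n) (0≤# (1 ℕ.+ x))
      trace′ : # n * # (1 ℕ.+ x ℕ.* x) ≤ T
      trace′ = # n * # (1 ℕ.+ x ℕ.* x) =⟨ cong (# n *_) (trans (#-+ 1 (x ℕ.* x)) (+-congʳ (#-* x x))) ⟩
        # n * (# 1 + # x * # x) ≤⟨ ≤-by (+-nonneg (+-nonneg (*-nonneg (0≤# n)
            (≤⇒0≤- (≤-trans (#-mono {1} (ℕₚ.≤-trans (ℕ.s≤s ℕ.z≤n) 2≤x)) (≤-by (0≤# x) refl)))) (≤⇒0≤- (*-cancel 0<n step)))
            (≤⇒0≤- E≤n))
          (sym (trans (cong (λ y → # n * (# 1 + # x * # x) + (# n * (# x + # x - # 1) + (T + E - # n * (y * y)) + (# n - E)))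
              (#-+ 1 x))
            (solve 4 (λ n x T E → n :* (con (+ 1) :+ x :* x) :+ (n :* (x :+ x :- con (+ 1)) :+
                (T :+ E :- n :* ((con (+ 1) :+ x) :* (con (+ 1) :+ x))) :+ (n :- E)) := T) refl (# n) (# x) T E))) ⟩
        T ∎


    -- x is squared until it reaches K, where n(1 + x) exceeds the trace of M. As x² ≥ x + 1, `fuel`
    -- keeps bounding the gap K - x.
    no-large-trace′ : ∀ fuel x → 2 ℕ.≤ x → K ℕ.≤ x ℕ.+ fuel → ∀ L → Below M L → length L ℕ.≤ x ℕ.^ 3 → ¬
        (# n * # (1 ℕ.+ x) ≤ tr (bm L))

    no-large-trace-small : ∀ fuel x → 2 ℕ.≤ x → K ℕ.≤ x ℕ.+ fuel → ¬ (K ℕ.≤ x) → ∀ L → Below M L → length L ℕ.≤ x ℕ.^ 3 → ¬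
        (# n * # (1 ℕ.+ x) ≤ tr (bm L))
    no-large-trace-small zero x 2≤x K≤ K≰x L below len large = K≰x (subst (K ℕ.≤_) (ℕₚ.+-identityʳ x) K≤)
    no-large-trace-small (suc fuel) x 2≤x K≤ K≰x L below len large =
      no-large-trace′ fuel (x ℕ.* x) (ℕₚ.≤-trans 2≤x (ℕₚ.≤-trans (ℕₚ.m≤m+n x 1) S.x+1≤x²))
        (ℕₚ.≤-trans K≤ (ℕₚ.≤-trans (ℕₚ.≤-reflexive (sym (ℕₚ.+-assoc x 1 fuel))) (ℕₚ.+-monoˡ-≤ fuel S.x+1≤x²)))
        (proj₁ sq) (proj₁ (proj₂ sq)) S.length′ S.trace′
      where
      sq : Σ (Rank1s n) λ L′ → Below M L′ × length L′ ℕ.≤ length L ℕ.* length L × tr (bm L) * tr (bm L) ≤ # n *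
          (tr (bm L′) + # K * # K * # (length L ℕ.* length L))
      sq = squaring below
      module S = SquareStep x 2≤x (ℕₚ.<⇒≤ (ℕₚ.≰⇒> K≰x)) L len large (proj₁ sq) (proj₁ (proj₂ (proj₂ sq)))
          (proj₂ (proj₂ (proj₂ sq)))

    no-large-trace′ fuel x 2≤x K≤ L below len large with K ℕ.≤? x
    ... | yes K≤x = ≤∧>⇒⊥ (*-cancel 0<n (# n * # (1 ℕ.+ x) ≤⟨ large ⟩ tr (bm L) ≤⟨ below-tr below ⟩ tr M ≤⟨ tr≤ ⟩ # n * # K ≤⟨
        *-monoˡ (0≤# n) (#-mono K≤x) ⟩ # n * # x ∎)) (#-mono-< ℕₚ.≤-refl)
    ... | no K≰x = no-large-trace-small fuel x 2≤x K≤ K≰x L below len large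

    no-large-trace : ∀ x → 2 ℕ.≤ x → ∀ L → Below M L → length L ℕ.≤ x ℕ.^ 3 → ¬ (# n * # (1 ℕ.+ x) ≤ tr (bm L))
    no-large-trace x 2≤x = no-large-trace′ K x 2≤x (ℕₚ.m≤n+m K x)

  -- Greedy low-rank approximation

  frob : ∀ {n} → Mat n → ℚ
  frob N = sum (λ i → dot (N i) (N i))

  UpperBound : ∀ {n} → ℚ → Mat n → Set
  UpperBound λ₀ N = ∀ c → form N c c ≤ λ₀ * dot c c

  -- Cauchy-Schwarz for row r = N e_i against e_i gives (r · r)² ≤ N(r, r) N_ii ≤ `λ₀` (r · r) N_ii;
  -- cancel r · r and sum over i.
  frob≤tr : ∀ {n} {N : Mat n} {λ₀} → Symm N → PSD N → # 0 ≤ λ₀ → UpperBound λ₀ N → frob N ≤ λ₀ * tr N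
  frob≤tr {n} {N} {λ₀} sy psd 0≤λ ub = ≤-trans (sum-mono row) (≡⇒≤ (sum-*ˡ λ₀ _))
    where
    row : ∀ i → dot (N i) (N i) ≤ λ₀ * N i i
    row i = subst (_≤ λ₀ * N i i) (dot-cong r≡ r≡) rr
      where
      r : Vect n
      r = mv N (Id i)
      r≡ : ∀ j → r j ≡ N i j
      r≡ j = trans (mv-column N j i) (sy j i)
      rr : dot r r ≤ λ₀ * N i i
      rr with dot r r ≟ # 0
      ... | yes e = dot r r =⟨ e ⟩ # 0 ≤⟨ *-nonneg 0≤λ (psd-diag psd i) ⟩ λ₀ * N i i ∎
      ... | no ne = *-cancel (nonneg≢0⇒pos (dot-self r) ne) (
        dot r r * dot r r ≤⟨ cauchy-schwarz sy psd r (Id i) ⟩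
        form N r r * form N (Id i) (Id i) ≤⟨ *-mono (psd r) (psd (Id i)) (ub r) ≤-refl ⟩
        λ₀ * dot r r * form N (Id i) (Id i) =⟨ trans (cong (λ₀ * dot r r *_) (form-column N i))
            (solve 3 (λ l d m → l :* d :* m := d :* (l :* m)) refl λ₀ (dot r r) (N i i)) ⟩
        dot r r * (λ₀ * N i i) ∎)

  frob-upd : ∀ {n} (M : Mat n) g w L → frob (M ⊖ bm L) ≤ frob (M ⊖ bm ((g , w) ∷ L)) + # 2 * w * form (M ⊖ bm L) g g
  frob-upd {n} M g w L = ≤-trans (sum-mono (λ i → sum-mono (λ j → entry i j))) (≡⇒≤
    (trans (sum-cong (λ i → sum-+ (λ j → N′ i j * N′ i j) (λ j → # 2 * w * (N i j * (g i * g j)))))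
        (trans (sum-+ (λ i → dot (N′ i) (N′ i)) _)
      (+-congʳ (trans (sum-cong (λ i → sum-*ˡ (# 2 * w) (λ j → N i j * (g i * g j))))
          (trans (sum-*ˡ (# 2 * w) _) (cong (# 2 * w *_) (sym (form-sum N g g)))))))))
    where
    N N′ : Mat n
    N = M ⊖ bm L
    N′ = M ⊖ bm ((g , w) ∷ L)
    entry : ∀ i j → N i j * N i j ≤ N′ i j * N′ i j + # 2 * w * (N i j * (g i * g j))
    entry i j = ≤-by (sq≥0 (w * (g i * g j))) (solve 4 (λ m b w p → (m :- (w :* p :+ b)) :* (m :- (w :* p :+ b)) :+ con (+ 2) :*
        w :* ((m :- b) :* p) := (m :- b) :* (m :- b) :+ (w :* p) :* (w :* p)) refl (M i j) (bm L i j) w (g i * g j))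

  tr-∷ : ∀ {n} g w (L : Rank1s n) → tr (bm ((g , w) ∷ L)) ≡ w * dot g g + tr (bm L)
  tr-∷ g w L = trans (tr-bm ((g , w) ∷ L)) (cong₂ _+_ (cong (w *_) (form-Id g g)) (sym (tr-bm L)))

  -- Whether some direction violates a bound is not decidable. Excluded middle is available when the
  -- goal is `⊥`, hence the continuation style of the greedy construction.
  em : ∀ {P : Set} → (Dec P → ⊥) → ⊥
  em k = k (no (λ p → k (yes p)))

  -- The outcome of at most `N` greedy steps, each worth at least `λ₀` of trace. `loss` allows any
  -- bound `Λ` on the initial remainder, because it is applied with the previous, coarser level.
  record Extension {n} (M : Mat n) (L : Rank1s n) (N : ℕ) (λ₀ : ℚ) : Set where
    field
      L′ : Rank1s n
      below : Below M L′
      len : length L′ ℕ.≤ length L ℕ.+ N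
      tr-mono : tr (bm L) ≤ tr (bm L′)
      loss : ∀ Λ → UpperBound Λ (M ⊖ bm L) → frob (M ⊖ bm L) ≤ frob (M ⊖ bm L′) + # 2 * Λ * (tr (bm L′) - tr (bm L))
      outcome : UpperBound λ₀ (M ⊖ bm L′) ⊎ tr (bm L) + # N * λ₀ ≤ tr (bm L′)

  module Greedy {n} {M : Mat n} (M-symm : Symm M) (λ₀ : ℚ) (0≤λ : # 0 ≤ λ₀) where
    stop : ∀ N L → Below M L → UpperBound λ₀ (M ⊖ bm L) ⊎ tr (bm L) + # N * λ₀ ≤ tr (bm L) → Extension M L N λ₀
    stop N L b o = record { L′ = L ; below = b ; len = ℕₚ.m≤m+n (length L) N ; tr-mono = ≤-refl
      ; loss = λ Λ _ → ≡⇒≤ (solve 3 (λ f l t → f := f :+ con (+ 2) :* l :* (t :- t)) refl (frob (M ⊖ bm L)) Λ (tr (bm L))) ;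
          outcome = o }

    module Add (L : Rank1s n) (b : Below M L) (c : Vect n) (viol : λ₀ * dot c c < form (M ⊖ bm L) c c) where
      α>0 : # 0 < form (M ⊖ bm L) c c
      α>0 = ≤-<-trans (*-nonneg 0≤λ (dot-self c)) viol
      open Pivot M-symm L (proj₂ b) c α>0 public renaming (L′ to L⁺)
      below⁺ : Below M L⁺
      below⁺ = (<⇒≤ 0<w ∷ proj₁ b) , pivot-psd
      0≤gain : # 0 ≤ w * dot g g
      0≤gain = *-nonneg (<⇒≤ 0<w) (dot-self g)
      c·c>0 : # 0 < dot c c
      c·c>0 = nonneg≢0⇒pos (dot-self c) (λ e → pos⇒≢0 α>0 (trans (sum-cong (λ i → cong (_* g i) (dot-self≡0 e i)))
          (sum-≡0 (λ i → zeroˡ (g i)))))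
      -- Since α = c · g, Cauchy-Schwarz gives α² ≤ (c · c)(g · g), while the violation says α >
      -- `λ₀` (c · c); so the gained trace (g · g)/α is at least `λ₀`.
      λ≤gain : λ₀ ≤ w * dot g g
      λ≤gain = *-cancel α>0 (α * λ₀ ≤⟨ *-cancel c·c>0 step ⟩ dot g g =⟨ trans (sym (*-identityˡ _))
          (trans (cong (_* dot g g) (sym (inv-posʳ α>0))) (*-assoc α w (dot g g))) ⟩ α * (w * dot g g) ∎)
        where
        step : dot c c * (α * λ₀) ≤ dot c c * dot g g
        step = dot c c * (α * λ₀) =⟨ solve 3 (λ c a l → c :* (a :* l) := (l :* c) :* a) refl (dot c c) α λ₀ ⟩
          λ₀ * dot c c * α ≤⟨ *-monoʳ (<⇒≤ α>0) (<⇒≤ viol) ⟩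
          α * α =⟨ cong₂ _*_ (sym (form-Id c g)) (sym (form-Id c g)) ⟩
          form Id c g * form Id c g ≤⟨ cauchy-schwarz Id-symm Id-psd c g ⟩
          form Id c c * form Id g g =⟨ cong₂ _*_ (form-Id c c) (form-Id g g) ⟩
          dot c c * dot g g ∎
      ub⁺ : ∀ Λ → UpperBound Λ (M ⊖ bm L) → UpperBound Λ (M ⊖ bm L⁺)
      ub⁺ Λ ub x = ≤-trans (≤-by (*-nonneg (<⇒≤ 0<w) (sq≥0 (dot g x))) (trans
          (solve 2 (λ f d → f := f :- d :+ d) refl (form (M ⊖ bm L) x x) (w * (dot g x * dot g x)))
          (+-congˡ (sym (upd-form M g w L x x))))) (ub x)
      loss⁺ : ∀ Λ → UpperBound Λ (M ⊖ bm L) → frob (M ⊖ bm L) ≤ frob (M ⊖ bm L⁺) + # 2 * Λ * (w * dot g g)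
      loss⁺ Λ ub = ≤-trans (frob-upd M g w L) (+-mono ≤-refl (≤-trans (*-monoˡ (*-nonneg (0≤# 2) (<⇒≤ 0<w)) (ub g))
          (≡⇒≤ (solve 4 (λ t w l d → t :* w :* (l :* d) := t :* l :* (w :* d)) refl (# 2) w Λ (dot g g)))))
      tr⁺ : tr (bm L⁺) ≡ w * dot g g + tr (bm L)
      tr⁺ = tr-∷ g w L

      combine : ∀ {N} → Extension M L⁺ N λ₀ → Extension M L (suc N) λ₀
      combine {N} E = record { L′ = E.L′ ; below = E.below ; len = ℕₚ.≤-trans E.len
          (ℕₚ.≤-reflexive (sym (ℕₚ.+-suc (length L) N)))
        ; tr-mono = ≤-trans (≤-by 0≤gain (trans tr⁺ (+-comm _ _))) E.tr-mono
        ; loss = λ Λ ub → ≤-trans (loss⁺ Λ ub) (≤-trans (+-mono (E.loss Λ (ub⁺ Λ ub)) ≤-refl)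
            (≡⇒≤ (trans (cong (λ t → frob (M ⊖ bm E.L′) + # 2 * Λ * (tr (bm E.L′) - t) + # 2 * Λ * (w * dot g g)) tr⁺)
            (solve 5 (λ f l t′ d t → f :+ con (+ 2) :* l :* (t′ :- (d :+ t)) :+ con (+ 2) :* l :* d := f :+ con (+ 2) :* l :*
                (t′ :- t)) refl (frob (M ⊖ bm E.L′)) Λ (tr (bm E.L′)) (w * dot g g) (tr (bm L))))))
        ; outcome = out E.outcome }
        where
        module E = Extension E
        out : UpperBound λ₀ (M ⊖ bm E.L′) ⊎ tr (bm L⁺) + # N * λ₀ ≤ tr (bm E.L′) → UpperBound λ₀ (M ⊖ bm E.L′) ⊎ tr (bm L) + #
            (suc N) * λ₀ ≤ tr (bm E.L′)
        out (inj₁ u) = inj₁ u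
        out (inj₂ t) = inj₂ (≤-trans (≤-by (≤⇒0≤- λ≤gain) (trans (cong (_+ # N * λ₀) tr⁺)
            (sym (trans (cong (λ m → tr (bm L) + m * λ₀ + (w * dot g g - λ₀)) (#-+ 1 N))
          (solve 4 (λ t N l d → t :+ (con (+ 1) :+ N) :* l :+ (d :- l) := d :+ t :+ N :* l) refl (tr (bm L)) (# N) λ₀
              (w * dot g g)))))) t)

    greedy : ∀ N L → Below M L → (Extension M L N λ₀ → ⊥) → ⊥
    greedy zero L b k = k (stop zero L b (inj₂ (≡⇒≤ (solve 2 (λ t l → t :+ con (+ 0) :* l := t) refl (tr (bm L)) λ₀))))
    greedy (suc N) L b k = em {P = Σ (Vect n) λ c → λ₀ * dot c c < form (M ⊖ bm L) c c} λ where
      (no h) → k (stop (suc N) L b (inj₁ (λ c → ≮⇒≥ (λ v → h (c , v)))))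
      (yes (c , viol)) → greedy N (Add.L⁺ L b c viol) (Add.below⁺ L b c viol) (λ E → k (Add.combine L b c viol E))

  -- Numerical conclusions leave the continuation style here, as the order is decidable.
  ¬¬≤ : ∀ {x y} → ((x ≤ y → ⊥) → ⊥) → x ≤ y
  ¬¬≤ {x} {y} h with x ≤? y
  ... | yes p = p
  ... | no np = ⊥-elim (h np)

  module LowRank {n : ℕ} {K : ℕ} {M : Mat n} (B : Bounded01 K M) (1≤K : 1 ℕ.≤ K) (K⁸≤n : K ℕ.^ 8 ℕ.≤ n) where
    open Bounded01 B
    open Bootstrap B 1≤K K⁸≤n

    -- y³ directions have trace at most about ny, so a direction is worth about n/y². The factor 4
    -- makes y³ steps at this level overshoot n(1 + y).
    lev : ℕ → ℚ
    lev y = # 4 * # n * inv (# y * # y)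

    module _ (y : ℕ) (2≤y : 2 ℕ.≤ y) where
      0<y : # 0 < # y
      0<y = #-mono-< (ℕₚ.≤-trans (ℕ.s≤s ℕ.z≤n) 2≤y)
      0<y² : # 0 < # y * # y
      0<y² = *-pos 0<y 0<y
      0≤lev : # 0 ≤ lev y
      0≤lev = *-nonneg (*-nonneg (0≤# 4) (0≤# n)) (<⇒≤ (inv-pos 0<y²))
      y²lev : # y * # y * lev y ≡ # 4 * # n
      y²lev = trans (solve 3 (λ q n i → q :* (con (+ 4) :* n :* i) := q :* i :* (con (+ 4) :* n)) refl (# y * # y) (# n)
          (inv (# y * # y))) (trans (cong (_* (# 4 * # n)) (inv-posʳ 0<y²)) (*-identityˡ _))

    trace-bound : ∀ x → 2 ℕ.≤ x → ∀ {L} → Below M L → length L ℕ.≤ x ℕ.^ 3 → tr (bm L) ≤ # n * # (1 ℕ.+ x)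
    trace-bound x 2≤x {L} b len with ≤-total (tr (bm L)) (# n * # (1 ℕ.+ x))
    ... | inj₁ p = p
    ... | inj₂ p = ⊥-elim (no-large-trace x 2≤x L b len p)

    -- The remainder at scale y is compared with an extension to scale 2y. The loss is at most 2 ·
    -- (4n/y²) · 3ny = 24n²/y, and the claim at 2y contributes 32n²/y, within 64n²/y. The recursion
    -- ends at y ≥ K, where the trace bound nK is good enough.
    tail : ∀ fuel y → 2 ℕ.≤ y → K ℕ.≤ y ℕ.+ fuel → ∀ L → Below M L → length L ℕ.≤ y ℕ.^ 3 → UpperBound (lev y) (M ⊖ bm L) → # y
        * frob (M ⊖ bm L) ≤ # 64 * (# n * # n)
    tail-base : ∀ y → 2 ℕ.≤ y → K ℕ.≤ y → ∀ L → Below M L → UpperBound (lev y) (M ⊖ bm L) → # y * frob (M ⊖ bm L) ≤ # 64 *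
        (# n * # n)
    tail-base y 2≤y K≤y L b ub = *-cancel (0<y y 2≤y) (
      # y * (# y * frob (M ⊖ bm L)) ≤⟨ *-monoˡ (0≤# y) (*-monoˡ (0≤# y)
          (frob≤tr (⊖-symm symm (bm-symm L)) (proj₂ b) (0≤lev y 2≤y) ub)) ⟩
      # y * (# y * (lev y * tr (M ⊖ bm L))) =⟨ trans (solve 3 (λ y l t → y :* (y :* (l :* t)) := y :* y :* l :* t) refl (# y)
          (lev y) (tr (M ⊖ bm L))) (cong (_* tr (M ⊖ bm L)) (y²lev y 2≤y)) ⟩
      # 4 * # n * tr (M ⊖ bm L) ≤⟨ *-monoˡ (*-nonneg (0≤# 4) (0≤# n)) trace ⟩
      # 4 * # n * (# n * # y) ≤⟨ ≤-by (*-nonneg (0≤# 60) (*-nonneg (0≤# y) (*-nonneg (0≤# n) (0≤# n))))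
          (solve 2 (λ n y → y :* (con (+ 64) :* (n :* n)) := con (+ 4) :* n :* (n :* y) :+ con (+ 60) :* (y :* (n :* n))) refl
          (# n) (# y)) ⟩
      # y * (# 64 * (# n * # n)) ∎)
      where
      trace : tr (M ⊖ bm L) ≤ # n * # y
      trace = tr (M ⊖ bm L) =⟨ sum-- (λ i → M i i) (λ i → bm L i i) ⟩ tr M - tr (bm L)
        ≤⟨ ≤-by (sum-nonneg (psd-diag (bm-psd (proj₁ b)))) (solve 2 (λ m b → m := m :- b :+ b) refl (tr M) (tr (bm L))) ⟩ tr M
            ≤⟨ tr≤ ⟩ # n * # K ≤⟨ *-monoˡ (0≤# n) (#-mono K≤y) ⟩ # n * # y ∎

    module Doubling (y : ℕ) (2≤y : 2 ℕ.≤ y) (L : Rank1s n) (b : Below M L) (len : length L ℕ.≤ y ℕ.^ 3)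
        (ub : UpperBound (lev y) (M ⊖ bm L))
      (E : Extension M L (4 ℕ.* y ℕ.^ 3) (lev (2 ℕ.* y))) where
      module E = Extension E
      2≤2y : 2 ℕ.≤ 2 ℕ.* y
      2≤2y = ℕₚ.≤-trans 2≤y (ℕₚ.m≤m+n y _)
      cube : ∀ y → (2 ℕ.* y) ℕ.^ 3 ≡ y ℕ.^ 3 ℕ.+ 4 ℕ.* y ℕ.^ 3 ℕ.+ 3 ℕ.* y ℕ.^ 3
      cube = NS.solve 1 (λ y → (NS.con 2 NS.:* y) NS.:^ 3 NS.:= y NS.:^ 3 NS.:+ NS.con 4 NS.:* y NS.:^ 3 NS.:+ NS.con 3 NS.:* y
          NS.:^ 3) refl
      len⁺ : length E.L′ ℕ.≤ (2 ℕ.* y) ℕ.^ 3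
      len⁺ = ℕₚ.≤-trans E.len (ℕₚ.≤-trans (ℕₚ.+-monoˡ-≤ _ len) (ℕₚ.≤-trans (ℕₚ.m≤m+n _ (3 ℕ.* y ℕ.^ 3))
          (ℕₚ.≤-reflexive (sym (cube y)))))
      -- 4y³ · 4n/(2y)² = 4ny
      added : # (4 ℕ.* y ℕ.^ 3) * lev (2 ℕ.* y) ≡ # n * # (4 ℕ.* y)
      added = trans (cong (_* lev (2 ℕ.* y)) (trans (cong # (pow y)) (trans (#-* y (2 ℕ.* y ℕ.* (2 ℕ.* y)))
          (cong (# y *_) (#-* (2 ℕ.* y) (2 ℕ.* y))))))
        (trans (*-assoc (# y) _ _) (trans (cong (# y *_) (y²lev (2 ℕ.* y) 2≤2y))
            (trans (solve 2 (λ y n → y :* (con (+ 4) :* n) := n :* (con (+ 4) :* y)) refl (# y) (# n))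
            (cong (# n *_) (sym (#-* 4 y))))))
        where
        pow : ∀ y → 4 ℕ.* y ℕ.^ 3 ≡ y ℕ.* (2 ℕ.* y ℕ.* (2 ℕ.* y))
        pow = NS.solve 1 (λ y → NS.con 4 NS.:* y NS.:^ 3 NS.:= y NS.:* (NS.con 2 NS.:* y NS.:* (NS.con 2 NS.:* y))) refl
      1+2y≤ : 1 ℕ.+ 2 ℕ.* y ℕ.≤ 3 ℕ.* y
      1+2y≤ = ℕₚ.+-monoˡ-≤ (2 ℕ.* y) (ℕₚ.≤-trans (ℕ.s≤s ℕ.z≤n) 2≤y)
      0≤tr : # 0 ≤ tr (bm L)
      0≤tr = sum-nonneg (psd-diag (bm-psd (proj₁ b)))
      -- Using up all steps would push the trace beyond n(1 + 2y), against `no-large-trace`; so the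
      -- run stopped because no direction was left above the level.
      ub⁺ : UpperBound (lev (2 ℕ.* y)) (M ⊖ bm E.L′)
      ub⁺ with E.outcome
      ... | inj₁ u = u
      ... | inj₂ t = ⊥-elim (no-large-trace (2 ℕ.* y) 2≤2y E.L′ E.below len⁺
          (≤-trans (*-monoˡ (0≤# n) (#-mono (ℕₚ.≤-trans 1+2y≤ (ℕₚ.*-monoˡ-≤ y (ℕₚ.n≤1+n 3)))))
          (≤-trans (≤-trans (≡⇒≤ (sym added)) (≤-by 0≤tr (+-comm _ _))) t)))
      gain≤ : tr (bm E.L′) - tr (bm L) ≤ # 3 * (# n * # y)
      gain≤ = ≤-trans (≤-by 0≤tr (solve 2 (λ m b → m := m :- b :+ b) refl (tr (bm E.L′)) (tr (bm L))))
          (≤-trans (trace-bound (2 ℕ.* y) 2≤2y E.below len⁺)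
        (≤-trans (*-monoˡ (0≤# n) (#-mono 1+2y≤)) (≡⇒≤ (trans (cong (# n *_) (#-* 3 y))
            (solve 2 (λ n y → n :* (con (+ 3) :* y) := con (+ 3) :* (n :* y)) refl (# n) (# y))))))
      conclude : # (2 ℕ.* y) * frob (M ⊖ bm E.L′) ≤ # 64 * (# n * # n) → # y * frob (M ⊖ bm L) ≤ # 64 * (# n * # n)
      conclude ih = *-cancel (0<#suc 1) (
        # 2 * (# y * frob (M ⊖ bm L)) ≤⟨ *-monoˡ (0≤# 2) (*-monoˡ (0≤# y) (E.loss (lev y) ub)) ⟩
        # 2 * (# y * (f′ + # 2 * lev y * d)) =⟨ solve 4 (λ y f l d → con (+ 2) :* (y :* (f :+ con (+ 2) :* l :* d)) := con (+ 2)
            :* y :* f :+ con (+ 4) :* (y :* (l :* d))) refl (# y) f′ (lev y) d ⟩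
        # 2 * # y * f′ + # 4 * (# y * (lev y * d)) ≤⟨ +-mono (≤-trans (≡⇒≤ (cong (_* f′) (sym (#-* 2 y)))) ih)
            (*-monoˡ (0≤# 4) lossb) ⟩
        # 64 * (# n * # n) + # 4 * (# 12 * (# n * # n)) ≤⟨ ≤-by (*-nonneg (0≤# 16) (*-nonneg (0≤# n) (0≤# n)))
            (solve 1 (λ p → con (+ 2) :* (con (+ 64) :* p) := con (+ 64) :* p :+ con (+ 4) :* (con (+ 12) :* p) :+ con (+ 16) :*
            p) refl (# n * # n)) ⟩
        # 2 * (# 64 * (# n * # n)) ∎)
        where
        f′ d : ℚ
        f′ = frob (M ⊖ bm E.L′)
        d = tr (bm E.L′) - tr (bm L)
        lossb : # y * (lev y * d) ≤ # 12 * (# n * # n)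
        lossb = *-cancel (0<y y 2≤y) (
          # y * (# y * (lev y * d)) =⟨ trans (solve 3 (λ y l t → y :* (y :* (l :* t)) := y :* y :* l :* t) refl (# y) (lev y) d)
              (cong (_* d) (y²lev y 2≤y)) ⟩
          # 4 * # n * d ≤⟨ *-monoˡ (*-nonneg (0≤# 4) (0≤# n)) gain≤ ⟩
          # 4 * # n * (# 3 * (# n * # y)) =⟨ solve 2 (λ n y → con (+ 4) :* n :* (con (+ 3) :* (n :* y)) := y :*
              (con (+ 12) :* (n :* n))) refl (# n) (# y) ⟩
          # y * (# 12 * (# n * # n)) ∎)

    tail fuel y 2≤y K≤ L b len ub with K ℕ.≤? y
    ... | yes K≤y = tail-base y 2≤y K≤y L b ub
    tail zero y 2≤y K≤ L b len ub | no K≰y = ⊥-elim (K≰y (subst (K ℕ.≤_) (ℕₚ.+-identityʳ y) K≤))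
    tail (suc fuel) y 2≤y K≤ L b len ub | no K≰y = ¬¬≤ λ k → Greedy.greedy symm (lev (2 ℕ.* y))
        (0≤lev (2 ℕ.* y) (ℕₚ.≤-trans 2≤y (ℕₚ.m≤m+n y _))) (4 ℕ.* y ℕ.^ 3) L b
      λ E → k (Doubling.conclude y 2≤y L b len ub E (tail fuel (2 ℕ.* y) (Doubling.2≤2y y 2≤y L b len ub E)
        (ℕₚ.≤-trans K≤ (ℕₚ.≤-trans (ℕₚ.≤-reflexive (ℕₚ.+-suc y fuel)) (ℕₚ.+-monoˡ-≤ fuel
            (ℕₚ.≤-trans (ℕₚ.+-monoˡ-≤ y (ℕₚ.≤-trans (ℕ.s≤s ℕ.z≤n) 2≤y))
            (ℕₚ.≤-reflexive (cong (y ℕ.+_) (sym (ℕₚ.+-identityʳ y))))))))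
        _ (Extension.below E) (Doubling.len⁺ y 2≤y L b len ub E) (Doubling.ub⁺ y 2≤y L b len ub E)))

    record Approximation (x : ℕ) : Set where
      field
        L : Rank1s n
        below : Below M L
        len : length L ℕ.≤ x ℕ.^ 3
        error : # x * frob (M ⊖ bm L) ≤ # 64 * (# n * # n)
        trace≤ : tr (bm L) ≤ # n * # (1 ℕ.+ x)

    approximation : ∀ x → 2 ℕ.≤ x → (Approximation x → ⊥) → ⊥
    approximation x 2≤x k = Greedy.greedy symm (lev x) (0≤lev x 2≤x) (x ℕ.^ 3) [] ([] , ⊖[]-psd psd) λ E → k (record
      { L = Extension.L′ E ; below = Extension.below E ; len = Extension.len E
      ; error = tail K x 2≤x (ℕₚ.m≤n+m K x) (Extension.L′ E) (Extension.below E) (Extension.len E) (ub E)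
      ; trace≤ = trace-bound x 2≤x (Extension.below E) (Extension.len E) })
      where
      ub : (E : Extension M [] (x ℕ.^ 3) (lev x)) → UpperBound (lev x) (M ⊖ bm (Extension.L′ E))
      ub E with Extension.outcome E
      ... | inj₁ u = u
      ... | inj₂ t = ⊥-elim (no-large-trace x 2≤x (Extension.L′ E) (Extension.below E) (Extension.len E) (
        # n * # (1 ℕ.+ x) ≤⟨ *-monoˡ (0≤# n) (#-mono (ℕₚ.≤-trans (ℕₚ.+-monoˡ-≤ x (ℕₚ.≤-trans (ℕ.s≤s ℕ.z≤n) 2≤x))
            (ℕₚ.+-monoʳ-≤ x (ℕₚ.m≤m+n x _)))) ⟩
        # n * # (4 ℕ.* x) =⟨ sym (trans (cong (_* lev x) (trans (cong # (pow x))
            (trans (#-* x (x ℕ.* x)) (cong (# x *_) (#-* x x))))) (trans (*-assoc (# x) _ _)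
            (trans (cong (# x *_) (y²lev x 2≤x)) (trans (solve 2 (λ y n → y :* (con (+ 4) :* n) := n :* (con (+ 4) :* y)) refl
            (# x) (# n)) (cong (# n *_) (sym (#-* 4 x))))))) ⟩
        # (x ℕ.^ 3) * lev x =⟨ sym (+-identityˡ _) ⟩
        # 0 + # (x ℕ.^ 3) * lev x =⟨ +-congˡ (sym (sum-zero {n})) ⟩
        tr (bm []) + # (x ℕ.^ 3) * lev x ≤⟨ t ⟩
        tr (bm (Extension.L′ E)) ∎))
        where
        pow : ∀ x → x ℕ.^ 3 ≡ x ℕ.* (x ℕ.* x)
        pow x = cong (λ u → x ℕ.* (x ℕ.* u)) (ℕₚ.*-identityʳ x)

  -- Rational square roots and buckets

  isqrt : ∀ m → Σ ℕ λ k → (k ℕ.* k ℕ.≤ m) × (m ℕ.< suc k ℕ.* suc k)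
  isqrt zero = 0 , ℕ.z≤n , ℕ.s≤s ℕ.z≤n
  isqrt (suc m) with isqrt m
  ... | k , lo , hi with suc m ℕ.<? suc k ℕ.* suc k
  ... | yes p = k , ℕₚ.m≤n⇒m≤1+n lo , p
  ... | no np = suc k , ℕₚ.≮⇒≥ np , ℕₚ.<-≤-trans (ℕ.s≤s hi) (ℕₚ.*-mono-< (ℕₚ.n<1+n (suc k)) (ℕₚ.n<1+n (suc k)))

  ι-nonneg : ∀ p → # 0 ≤ ι p → Σ ℕ λ m → p ≡ + m
  ι-nonneg (+ m) _ = m , refl
  ι-nonneg -[1+ m ] h = ⊥-elim (≤∧>⇒⊥ h (ι-mono-< ℤ.-<+))

  -- A square root up to a factor 2. Over the denominator Q, a = `m′`/Q² and r = k/Q with k the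
  -- integer root of `m′`; k ≥ 1 gives (k + 1)² ≤ 4k².
  √≈ : ∀ {a} → # 0 < a → Σ ℚ λ r → (# 0 < r) × (r * r ≤ a) × (a ≤ # 4 * (r * r))
  √≈ {a} 0<a = # k * t , *-pos (#-mono-< 1≤k) (inv-pos 0<Q)
      , *-cancel 0<Q² (Q * Q * (# k * t * (# k * t)) =⟨ kt ⟩ # (k ℕ.* k) ≤⟨ #-mono lo ⟩ # m′ =⟨ sym aQ² ⟩ Q * Q * a ∎)
      , *-cancel 0<Q² (Q * Q * a =⟨ aQ² ⟩ # m′ ≤⟨ #-mono (ℕₚ.≤-trans (ℕₚ.<⇒≤ hi) sq4) ⟩ # (4 ℕ.* (k ℕ.* k)) =⟨ trans
          (#-* 4 (k ℕ.* k)) (trans (cong (# 4 *_) (sym kt)) (solve 2 (λ q r → con (+ 4) :* (q :* r) := q :* (con (+ 4) :* r))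
          refl (Q * Q) (# k * t * (# k * t)))) ⟩ Q * Q * (# 4 * (# k * t * (# k * t))) ∎)
    where
    fr : Σ ℤ λ p → Σ ℕ λ q → a * # (suc q) ≡ ι p
    fr = fraction a
    q : ℕ
    q = proj₁ (proj₂ fr)
    Q : ℚ
    Q = # (suc q)
    0<Q : # 0 < Q
    0<Q = 0<#suc q
    0<Q² : # 0 < Q * Q
    0<Q² = *-pos 0<Q 0<Q
    nat : Σ ℕ λ m → proj₁ fr ≡ + m
    nat = ι-nonneg (proj₁ fr) (subst (# 0 ≤_) (proj₂ (proj₂ fr)) (*-nonneg (<⇒≤ 0<a) (<⇒≤ 0<Q)))
    m m′ : ℕ
    m = proj₁ nat
    m′ = m ℕ.* suc q
    aQ : a * Q ≡ # m
    aQ = trans (proj₂ (proj₂ fr)) (cong ι (proj₂ nat))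
    aQ² : Q * Q * a ≡ # m′
    aQ² = trans (solve 2 (λ q a → q :* q :* a := a :* q :* q) refl Q a) (trans (cong (_* Q) aQ) (sym (#-* m (suc q))))
    k : ℕ
    k = proj₁ (isqrt m′)
    lo : k ℕ.* k ℕ.≤ m′
    lo = proj₁ (proj₂ (isqrt m′))
    hi : m′ ℕ.< suc k ℕ.* suc k
    hi = proj₂ (proj₂ (isqrt m′))
    t : ℚ
    t = inv Q
    kt : Q * Q * (# k * t * (# k * t)) ≡ # (k ℕ.* k)
    kt = trans (solve 3 (λ q k t → q :* q :* (k :* t :* (k :* t)) := q :* t :* (q :* t) :* (k :* k)) refl Q (# k) t)
        (trans (cong (λ u → u * u * (# k * # k)) (inv-posʳ 0<Q)) (trans
        (solve 1 (λ k → con (+ 1) :* con (+ 1) :* k := k) refl (# k * # k)) (sym (#-* k k))))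
    1≤m′ : 1 ℕ.≤ m′
    1≤m′ with m′ ℕ.≤? 0
    ... | no h = ℕₚ.≰⇒> h
    ... | yes h = ⊥-elim (≤∧>⇒⊥ (≤-trans (≡⇒≤ aQ²) (#-mono h)) (*-pos 0<Q² 0<a))
    1≤k : 1 ℕ.≤ k
    1≤k with k ℕ.≟ 0
    ... | no h = ℕₚ.n≢0⇒n>0 h
    ... | yes h = ⊥-elim (ℕₚ.<⇒≱ (subst (λ j → m′ ℕ.< suc j ℕ.* suc j) h hi) 1≤m′)
    sq4 : suc k ℕ.* suc k ℕ.≤ 4 ℕ.* (k ℕ.* k)
    sq4 = ℕₚ.≤-trans (ℕₚ.*-mono-≤ k+1≤2k k+1≤2k) (ℕₚ.≤-reflexive (NS.solve 1
        (λ k → (k NS.:+ k) NS.:* (k NS.:+ k) NS.:= NS.con 4 NS.:* (k NS.:* k)) refl k))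
      where
      k+1≤2k : suc k ℕ.≤ k ℕ.+ k
      k+1≤2k = ℕₚ.+-monoˡ-≤ k 1≤k

  In : ℚ → ℚ → Set
  In a x = (- a ≤ x) × (x ≤ a)

  In-+ : ∀ {a b x y} → In a x → In b y → In (a + b) (x + y)
  In-+ {a} {b} (p , q) (r , s) = ≤-trans (≡⇒≤ (solve 2 (λ a b → :- (a :+ b) := :- a :+ :- b) refl a b)) (+-mono p r) , +-mono q
      s

  In-* : ∀ {a b x y} → In a x → In b y → In (a * b) (x * y)
  In-* {a} {b} {x} {y} (p , q) (r , s) =
      *-cancel (0<#suc 1) (≤-by (+-nonneg (*-nonneg a-x b-y) (*-nonneg a+x b+y))
          (solve 4 (λ a b x y → con (+ 2) :* (x :* y) := con (+ 2) :* (:- (a :* b)) :+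
          ((a :- x) :* (b :- y) :+ (a :+ x) :* (b :+ y))) refl a b x y))
    , *-cancel (0<#suc 1) (≤-by (+-nonneg (*-nonneg a-x b+y) (*-nonneg a+x b-y))
        (solve 4 (λ a b x y → con (+ 2) :* (a :* b) := con (+ 2) :* (x :* y) :+ ((a :- x) :* (b :+ y) :+ (a :+ x) :* (b :- y)))
        refl a b x y))
    where
    a-x : # 0 ≤ a - x
    a-x = ≤⇒0≤- q
    b-y : # 0 ≤ b - y
    b-y = ≤⇒0≤- s
    a+x : # 0 ≤ a + x
    a+x = subst (# 0 ≤_) (solve 2 (λ a x → x :- (:- a) := a :+ x) refl a x) (≤⇒0≤- p)
    b+y : # 0 ≤ b + y
    b+y = subst (# 0 ≤_) (solve 2 (λ a x → x :- (:- a) := a :+ x) refl b y) (≤⇒0≤- r)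

  sq≤⇒≤ : ∀ {c x} → # 0 ≤ c → x * x ≤ c * c → x ≤ c
  sq≤⇒≤ {c} {x} 0≤c h = ≮⇒≥ λ c<x → ≤∧>⇒⊥ h (<-≤-trans (subst (c * c <_)
      (solve 2 (λ c x → (x :- c) :* (x :- c) :+ c :* c := x :* x :+ con (+ 2) :* c :* (c :- x)) refl c x)
      (subst (_< (x - c) * (x - c) + c * c) (+-identityˡ (c * c)) (+-mono-<-≤ (*-pos (<⇒0<- c<x) (<⇒0<- c<x)) ≤-refl)))
    (≤-by (*-nonneg (*-nonneg (0≤# 2) 0≤c) (≤⇒0≤- (<⇒≤ c<x))) (solve 2 (λ c x → x :* x := x :* x :+ con (+ 2) :* c :* (c :- x)
        :+ con (+ 2) :* c :* (x :- c)) refl c x)))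

  sq≤⇒In : ∀ {c x} → # 0 ≤ c → x * x ≤ c * c → In c x
  sq≤⇒In {c} {x} 0≤c h = ≤-trans (≤-by (≤⇒0≤- (sq≤⇒≤ 0≤c (≤-trans (≡⇒≤ (solve 1 (λ x → (:- x) :* (:- x) := x :* x) refl x)) h)))
      (solve 2 (λ c x → x := :- c :+ (c :- :- x)) refl c x)) ≤-refl , sq≤⇒≤ 0≤c h

  Normalised : ∀ {n} → Rank1s n → Set
  Normalised = All (λ gw → (# 1 ≤ # 4 * proj₂ gw) × (proj₂ gw ≤ # 1))

  -- Rescaling g by 2r, where r² ≤ w ≤ 4r², moves the weight to w/4r², in [1/4, 1]. Then a diagonal
  -- entry of `bm L` bounds the coordinate of every factor there.
  normalise : ∀ {n} (L : Rank1s n) → NonNeg L → Σ (Rank1s n) λ L′ → Normalised L′ × (length L′ ℕ.≤ length L) ×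
      (∀ i j → bm L′ i j ≡ bm L i j)
  normalise [] [] = [] , [] , ℕ.z≤n , λ _ _ → refl
  normalise ((g , w) ∷ L) (0≤w ∷ nn) with normalise L nn | w ≟ # 0
  ... | L′ , nm , len , eq | yes refl = L′ , nm , ℕₚ.m≤n⇒m≤1+n len , λ i j → trans (eq i j)
      (solve 2 (λ p b → b := con (+ 0) :* p :+ b) refl (g i * g j) (bm L i j))
  ... | L′ , nm , len , eq | no w≢0 = ((λ i → # 2 * r * g i) , w * (u * u)) ∷ L′ , (lower , upper) ∷ nm , ℕ.s≤s len , λ i j →
      cong₂ _+_
        (trans (solve 5 (λ r w u a b → w :* (u :* u) :* (con (+ 2) :* r :* a :* (con (+ 2) :* r :* b)) := (con (+ 2) :* r :* u)
            :* (con (+ 2) :* r :* u) :* (w :* (a :* b))) refl r w u (g i) (g j))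
          (trans (cong (λ v → v * v * (w * (g i * g j))) ru) (solve 1 (λ v → con (+ 1) :* con (+ 1) :* v := v) refl
              (w * (g i * g j))))) (eq i j)
    where
    0<w : # 0 < w
    0<w = nonneg≢0⇒pos 0≤w w≢0
    rt : Σ ℚ λ r → (# 0 < r) × (r * r ≤ w) × (w ≤ # 4 * (r * r))
    rt = √≈ 0<w
    r u : ℚ
    r = proj₁ rt
    u = inv (# 2 * r)
    0<2r : # 0 < # 2 * r
    0<2r = *-pos (0<#suc 1) (proj₁ (proj₂ rt))
    ru : # 2 * r * u ≡ # 1
    ru = inv-posʳ 0<2r
    e1 : # 4 * (r * r) * (u * u) ≡ # 1
    e1 = trans (solve 2 (λ r u → con (+ 4) :* (r :* r) :* (u :* u) := (con (+ 2) :* r :* u) :* (con (+ 2) :* r :* u)) refl r u)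
        (trans (cong₂ _*_ ru ru) (*-identityˡ _))
    lower : # 1 ≤ # 4 * (w * (u * u))
    lower = # 1 =⟨ trans (sym e1) (solve 2 (λ r u → con (+ 4) :* r :* u := con (+ 4) :* (r :* u)) refl (r * r) (u * u)) ⟩ # 4 *
        (r * r * (u * u)) ≤⟨ *-monoˡ (0≤# 4) (*-monoʳ (sq≥0 u) (proj₁ (proj₂ (proj₂ rt)))) ⟩ # 4 * (w * (u * u)) ∎
    upper : w * (u * u) ≤ # 1
    upper = ≤-trans (*-monoʳ (sq≥0 u) (proj₂ (proj₂ (proj₂ rt)))) (≡⇒≤ e1)

  -- The index of the unit interval [k, k+1) containing q, clamped to 0 … b.
  bucket : ∀ b → ℚ → Fin (suc b)
  bucket zero q = zero
  bucket (suc b) q with # (suc b) ≤? q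
  ... | yes _ = F.fromℕ (suc b)
  ... | no _ = F.inject₁ (bucket b q)

  bucket-upper : ∀ b q → q < # (suc b) → q < # (suc (F.toℕ (bucket b q)))
  bucket-upper zero q h = h
  bucket-upper (suc b) q h with # (suc b) ≤? q
  ... | yes _ = subst (λ k → q < # (suc k)) (sym (Finₚ.toℕ-fromℕ (suc b))) h
  ... | no h′ = subst (λ k → q < # (suc k)) (sym (Finₚ.toℕ-inject₁ (bucket b q))) (bucket-upper b q (≰⇒> h′))

  bucket-lower : ∀ b q → # 0 ≤ q → # (F.toℕ (bucket b q)) ≤ q
  bucket-lower zero q h = h
  bucket-lower (suc b) q h with # (suc b) ≤? q
  ... | yes p = subst (λ k → # k ≤ q) (sym (Finₚ.toℕ-fromℕ (suc b))) p
  ... | no _ = subst (λ k → # k ≤ q) (sym (Finₚ.toℕ-inject₁ (bucket b q))) (bucket-lower b q h)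

  -- Buckets other than the two extreme ones are honest unit intervals, whatever the second point is.
  bucket-pos : ∀ b q k → suc k ≡ F.toℕ (bucket b q) → # (suc k) ≤ q
  bucket-pos zero q k ()
  bucket-pos (suc b) q k e with # (suc b) ≤? q
  ... | yes p = subst (λ k → # k ≤ q) (trans (sym (Finₚ.toℕ-fromℕ (suc b))) (sym e)) p
  ... | no _ = bucket-pos b q k (trans e (Finₚ.toℕ-inject₁ (bucket b q)))

  bucket-<top : ∀ b q → F.toℕ (bucket b q) ℕ.< b → q < # b
  bucket-<top zero q ()
  bucket-<top (suc b) q h with # (suc b) ≤? q
  ... | yes p = ⊥-elim (ℕₚ.<-irrefl (Finₚ.toℕ-fromℕ (suc b)) h)
  ... | no np = ≰⇒> np

  -- The bounds 1 ≤ q < b exclude both clamped buckets. They are asked of q alone, because q′ will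
  -- come from an arbitrary vertex of the cell, which may be atypical.
  bucket-close : ∀ b q q′ → # 1 ≤ q → q < # b → bucket b q′ ≡ bucket b q → In (# 1) (q′ - q)
  bucket-close b q q′ 1≤q q<b e with F.toℕ (bucket b q) in eq
  ... | zero = ⊥-elim (≤∧>⇒⊥ 1≤q (subst (λ k → q < # (suc k)) eq (bucket-upper b q (<-≤-trans q<b (#-mono (ℕₚ.n≤1+n b))))))
  ... | suc k = ≤-trans (≤-by (+-nonneg (≤⇒0≤- lo′) (≤⇒0≤- (<⇒≤ hi))) (trans
      (solve 3 (λ q p k → p :- q := :- con (+ 1) :+ (p :- k :+ (con (+ 1) :+ k :- q))) refl q q′ (# (suc k)))
      (cong (λ u → - # 1 + (q′ - # (suc k) + (u - q))) (sym (#-+ 1 (suc k)))))) ≤-refl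
              , ≤-by (+-nonneg (≤⇒0≤- lo) (≤⇒0≤- (<⇒≤ hi′))) (trans (solve 3
                  (λ q p k → con (+ 1) := p :- q :+ (q :- k :+ (con (+ 1) :+ k :- p))) refl q q′ (# (suc k)))
                  (cong (λ u → q′ - q + (q - # (suc k) + (u - q′))) (sym (#-+ 1 (suc k)))))
    where
    eq′ : F.toℕ (bucket b q′) ≡ suc k
    eq′ = trans (cong F.toℕ e) eq
    lo : # (suc k) ≤ q
    lo = bucket-pos b q k (sym eq)
    lo′ : # (suc k) ≤ q′
    lo′ = bucket-pos b q′ k (sym eq′)
    k<b : suc k ℕ.< b
    k<b with suc k ℕ.<? b
    ... | yes p = p
    ... | no np = ⊥-elim (≤∧>⇒⊥ (≤-trans (#-mono (ℕₚ.≮⇒≥ np)) lo) q<b)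
    hi : q < # (suc (suc k))
    hi = subst (λ k → q < # (suc k)) eq (bucket-upper b q (<-≤-trans q<b (#-mono (ℕₚ.n≤1+n b))))
    hi′ : q′ < # (suc (suc k))
    hi′ = subst (λ k → q′ < # (suc k)) eq′ (bucket-upper b q′ (<-≤-trans (bucket-<top b q′ (subst (ℕ._< b) (sym eq′) k<b))
        (#-mono (ℕₚ.n≤1+n b))))

  -- Cells of typical vertices

  In-cancel : ∀ {a m d} → # 0 ≤ a → # 1 ≤ m → In a (m * d) → In a d
  In-cancel {a} {m} {d} 0≤a 1≤m (p , q) =
      *-cancel 0<m (≤-trans (≤-by (*-nonneg 0≤a (≤⇒0≤- 1≤m)) (solve 2 (λ a m → :- a := m :* (:- a) :+ a :* (m :- con (+ 1)))
          refl a m)) p)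
    , *-cancel 0<m (≤-trans q (≤-by (*-nonneg 0≤a (≤⇒0≤- 1≤m)) (solve 2 (λ a m → m :* a := a :+ a :* (m :- con (+ 1))) refl a
        m)))
    where
    0<m : # 0 < m
    0<m = <-≤-trans (0<#suc 0) 1≤m

  boolean-cases : ∀ {x} → x * x ≡ x → x ≡ # 0 ⊎ x ≡ # 1
  boolean-cases {x} e with x ≟ # 0
  ... | yes p = inj₁ p
  ... | no p = inj₂ (trans (sym (*-identityʳ x)) (trans (cong (x *_) (sym (inv-inverse p)))
      (trans (sym (*-assoc x x (inv x))) (trans (cong (_* inv x) e) (inv-inverse p)))))

  Id-cases : ∀ {n} (i j : Fin n) → Id i j ≡ # 0 ⊎ i ≡ j
  Id-cases i j with i F.≟ j
  ... | yes e = inj₂ e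
  ... | no ne = inj₁ (Id-off i j ne)

  0≤Id : ∀ {n} (i j : Fin n) → # 0 ≤ Id i j
  0≤Id zero zero = 0≤# 1
  0≤Id zero (suc j) = ≤-refl
  0≤Id (suc i) zero = ≤-refl
  0≤Id (suc i) (suc j) = 0≤Id i j

  Id≤1 : ∀ {n} (i j : Fin n) → Id i j ≤ # 1
  Id≤1 zero zero = ≤-refl
  Id≤1 zero (suc j) = 0≤# 1
  Id≤1 (suc i) zero = 0≤# 1
  Id≤1 (suc i) (suc j) = Id≤1 i j

  -- The range [-2β, 2β] is cut into intervals of length 1/m. `position` maps it into [1, 4βm + 1],
  -- and `top` is one more, so typical vertices avoid the buckets 0 and `top`.
  module Codes {n : ℕ} (β m : ℕ) (1≤m : 1 ℕ.≤ m) where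
    top : ℕ
    top = 4 ℕ.* β ℕ.* m ℕ.+ 2

    position : ℚ → ℚ
    position y = # m * y + (# (2 ℕ.* β) * # m + # 1)

    code : (L : Rank1s n) → Fin n → Fin (suc top ℕ.^ length L)
    code [] u = zero
    code ((y , w) ∷ L) u = F.combine (bucket top (position (y u))) (code L u)

    Near : Fin n → Fin n → Vect n × ℚ → Set
    Near i u (y , w) = In (# 1) (# m * (y i - y u)) × In (# (2 ℕ.* β)) (y u)

    position-range : ∀ {y} → In (# (2 ℕ.* β)) y → (# 1 ≤ position y) × (position y < # top)
    position-range {y} (p , q) = lo , ≤-<-trans hi (≤-<-trans (≤-refl {# (4 ℕ.* β ℕ.* m) + # 1}) lt)
      where
      lo : # 1 ≤ position y
      lo = ≤-by (*-nonneg (0≤# m) (≤⇒0≤- p)) (solve 3 (λ m y b → m :* y :+ (b :* m :+ con (+ 1)) := con (+ 1) :+ m :*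
          (y :- :- b)) refl (# m) y (# (2 ℕ.* β)))
      hi : position y ≤ # (4 ℕ.* β ℕ.* m) + # 1
      hi = ≤-by (*-nonneg (0≤# m) (≤⇒0≤- q)) (trans (+-congˡ (trans (#-* (4 ℕ.* β) m) (cong (_* # m) (#-* 4 β))))
        (trans (solve 2 (λ m b → con (+ 4) :* b :* m :+ con (+ 1) := m :* (con (+ 2) :* b) :+
            (con (+ 2) :* b :* m :+ con (+ 1))) refl (# m) (# β))
          (trans (cong (λ b → # m * b + (b * # m + # 1)) (sym (#-* 2 β)))
              (solve 3 (λ m y b → m :* b :+ (b :* m :+ con (+ 1)) := m :* y :+ (b :* m :+ con (+ 1)) :+ m :* (b :- y)) refl
              (# m) y (# (2 ℕ.* β))))))
      lt : # (4 ℕ.* β ℕ.* m) + # 1 < # top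
      lt = ≤-<-trans (≡⇒≤ (sym (#-+ (4 ℕ.* β ℕ.* m) 1))) (#-mono-< (ℕₚ.+-monoʳ-< (4 ℕ.* β ℕ.* m) (ℕₚ.n<1+n 1)))

    bm-tail : ∀ (y : Vect n) w L → # 0 ≤ w → ∀ u → bm L u u ≤ bm ((y , w) ∷ L) u u
    bm-tail y w L 0≤w u = ≤-by (*-nonneg 0≤w (sq≥0 (y u))) (+-comm _ _)

    normalised-nonneg : ∀ {L : Rank1s n} → Normalised L → NonNeg L
    normalised-nonneg = All.map (λ {gw} h → *-cancel (0<#suc 3) (≤-trans (≡⇒≤ (zeroʳ (# 4))) (≤-trans (0≤# 1) (proj₁ h))))

    -- Weights of at least 1/4 give y(u)² ≤ 4 `bm L u u` ≤ (2β)²; about i only its code is known.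
    near : ∀ {L} → Normalised L → ∀ i u → bm L u u ≤ # β * # β → code L i ≡ code L u → All (Near i u) L
    near [] i u _ _ = []
    near {(y , w) ∷ L} nm@((w≥ , w≤) ∷ nms) i u small e = (subst (In (# 1))
        (solve 4 (λ m a b s → m :* a :+ s :- (m :* b :+ s) := m :* (a :- b)) refl (# m) (y i) (y u) (# (2 ℕ.* β) * # m + # 1))
          (bucket-close top (position (y u)) (position (y i)) (proj₁ rng) (proj₂ rng) (proj₁ inj)) , inY) ∷ near nms i u
              (≤-trans (bm-tail y w L (All.head (normalised-nonneg nm)) u) small) (proj₂ inj)
      where
      inj : (bucket top (position (y i)) ≡ bucket top (position (y u))) × (code L i ≡ code L u)
      inj = Finₚ.combine-injective _ _ _ _ e
      inY : In (# (2 ℕ.* β)) (y u)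
      inY = sq≤⇒In (0≤# (2 ℕ.* β)) (
        y u * y u ≤⟨ ≤-by (*-nonneg (≤⇒0≤- w≥) (sq≥0 (y u))) (solve 2 (λ w y → con (+ 4) :* (w :* y) := y :+
            (con (+ 4) :* w :- con (+ 1)) :* y) refl w (y u * y u)) ⟩
        # 4 * (w * (y u * y u)) ≤⟨ *-monoˡ (0≤# 4) (≤-trans (≤-by (psd-diag (bm-psd (normalised-nonneg nms)) u) refl) small) ⟩
        # 4 * (# β * # β) =⟨ trans (solve 1 (λ b → con (+ 4) :* (b :* b) := con (+ 2) :* b :* (con (+ 2) :* b)) refl (# β))
            (cong₂ _*_ (sym (#-* 2 β)) (sym (#-* 2 β))) ⟩
        # (2 ℕ.* β) * # (2 ℕ.* β) ∎)
      rng : (# 1 ≤ position (y u)) × (position (y u) < # top)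
      rng = position-range inY

    -- Bounds m |y_i y_j - y_u y_v| through (y_i - y_u) y_j + y_u (y_j - y_v): here |y_u| ≤ 2β, and
    -- |y_j| ≤ 2β + 1 because y_j is within 1 of y_v.
    c₀ : ℚ
    c₀ = # 1 * (# (2 ℕ.* β) + # 1) + # (2 ℕ.* β) * # 1

    bm-close : ∀ {L} → Normalised L → ∀ {i j u v} → All (Near i u) L → All (Near j v) L → In (# (length L) * c₀)
        (# m * (bm L i j - bm L u v))
    bm-close [] [] [] = ≡⇒≤ (solve 2 (λ c m → :- (con (+ 0) :* c) := m :* (con (+ 0) :- con (+ 0))) refl c₀ (# m)) , ≡⇒≤
        (solve 2 (λ c m → m :* (con (+ 0) :- con (+ 0)) := con (+ 0) :* c) refl c₀ (# m))
    bm-close {(y , w) ∷ L} nm@((w≥ , w≤) ∷ nms) {i} {j} {u} {v} ((di , yu) ∷ ns) ((dj , yv) ∷ ns′) = subst₂ In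
        (sym (trans (cong (_* c₀) (#-+ 1 (length L))) (solve 2 (λ l c → (con (+ 1) :+ l) :* c := con (+ 1) :* c :+ l :* c) refl
            (# (length L)) c₀)))
        (trans (+-congˡ (cong (w *_) (solve 5 (λ m a b c d → m :* (a :- c) :* b :+ c :* (m :* (b :- d)) := m :*
            (a :* b :- c :* d)) refl (# m) (y i) (y j) (y u) (y v)))) eq)
        (In-+ (In-* inw (In-+ (In-* di yj) (In-* yu dj))) (bm-close nms ns ns′))
      where
      inw : In (# 1) w
      inw = ≤-trans (≤-by (0≤# 1) (solve 0 (con (+ 0) := :- con (+ 1) :+ con (+ 1)) refl)) (All.head (normalised-nonneg nm)) ,
          w≤
      yj : In (# (2 ℕ.* β) + # 1) (y j)
      yj = subst (In (# (2 ℕ.* β) + # 1)) (solve 2 (λ a b → b :+ (a :- b) := a) refl (y j) (y v))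
          (In-+ yv (In-cancel (0≤# 1) (#-mono 1≤m) dj))
      eq : w * (# m * (y i * y j - y u * y v)) + # m * (bm L i j - bm L u v) ≡ # m *
          (bm ((y , w) ∷ L) i j - bm ((y , w) ∷ L) u v)
      eq = solve 6 (λ w m p q r s → w :* (m :* (p :- q)) :+ m :* (r :- s) := m :* (w :* p :+ r :- (w :* q :+ s))) refl w (# m)
          (y i * y j) (y u * y v) (bm L i j) (bm L u v)

    bm-close-8 : ∀ {L} → Normalised L → # 8 * (# (length L) * c₀) ≤ # m → ∀ {i j u v} → bm L u u ≤ # β * # β → bm L v v ≤ # β *
        # β →
      code L i ≡ code L u → code L j ≡ code L v → In (# 1) (# 8 * (bm L i j - bm L u v))
    bm-close-8 {L} nm m≥ {i} {j} {u} {v} bu bv ei ej =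
        *-cancel 0<m (≤-trans (≤-by (≤⇒0≤- m≥) (solve 2 (λ m c → :- (con (+ 8) :* c) := m :* (:- con (+ 1)) :+
            (m :- con (+ 8) :* c)) refl (# m) c)) (≤-trans (≤-trans (≡⇒≤
            (solve 1 (λ c → :- (con (+ 8) :* c) := con (+ 8) :* (:- c)) refl c)) (*-monoˡ (0≤# 8) (proj₁ cl))) (≡⇒≤ sw)))
      , *-cancel 0<m (≤-trans (≡⇒≤ (sym sw)) (≤-trans (*-monoˡ (0≤# 8) (proj₂ cl))
          (≤-trans m≥ (≡⇒≤ (sym (*-identityʳ (# m)))))))
      where
      0<m : # 0 < # m
      0<m = #-mono-< 1≤m
      c d : ℚ
      c = # (length L) * c₀
      d = bm L i j - bm L u v
      cl : In c (# m * d)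
      cl = bm-close nm (near nm i u bu ei) (near nm j v bv ej)
      sw : # 8 * (# m * d) ≡ # m * (# 8 * d)
      sw = solve 2 (λ m d → con (+ 8) :* (m :* d) := m :* (con (+ 8) :* d)) refl (# m) d

  -- `T` and `S` are cell sizes and `p u` is the uniform distribution on the cell of u, so
  -- `form X (p u) (p v)` averages X over a pair of cells.
  module Cells {n N : ℕ} (code : Fin n → Fin N) where
    T : Fin N → ℚ
    T c = sum (λ i → Id c (code i))
    S : Fin n → ℚ
    S u = T (code u)
    p : Fin n → Vect n
    p u i = Id (code u) (code i) * inv (S u)

    1≤S : ∀ u → # 1 ≤ S u
    1≤S u = ≤-trans (≡⇒≤ (sym (Id-diag (code u)))) (term≤sum (λ i → 0≤Id (code u) (code i)) u)
    0<S : ∀ u → # 0 < S u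
    0<S u = <-≤-trans (0<#suc 0) (1≤S u)
    0≤invS : ∀ u → # 0 ≤ inv (S u)
    0≤invS u = <⇒≤ (inv-pos (0<S u))
    0≤p : ∀ u i → # 0 ≤ p u i
    0≤p u i = *-nonneg (0≤Id (code u) (code i)) (0≤invS u)
    p≤ : ∀ u i → p u i ≤ inv (S u)
    p≤ u i = ≤-trans (*-monoʳ (0≤invS u) (Id≤1 (code u) (code i))) (≡⇒≤ (*-identityˡ _))
    sum-p : ∀ u → sum (p u) ≡ # 1
    sum-p u = trans (sum-*ʳ (inv (S u)) _) (inv-posʳ (0<S u))
    p-cases : ∀ u i → p u i ≡ # 0 ⊎ code i ≡ code u
    p-cases u i with Id-cases (code u) (code i)
    ... | inj₁ e = inj₁ (trans (cong (_* inv (S u)) e) (zeroˡ _))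
    ... | inj₂ e = inj₂ (sym e)

    -- `p` is symmetric in its two vertices, so column sums are row sums.
    sum-p-col : ∀ i → sum (λ u → p u i) ≡ # 1
    sum-p-col i = trans (sum-cong eq) (sum-p i)
      where
      eq : ∀ u → p u i ≡ p i u
      eq u with Id-cases (code u) (code i)
      ... | inj₁ e = trans (trans (cong (_* inv (S u)) e) (zeroˡ _)) (sym
          (trans (cong (_* inv (S i)) (trans (Id-symm (code i) (code u)) e)) (zeroˡ _)))
      ... | inj₂ e = cong₂ _*_ (Id-symm (code u) (code i)) (cong (λ c → inv (T c)) e)

    -- Each nonempty cell contributes its size times the inverse of its size, that is 1.
    sum-invS : sum (λ u → inv (S u)) ≤ # N
    sum-invS = ≤-trans (≡⇒≤ (trans (sum-cong (λ u → sym (mv-Id (λ c → inv (T c)) (code u))))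
        (trans (sum-swap _) (sum-cong (λ c → sum-*ʳ (inv (T c)) (λ u → Id (code u) c))))))
      (≤-trans (sum-mono each) (≡⇒≤ (trans (sum-const {N} (# 1)) (*-identityʳ _))))
      where
      each : ∀ c → sum (λ u → Id (code u) c) * inv (T c) ≤ # 1
      each c with T c ≟ # 0
      ... | yes e = ≤-trans (≡⇒≤ (trans (cong (_* inv (T c)) (trans (sum-cong (λ u → Id-symm (code u) c)) e)) (zeroˡ _)))
          (0≤# 1)
      ... | no ne = ≡⇒≤ (trans (cong (_* inv (T c)) (sum-cong (λ u → Id-symm (code u) c))) (inv-inverse ne))

    -- Entries outside the two cells have weight 0, so only entries inside them are compared.
    form-mono-on : ∀ {X Z : Mat n} u v → (∀ i j → code i ≡ code u → code j ≡ code v → X i j ≤ Z i j) → form X (p u) (p v) ≤ form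
        Z (p u) (p v)
    form-mono-on {X} {Z} u v h = ≤-trans (≡⇒≤ (form-sum X (p u) (p v)))
        (≤-trans (sum-mono (λ i → sum-mono (λ j → each i j))) (≡⇒≤ (sym (form-sum Z (p u) (p v)))))
      where
      each : ∀ i j → X i j * (p u i * p v j) ≤ Z i j * (p u i * p v j)
      each i j with p-cases u i | p-cases v j
      ... | inj₁ e | _ = ≡⇒≤ (trans (cong (λ a → X i j * (a * p v j)) e)
          (trans (solve 3 (λ x z q → x :* (con (+ 0) :* q) := z :* (con (+ 0) :* q)) refl (X i j) (Z i j) (p v j))
          (cong (λ a → Z i j * (a * p v j)) (sym e))))
      ... | inj₂ _ | inj₁ e = ≡⇒≤ (trans (cong (λ a → X i j * (p u i * a)) e)
          (trans (solve 3 (λ x z q → x :* (q :* con (+ 0)) := z :* (q :* con (+ 0))) refl (X i j) (Z i j) (p u i))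
          (cong (λ a → Z i j * (p u i * a)) (sym e))))
      ... | inj₂ e | inj₂ e′ = *-monoʳ (*-nonneg (0≤p u i) (0≤p v j)) (h i j e e′)

    form-one : ∀ u v → form (λ _ _ → # 1) (p u) (p v) ≡ # 1
    form-one u v = trans (sum-cong (λ i → trans (cong (p u i *_) (trans (sum-cong (λ j → *-identityˡ (p v j))) (sum-p v)))
        (*-identityʳ (p u i)))) (sum-p u)

    dot-p≤ : ∀ u v → dot (p u) (p v) ≤ inv (S u)
    dot-p≤ u v = ≤-trans (sum-mono (λ i → *-monoʳ (0≤p v i) (p≤ u i))) (≡⇒≤
        (trans (sum-*ˡ (inv (S u)) (p v)) (trans (cong (inv (S u) *_) (sum-p v)) (*-identityʳ _))))

    form-scaleᴹ : ∀ c (X : Mat n) x y → form (λ i j → c * X i j) x y ≡ c * form X x y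
    form-scaleᴹ c X x y = trans (sum-cong (λ i → cong (x i *_) (dot-*ˡ y (X i) c))) (dot-*ʳ x (mv X y) c)

    -- Averaging over cells is doubly stochastic and preserves the total; so the Frobenius error
    -- also bounds the averaged errors.
    sum-form : ∀ (X : Mat n) → sum (λ u → sum (λ v → form X (p u) (p v))) ≡ sum (λ i → sum (X i))
    sum-form X = trans (sum-cong inner) (trans (sum-swap (λ u i → p u i * sum (X i)))
        (sum-cong (λ i → trans (sum-*ʳ (sum (X i)) (λ u → p u i)) (trans (cong (_* sum (X i)) (sum-p-col i)) (*-identityˡ _)))))
      where
      row : ∀ i → sum (λ v → mv X (p v) i) ≡ sum (X i)
      row i = trans (sum-swap (λ v j → X i j * p v j)) (sum-cong (λ j → trans (sum-*ˡ (X i j) (λ v → p v j))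
          (trans (cong (X i j *_) (sum-p-col j)) (*-identityʳ _))))
      inner : ∀ u → sum (λ v → form X (p u) (p v)) ≡ sum (λ i → p u i * sum (X i))
      inner u = trans (sum-swap (λ v i → p u i * mv X (p v) i)) (sum-cong
          (λ i → trans (sum-*ˡ (p u i) (λ v → mv X (p v) i)) (cong (p u i *_) (row i))))

  module Cherries {n K : ℕ} {M : Mat n} (B : Bounded01 K M) (L : Rank1s n) (nm : Normalised L) (β m : ℕ) (1≤m : 1 ℕ.≤ m)
    (m-large : # 8 * (# (length L) * Codes.c₀ {n} β m 1≤m) ≤ # m) where
    open Bounded01 B
    open Codes {n} β m 1≤m
    open Cells (code L) public

    e E² : Mat n
    e = M ⊖ bm L
    E² i j = e i j * e i j

    -- The least admissible cell size. Diagonal entries contribute K/s or 1/s to averages, and s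
    -- makes 10K/s + 8/s equal to 1, as the count in `no-good-cherry` asks.
    s : ℚ
    s = # (10 ℕ.* K ℕ.+ 8)
    0<s : # 0 < s
    0<s = #-mono-< (ℕₚ.≤-trans (ℕ.s≤s ℕ.z≤n) (ℕₚ.m≤n+m 8 (10 ℕ.* K)))
    s⁻¹ : ℚ
    s⁻¹ = inv s
    large-e : ∀ {t} → # 5 ≤ # 8 * t → # 1 ≤ # 4 * (t * t)
    large-e {t} h = *-cancel (0<#suc 15) (# 16 * # 1 ≤⟨ ≤-by (0≤# 9) (trans (sym (ι-* (+ 5) (+ 5)))
        (trans (ι-+ (+ 16) (+ 9)) (+-congˡ (sym (*-identityʳ (# 16)))))) ⟩ # 5 * # 5 ≤⟨ *-mono (0≤# 5) (0≤# 5) h h ⟩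
      # 8 * t * (# 8 * t) =⟨ solve 1 (λ t → con (+ 8) :* t :* (con (+ 8) :* t) := con (+ 16) :* (con (+ 4) :* (t :* t))) refl t
          ⟩ # 16 * (# 4 * (t * t)) ∎)

    -- The first condition keeps the mean square error over the two cells at 1/100, the second keeps
    -- the error at (u, v) itself within 1/4.
    GoodPair : Fin n → Fin n → Set
    GoodPair u v = (# 100 * form E² (p u) (p v) ≤ # 1) × (# 16 * E² u v ≤ # 1)

    GoodVertex : Fin n → Set
    GoodVertex u = (bm L u u ≤ # β * # β) × (inv (S u) ≤ s⁻¹)

    pair-In : ∀ {u v} → GoodPair u v → In (# 1) (# 4 * e u v)
    pair-In {u} {v} (_ , h) = sq≤⇒In (0≤# 1) (# 4 * e u v * (# 4 * e u v) =⟨ solve 1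
        (λ e → con (+ 4) :* e :* (con (+ 4) :* e) := con (+ 16) :* (e :* e)) refl (e u v) ⟩ # 16 * E² u v ≤⟨ h ⟩ # 1 =⟨ sym
        (*-identityˡ (# 1)) ⟩ # 1 * # 1 ∎)

    0≤E² : ∀ i j → # 0 ≤ # 4 * E² i j
    0≤E² i j = *-nonneg (0≤# 4) (sq≥0 (e i j))

    -- `bm L` is at least 3/4 at (u, v) and varies by at most 1/8 within the cells, so it is at
    -- least 5/8 there. An entry 0 of M thus has squared error above 1/4; `Id` covers the diagonal,
    -- where M need not be 0/1.
    high-entry : ∀ {u v} → GoodVertex u → GoodVertex v → GoodPair u v → M u v ≡ # 1 → ∀ i j → code L i ≡ code L u → code L j ≡
        code L v → # 1 - M i j ≤ # 4 * E² i j + Id i j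
    high-entry {u} {v} gu gv gp Muv i j ei ej with i F.≟ j
    ... | yes refl = # 1 - M i i ≤⟨ ≤-by (psd-diag psd i) (solve 1 (λ m → con (+ 1) := con (+ 1) :- m :+ m) refl (M i i)) ⟩ # 1
        ≤⟨ ≤-by (0≤E² i i) (trans (+-congʳ (Id-diag i)) (+-comm _ _)) ⟩ # 4 * E² i i + Id i i ∎
    ... | no ne = ≤-trans (body (boolean-cases (off i j ne))) (≤-by (0≤Id i j) refl)
      where
      b₁ b₀ : ℚ
      b₁ = bm L i j
      b₀ = bm L u v
      cl : In (# 1) (# 8 * (b₁ - b₀))
      cl = bm-close-8 nm m-large (proj₁ gu) (proj₁ gv) ei ej
      b≥ : # 5 ≤ # 8 * b₁
      b≥ = ≤-by (+-nonneg (≤⇒0≤- (proj₁ cl)) (*-nonneg (0≤# 2) (≤⇒0≤- (proj₂ (pair-In gp)))))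
        (trans (solve 2 (λ x y → con (+ 8) :* x := con (+ 5) :+ (con (+ 8) :* (x :- y) :- (:- con (+ 1)) :+ con (+ 2) :*
            (con (+ 1) :- con (+ 4) :* (con (+ 1) :- y)))) refl b₁ b₀) (cong
            (λ q → # 5 + (# 8 * (b₁ - b₀) - (- # 1) + # 2 * (# 1 - # 4 * (q - b₀)))) (sym Muv)))
      body : M i j ≡ # 0 ⊎ M i j ≡ # 1 → # 1 - M i j ≤ # 4 * E² i j
      body (inj₁ z) = # 1 - M i j =⟨ trans (cong (λ q → # 1 - q) z) (solve 0 (con (+ 1) :- con (+ 0) := con (+ 1)) refl) ⟩ # 1
          ≤⟨ large-e b≥ ⟩ # 4 * (b₁ * b₁) =⟨ trans (solve 1 (λ b → con (+ 4) :* (b :* b) := con (+ 4) :*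
          ((con (+ 0) :- b) :* (con (+ 0) :- b))) refl b₁) (cong (λ q → # 4 * ((q - b₁) * (q - b₁))) (sym z)) ⟩ # 4 * E² i j ∎
      body (inj₂ z) = # 1 - M i j =⟨ trans (cong (λ q → # 1 - q) z) (solve 0 (con (+ 1) :- con (+ 1) := con (+ 0)) refl) ⟩ # 0
          ≤⟨ 0≤E² i j ⟩ # 4 * E² i j ∎

    -- The mirror image of `high-entry`; on the diagonal M can be as large as K.
    low-entry : ∀ {u v} → GoodVertex u → GoodVertex v → GoodPair u v → M u v ≡ # 0 → ∀ i j → code L i ≡ code L u → code L j ≡
        code L v → M i j ≤ # 4 * E² i j + # K * Id i j
    low-entry {u} {v} gu gv gp Muv i j ei ej with i F.≟ j
    ... | yes refl = M i i ≤⟨ diag≤ i ⟩ # K ≤⟨ ≤-by (0≤E² i i) (trans (+-congʳ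
        (trans (cong (# K *_) (Id-diag i)) (*-identityʳ _))) (+-comm _ _)) ⟩ # 4 * E² i i + # K * Id i i ∎
    ... | no ne = ≤-trans (body (boolean-cases (off i j ne))) (≤-by (*-nonneg (0≤# K) (0≤Id i j)) refl)
      where
      b₁ b₀ : ℚ
      b₁ = bm L i j
      b₀ = bm L u v
      cl : In (# 1) (# 8 * (b₁ - b₀))
      cl = bm-close-8 nm m-large (proj₁ gu) (proj₁ gv) ei ej
      b≤ : # 5 ≤ # 8 * (# 1 - b₁)
      b≤ = ≤-by (+-nonneg (≤⇒0≤- (proj₂ cl)) (*-nonneg (0≤# 2) (≤⇒0≤- (proj₁ (pair-In gp)))))
        (trans (solve 2 (λ x y → con (+ 8) :* (con (+ 1) :- x) := con (+ 5) :+
            (con (+ 1) :- con (+ 8) :* (x :- y) :+ con (+ 2) :* (con (+ 4) :* (con (+ 0) :- y) :- (:- con (+ 1))))) refl b₁ b₀)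
            (cong (λ q → # 5 + (# 1 - # 8 * (b₁ - b₀) + # 2 * (# 4 * (q - b₀) - (- # 1)))) (sym Muv)))
      body : M i j ≡ # 0 ⊎ M i j ≡ # 1 → M i j ≤ # 4 * E² i j
      body (inj₁ z) = M i j =⟨ z ⟩ # 0 ≤⟨ 0≤E² i j ⟩ # 4 * E² i j ∎
      body (inj₂ z) = M i j =⟨ z ⟩ # 1 ≤⟨ large-e b≤ ⟩ # 4 * ((# 1 - b₁) * (# 1 - b₁)) =⟨ cong
          (λ q → # 4 * ((q - b₁) * (q - b₁))) (sym z) ⟩ # 4 * E² i j ∎

    Q : Fin n → Fin n → ℚ
    Q u v = form M (p u) (p v)
    A : Fin n → Fin n → ℚ
    A u v = form E² (p u) (p v)

    dot≤ : ∀ {u} v → GoodVertex u → dot (p u) (p v) ≤ s⁻¹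
    dot≤ {u} v g = ≤-trans (dot-p≤ u v) (proj₂ g)

    self : ∀ {u} → GoodVertex u → Q u u ≤ # 1 + # K * s⁻¹
    self {u} g = Q u u ≤⟨ form-mono-on u u (λ i j _ _ → entry i j) ⟩ form (λ i j → # 1 + # K * Id i j) (p u) (p u) =⟨ trans
        (form-+ᴹ (λ _ _ → # 1) (λ i j → # K * Id i j) (p u) (p u)) (cong₂ _+_ (form-one u u)
        (trans (form-scaleᴹ (# K) Id (p u) (p u)) (cong (# K *_) (form-Id (p u) (p u))))) ⟩
      # 1 + # K * dot (p u) (p u) ≤⟨ +-mono ≤-refl (*-monoˡ (0≤# K) (dot≤ u g)) ⟩ # 1 + # K * s⁻¹ ∎
      where
      entry : ∀ i j → M i j ≤ # 1 + # K * Id i j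
      entry i j with i F.≟ j
      ... | yes refl = ≤-trans (diag≤ i) (≤-by (0≤# 1) (trans (+-congʳ (trans (cong (# K *_) (Id-diag i)) (*-identityʳ _)))
          (+-comm _ _)))
      ... | no ne = ≤-trans (le (boolean-cases (off i j ne))) (≤-by (*-nonneg (0≤# K) (0≤Id i j)) refl)
        where
        le : M i j ≡ # 0 ⊎ M i j ≡ # 1 → M i j ≤ # 1
        le (inj₁ z) = ≤-trans (≡⇒≤ z) (0≤# 1)
        le (inj₂ z) = ≡⇒≤ z

    high : ∀ {u v} → GoodVertex u → GoodVertex v → GoodPair u v → M u v ≡ # 1 → # 1 - Q u v ≤ # 4 * A u v + s⁻¹
    high {u} {v} gu gv gp Muv = # 1 - Q u v =⟨ sym (trans (form-⊖ (λ _ _ → # 1) M (p u) (p v)) (+-congˡ (form-one u v))) ⟩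
      form (λ i j → # 1 - M i j) (p u) (p v) ≤⟨ form-mono-on u v (high-entry gu gv gp Muv) ⟩
      form (λ i j → # 4 * E² i j + Id i j) (p u) (p v) =⟨ trans (form-+ᴹ (λ i j → # 4 * E² i j) Id (p u) (p v))
          (cong₂ _+_ (form-scaleᴹ (# 4) E² (p u) (p v)) (form-Id (p u) (p v))) ⟩
      # 4 * A u v + dot (p u) (p v) ≤⟨ +-mono ≤-refl (dot≤ v gu) ⟩ # 4 * A u v + s⁻¹ ∎

    low : ∀ {u v} → GoodVertex u → GoodVertex v → GoodPair u v → M u v ≡ # 0 → Q u v ≤ # 4 * A u v + # K * s⁻¹
    low {u} {v} gu gv gp Muv = Q u v ≤⟨ form-mono-on u v (low-entry gu gv gp Muv) ⟩
      form (λ i j → # 4 * E² i j + # K * Id i j) (p u) (p v) =⟨ trans (form-+ᴹ (λ i j → # 4 * E² i j) (λ i j → # K * Id i j)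
          (p u) (p v)) (cong₂ _+_ (form-scaleᴹ (# 4) E² (p u) (p v)) (trans (form-scaleᴹ (# K) Id (p u) (p v))
          (cong (# K *_) (form-Id (p u) (p v))))) ⟩
      # 4 * A u v + # K * dot (p u) (p v) ≤⟨ +-mono ≤-refl (*-monoˡ (0≤# K) (dot≤ v gu)) ⟩ # 4 * A u v + # K * s⁻¹ ∎

    -- The test vector p u - p v + p w: inside a cell the density is at most 1, so M would be negative on it.
    test : ∀ u v w → # 0 ≤ Q u u + Q v v + Q w w - # 2 * Q u v - # 2 * Q v w + # 2 * Q u w
    test u v w = ≤-trans (psd (λ i → # 1 * g i + # 1 * p w i)) (≡⇒≤ (trans (form-lin symm (# 1) (# 1) g (p w))
        (trans (cong₂ (λ a b → # 1 * # 1 * a + # 2 * (# 1 * # 1) * b + # 1 * # 1 * Q w w)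
        (form-lin symm (# 1) (- # 1) (p u) (p v)) gw)
        (solve 6 (λ a b c d f h → con (+ 1) :* con (+ 1) :* (con (+ 1) :* con (+ 1) :* a :+ con (+ 2) :*
            (con (+ 1) :* (:- con (+ 1))) :* d :+ (:- con (+ 1)) :* (:- con (+ 1)) :* b) :+ con (+ 2) :*
            (con (+ 1) :* con (+ 1)) :* (con (+ 1) :* h :+ (:- con (+ 1)) :* f) :+ con (+ 1) :* con (+ 1) :* c
           := a :+ b :+ c :- con (+ 2) :* d :- con (+ 2) :* f :+ con (+ 2) :* h) refl (Q u u) (Q v v) (Q w w) (Q u v) (Q v w)
               (Q u w)))))
      where
      g : Vect n
      g i = # 1 * p u i + (- # 1) * p v i
      gw : form M g (p w) ≡ # 1 * Q u w + (- # 1) * Q v w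
      gw = trans (form-+ˡ M (p w) (λ i → # 1 * p u i) (λ i → (- # 1) * p v i))
          (cong₂ _+_ (form-*ˡ M (p w) (p u) (# 1)) (form-*ˡ M (p w) (p v) (- # 1)))

    -- Densities are at most 1 + K/s inside the cells, at least 0.96 - 1/s across the two edges and
    -- at most 0.04 + K/s across the non-edge. The test vector then has value at most -0.76 + 5K/s +
    -- 4/s = -0.26, here multiplied by 100.
    no-good-cherry : ∀ {u v w} → M u v ≡ # 1 → M v w ≡ # 1 → M u w ≡ # 0 → GoodVertex u → GoodVertex v → GoodVertex w → GoodPair
        u v → GoodPair v w → GoodPair u w → ⊥
    no-good-cherry {u} {v} {w} Muv Mvw Muw gu gv gw puv pvw puw = ≤∧>⇒⊥ (≤-trans total (≡⇒≤ val)) (ι-mono-< ℤ.-<+)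
      where
      k : ℚ
      k = # K * s⁻¹
      t₁ t₂ t₃ : ℚ
      t₁ = (# 1 + k - Q u u) + (# 1 + k - Q v v) + (# 1 + k - Q w w)
      t₂ = (# 4 * A u v + s⁻¹ - (# 1 - Q u v)) + (# 4 * A v w + s⁻¹ - (# 1 - Q v w)) + (# 4 * A u w + k - Q u w)
      t₃ = (# 1 - # 100 * A u v) + (# 1 - # 100 * A v w) + (# 1 - # 100 * A u w)
      -- The multipliers cancel the averages `A`, since 200 · 4 = 8 · 100, and the densities `Q`,
      -- since 200 is twice 100.
      total : # 0 ≤ # 100 * (Q u u + Q v v + Q w w - # 2 * Q u v - # 2 * Q v w + # 2 * Q u w) + # 100 * t₁ + # 200 * t₂ + # 8 *
          t₃
      total = +-nonneg (+-nonneg (+-nonneg (*-nonneg (0≤# 100) (test u v w))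
          (*-nonneg (0≤# 100) (+-nonneg (+-nonneg (≤⇒0≤- (self gu)) (≤⇒0≤- (self gv))) (≤⇒0≤- (self gw)))))
          (*-nonneg (0≤# 200) (+-nonneg (+-nonneg (≤⇒0≤- (high gu gv puv Muv)) (≤⇒0≤- (high gv gw pvw Mvw)))
          (≤⇒0≤- (low gu gw puw Muw))))) (*-nonneg (0≤# 8) (+-nonneg (+-nonneg (≤⇒0≤- (proj₁ puv)) (≤⇒0≤- (proj₁ pvw)))
          (≤⇒0≤- (proj₁ puw))))
      split₁ : ∀ a b c k → # 100 * ((# 1 + k - a) + (# 1 + k - b) + (# 1 + k - c)) ≡ # 300 + # 300 * k - # 100 * (a + b + c)
      split₁ = solve 4 (λ a b c k → con (+ 100) :* ((con (+ 1) :+ k :- a) :+ (con (+ 1) :+ k :- b) :+ (con (+ 1) :+ k :- c)) :=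
          con (+ 300) :+ con (+ 300) :* k :- con (+ 100) :* (a :+ b :+ c)) refl
      split₂ : ∀ x t q → # 200 * (# 4 * x + t - q) + # 8 * (# 1 - # 100 * x) ≡ # 200 * (t - q) + # 8
      split₂ = solve 3 (λ x t q → con (+ 200) :* (con (+ 4) :* x :+ t :- q) :+ con (+ 8) :* (con (+ 1) :- con (+ 100) :* x) :=
          con (+ 200) :* (t :- q) :+ con (+ 8)) refl
      val : # 100 * (Q u u + Q v v + Q w w - # 2 * Q u v - # 2 * Q v w + # 2 * Q u w) + # 100 * t₁ + # 200 * t₂ + # 8 * t₃ ≡ ι
          -[1+ 25 ]
      val = trans (+-congˡ (+-congˡ (+-congʳ (split₁ (Q u u) (Q v v) (Q w w) k))))
        (trans (solve 9 (λ a b c d f h x y z → con (+ 100) :* (a :- b :- c :+ d) :+ f :+ con (+ 200) :* (x :+ y :+ z) :+ con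
            (+ 8) :* h := con (+ 100) :* (a :- b :- c :+ d) :+ f :+ (con (+ 200) :* x :+ con (+ 200) :* y :+ con (+ 200) :* z)
            :+ con (+ 8) :* h) refl
            (Q u u + Q v v + Q w w) (# 2 * Q u v) (# 2 * Q v w) (# 2 * Q u w)
                (# 300 + # 300 * k - # 100 * (Q u u + Q v v + Q w w)) t₃ (# 4 * A u v + s⁻¹ - (# 1 - Q u v))
                (# 4 * A v w + s⁻¹ - (# 1 - Q v w)) (# 4 * A u w + k - Q u w))
        (trans (regroup _ _ _ _ _ _ _ _)
        (trans (cong₂ _+_ refl (cong₂ _+_ (cong₂ _+_ (split₂ (A u v) s⁻¹ (# 1 - Q u v)) (split₂ (A v w) s⁻¹ (# 1 - Q v w)))
            (split₂ (A u w) k (Q u w))))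
        (trans (fin (Q u u + Q v v + Q w w) (Q u v) (Q v w) (Q u w) k s⁻¹)
          (trans (cong (λ q → # 50 * q - # 76) sval) (trans (cong (_- # 76) (*-identityʳ (# 50)))
              (trans (+-congʳ (sym (ι-neg (+ 76)))) (sym (ι-+ (+ 50) -[1+ 75 ])))))))))
        where
        regroup : ∀ a b c d x y z g → a + b + (# 200 * x + # 200 * y + # 200 * z) + # 8 * (c + d + g) ≡ a + b +
            ((# 200 * x + # 8 * c + (# 200 * y + # 8 * d)) + (# 200 * z + # 8 * g))
        regroup = solve 8 (λ a b c d x y z g → a :+ b :+ (con (+ 200) :* x :+ con (+ 200) :* y :+ con (+ 200) :* z) :+ con (+ 8)
            :* (c :+ d :+ g) := a :+ b :+ ((con (+ 200) :* x :+ con (+ 8) :* c :+ (con (+ 200) :* y :+ con (+ 8) :* d)) :+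
            (con (+ 200) :* z :+ con (+ 8) :* g))) refl
        fin : ∀ q a b c k t → # 100 * (q - # 2 * a - # 2 * b + # 2 * c) + (# 300 + # 300 * k - # 100 * q) +
            ((# 200 * (t - (# 1 - a)) + # 8 + (# 200 * (t - (# 1 - b)) + # 8)) + (# 200 * (k - c) + # 8)) ≡ # 50 *
            (# 10 * k + # 8 * t) - # 76
        fin = solve 6 (λ q a b c k t → con (+ 100) :* (q :- con (+ 2) :* a :- con (+ 2) :* b :+ con (+ 2) :* c) :+
            (con (+ 300) :+ con (+ 300) :* k :- con (+ 100) :* q) :+ ((con (+ 200) :* (t :- (con (+ 1) :- a)) :+ con (+ 8) :+
            (con (+ 200) :* (t :- (con (+ 1) :- b)) :+ con (+ 8))) :+ (con (+ 200) :* (k :- c) :+ con (+ 8))) := con (+ 50) :*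
            (con (+ 10) :* k :+ con (+ 8) :* t) :- con (+ 76)) refl
        sval : # 10 * k + # 8 * s⁻¹ ≡ # 1
        sval = trans (solve 2 (λ K t → con (+ 10) :* (K :* t) :+ con (+ 8) :* t := (con (+ 10) :* K :+ con (+ 8)) :* t) refl
            (# K) s⁻¹) (trans (cong (_* s⁻¹) (sym (trans (#-+ (10 ℕ.* K) 8) (+-congˡ (#-* 10 K))))) (inv-posʳ 0<s))

  -- Markov weights and the number of cherries

  module Weights {n K : ℕ} {M : Mat n} (B : Bounded01 K M) (L : Rank1s n) (nm : Normalised L) (β m : ℕ) (1≤β : 1 ℕ.≤ β)
      (1≤m : 1 ℕ.≤ m)
    (m-large : # 8 * (# (length L) * Codes.c₀ {n} β m 1≤m) ≤ # m) where
    open Bounded01 B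
    open Codes {n} β m 1≤m using (top; normalised-nonneg)
    open Cherries B L nm β m 1≤m m-large

    0<β² : # 0 < # β * # β
    0<β² = *-pos (#-mono-< 1≤β) (#-mono-< 1≤β)
    β⁻² : ℚ
    β⁻² = inv (# β * # β)

    -- Weights for Markov's inequality: a vertex fails to be good only if `ν` exceeds 1, and a pair
    -- only if `π` does.
    ν₁ ν₂ ν : Fin n → ℚ
    ν₁ u = bm L u u * β⁻²
    ν₂ u = s * inv (S u)
    ν u = ν₁ u + ν₂ u

    π : Fin n → Fin n → ℚ
    π u v = # 100 * A u v + # 16 * E² u v

    W : Fin n → Fin n → Fin n → ℚ
    W u v w = ν u + ν v + ν w + (π u v + π v w + π u w)

    E²-symm : Symm E²
    E²-symm i j = cong₂ _*_ (⊖-symm symm (bm-symm L) i j) (⊖-symm symm (bm-symm L) i j)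

    π-symm : ∀ u v → π u v ≡ π v u
    π-symm u v = cong₂ (λ a b → # 100 * a + # 16 * b) (form-sym E²-symm (p u) (p v)) (E²-symm u v)

    W-swap : ∀ u v w → W u v w ≡ W v u w
    W-swap u v w = cong₂ _+_ (+-congˡ (+-comm (ν u) (ν v))) (trans (cong (λ a → a + π v w + π u w) (π-symm u v))
        (solve 3 (λ a b c → a :+ b :+ c := a :+ c :+ b) refl (π v u) (π v w) (π u w)))

    0≤A : ∀ u v → # 0 ≤ A u v
    0≤A u v = subst (# 0 ≤_) (sym (form-sum E² (p u) (p v))) (sum-nonneg
        (λ i → sum-nonneg (λ j → *-nonneg (sq≥0 (e i j)) (*-nonneg (0≤p u i) (0≤p v j)))))

    0≤ν₁ : ∀ u → # 0 ≤ ν₁ u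
    0≤ν₁ u = *-nonneg (psd-diag (bm-psd (normalised-nonneg nm)) u) (<⇒≤ (inv-pos 0<β²))
    0≤ν₂ : ∀ u → # 0 ≤ ν₂ u
    0≤ν₂ u = *-nonneg (<⇒≤ 0<s) (0≤invS u)
    0≤ν : ∀ u → # 0 ≤ ν u
    0≤ν u = +-nonneg (0≤ν₁ u) (0≤ν₂ u)
    0≤π : ∀ u v → # 0 ≤ π u v
    0≤π u v = +-nonneg (*-nonneg (0≤# 100) (0≤A u v)) (*-nonneg (0≤# 16) (sq≥0 (e u v)))

    good-vertex : ∀ {u} → ν u ≤ # 1 → GoodVertex u
    good-vertex {u} h = *-cancel (inv-pos 0<β²) (β⁻² * bm L u u =⟨ *-comm _ _ ⟩ ν₁ u ≤⟨ ≤-by (0≤ν₂ u) refl ⟩ ν u ≤⟨ h ⟩ # 1 =⟨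
        sym (trans (*-comm _ _) (inv-posʳ 0<β²)) ⟩ β⁻² * (# β * # β) ∎)
      , *-cancel 0<s (ν₂ u ≤⟨ ≤-by (0≤ν₁ u) (+-comm _ _) ⟩ ν u ≤⟨ h ⟩ # 1 =⟨ sym (inv-posʳ 0<s) ⟩ s * s⁻¹ ∎)

    good-pair : ∀ {u v} → π u v ≤ # 1 → GoodPair u v
    good-pair {u} {v} h = ≤-trans (≤-by (*-nonneg (0≤# 16) (sq≥0 (e u v))) refl) h , ≤-trans
        (≤-by (*-nonneg (0≤# 100) (0≤A u v)) (+-comm _ _)) h

    0≤ν³ : ∀ u v w → # 0 ≤ ν u + ν v + ν w
    0≤ν³ u v w = +-nonneg (+-nonneg (0≤ν u) (0≤ν v)) (0≤ν w)
    0≤π³ : ∀ u v w → # 0 ≤ π u v + π v w + π u w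
    0≤π³ u v w = +-nonneg (+-nonneg (0≤π u v) (0≤π v w)) (0≤π u w)

    three : ∀ {a b c} → # 0 ≤ a → # 0 ≤ b → # 0 ≤ c → a + b + c ≤ # 1 → (a ≤ # 1) × (b ≤ # 1) × (c ≤ # 1)
    three {a} {b} {c} 0≤a 0≤b 0≤c h = ≤-trans (≤-by (+-nonneg 0≤b 0≤c) (+-assoc a b c)) h
      , ≤-trans (≤-by (+-nonneg 0≤a 0≤c) (solve 3 (λ a b c → a :+ b :+ c := b :+ (a :+ c)) refl a b c)) h
      , ≤-trans (≤-by (+-nonneg 0≤a 0≤b) (+-comm _ _)) h

    -- If the total were below 1, every weight would be at most 1, all vertices and pairs would be
    -- good, and `no-good-cherry` would apply.
    cherry-weight : ∀ {u v w} → M u v ≡ # 1 → M v w ≡ # 1 → M u w ≡ # 0 → # 1 ≤ W u v w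
    cherry-weight {u} {v} {w} Muv Mvw Muw = ≮⇒≥ λ small →
      let vs = three (0≤ν u) (0≤ν v) (0≤ν w) (≤-trans (≤-by (0≤π³ u v w) refl) (<⇒≤ small))
          ps = three (0≤π u v) (0≤π v w) (0≤π u w) (≤-trans (≤-by (0≤ν³ u v w) (+-comm _ _)) (<⇒≤ small))
      in no-good-cherry Muv Mvw Muw (good-vertex (proj₁ vs)) (good-vertex (proj₁ (proj₂ vs))) (good-vertex (proj₂ (proj₂ vs)))
           (good-pair (proj₁ ps)) (good-pair (proj₁ (proj₂ ps))) (good-pair (proj₂ (proj₂ ps)))

    0≤W : ∀ u v w → # 0 ≤ W u v w
    0≤W u v w = +-nonneg (0≤ν³ u v w) (0≤π³ u v w)

    sν sπ : ℚ
    sν = sum ν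
    sπ = sum (λ u → sum (π u))

    sumW : sum (λ u → sum (λ v → sum (W u v))) ≡ # 3 * (# n * # n * sν + # n * sπ)
    sumW = trans (sum-cong (λ u → trans (sum-cong (step₁ u)) (step₂ u)))
        (trans step₃ (solve 3 (λ n a b → n :* (n :* a :+ n :* a :+ b) :+ (n :* (n :* a) :+ (n :* b :+ n :* b)) := con (+ 3) :*
        (n :* n :* a :+ n :* b)) refl (# n) sν sπ))
      where
      r : Fin n → ℚ
      r u = sum (π u)
      step₁ : ∀ u v → sum (W u v) ≡ # n * (ν u + ν v + π u v) + (sν + (r v + r u))
      step₁ u v = trans (sum-cong (λ w → solve 6 (λ a b c d e f → a :+ b :+ c :+ (d :+ e :+ f) := (a :+ b :+ d) :+
          (c :+ (e :+ f))) refl (ν u) (ν v) (ν w) (π u v) (π v w) (π u w)))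
        (trans (sum-+ _ _) (cong₂ _+_ (sum-const {n} _) (trans (sum-+ ν _) (+-congʳ (sum-+ (π v) (π u))))))
      step₂ : ∀ u → sum (λ v → # n * (ν u + ν v + π u v) + (sν + (r v + r u))) ≡ # n * (# n * ν u + sν + r u) +
          (# n * sν + (sπ + # n * r u))
      step₂ u = trans (sum-+ _ _) (cong₂ _+_ (trans (sum-*ˡ (# n) _) (cong (# n *_)
          (trans (sum-+ _ (π u)) (+-congˡ (trans (sum-+ _ ν) (+-congˡ (sum-const {n} (ν u))))))))
        (trans (sum-+ _ _) (cong₂ _+_ (sum-const {n} sν) (trans (sum-+ r _) (+-congʳ (sum-const {n} (r u)))))))
      step₃ : sum (λ u → # n * (# n * ν u + sν + r u) + (# n * sν + (sπ + # n * r u))) ≡ # n * (# n * sν + # n * sν + sπ) +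
          (# n * (# n * sν) + (# n * sπ + # n * sπ))
      step₃ = trans (sum-+ _ _) (cong₂ _+_ (trans (sum-*ˡ (# n) _) (cong (# n *_)
          (trans (sum-+ _ r) (+-congˡ (trans (sum-+ _ _) (cong₂ _+_ (sum-*ˡ (# n) ν) (sum-const {n} sν)))))))
        (trans (sum-+ _ _) (cong₂ _+_ (sum-const {n} _) (trans (sum-+ _ _) (cong₂ _+_ (sum-const {n} sπ) (sum-*ˡ (# n) r))))))

    N : ℕ
    N = suc top ℕ.^ length L

    sν≤ : sν ≤ tr (bm L) * β⁻² + s * # N
    sν≤ = ≤-trans (≡⇒≤ (trans (sum-+ ν₁ ν₂) (cong₂ _+_ (sum-*ʳ β⁻² _) (sum-*ˡ s _))))
        (+-mono ≤-refl (*-monoˡ (<⇒≤ 0<s) sum-invS))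

    sπ≡ : sπ ≡ # 116 * frob e
    sπ≡ = trans (sum-cong (λ u → trans (sum-+ _ _) (cong₂ _+_ (sum-*ˡ (# 100) (A u)) (sum-*ˡ (# 16) (E² u)))))
        (trans (sum-+ _ _) (trans (cong₂ _+_ (trans (sum-*ˡ (# 100) _) (cong (# 100 *_) (sum-form E²))) (sum-*ˡ (# 16) _))
      (solve 1 (λ f → con (+ 100) :* f :+ con (+ 16) :* f := con (+ 116) :* f) refl (frob e))))

  -- Either the weight t counts nothing, or j is joined to exactly one end of the edge vi. Upper
  -- bounds on t suffice and allow indicators cut down to a set of vertices.
  CherryLike : ∀ {n} → Mat n → Fin n → Fin n → Fin n → ℚ → Set
  CherryLike M v i j t = (t ≤ # 0) ⊎ ((t ≤ # 1) × (M v i ≡ # 1) × (((M v j ≡ # 1) × (M i j ≡ # 0)) ⊎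
      ((M v j ≡ # 0) × (M i j ≡ # 1))))

  -- Large diagonal entries, small cells and entry errors each get a share n³/3d. The constant 66816
  -- is 64 · 9 · 116: the constant of `Approximation`, the factor that makes the shares, and the
  -- weight 100 + 16 of a squared error.
  module FewCherries (d x β m : ℕ) (2≤x : 2 ℕ.≤ x) (x≡ : # x ≡ # 66816 * # d) (1≤β : 1 ℕ.≤ β)
      (β-large : 9 ℕ.* d ℕ.* (1 ℕ.+ x) ℕ.≤ β)
    (1≤m : 1 ℕ.≤ m) (m≥ : 8 ℕ.* (x ℕ.^ 3 ℕ.* (4 ℕ.* β ℕ.+ 1)) ℕ.≤ m) where

    module _ {n K : ℕ} {M : Mat n} (B : Bounded01 K M) (1≤K : 1 ℕ.≤ K) (K⁸≤n : K ℕ.^ 8 ℕ.≤ n)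
        (n-large : 9 ℕ.* d ℕ.* (18 ℕ.* K ℕ.* suc (4 ℕ.* β ℕ.* m ℕ.+ 2) ℕ.^ (x ℕ.^ 3)) ℕ.≤ n)
      (T : Fin n → Fin n → Fin n → ℚ) (T-cherry : ∀ v i j → CherryLike M v i j (T v i j)) where
      open LowRank B 1≤K K⁸≤n using (Approximation; approximation)

      ΣT : ℚ
      ΣT = sum (λ v → sum (λ i → sum (T v i)))

      module Given (Ap : Approximation x) where
        module Ap = Approximation Ap
        nrm : Σ (Rank1s n) λ L′ → Normalised L′ × (length L′ ℕ.≤ length Ap.L) × (∀ i j → bm L′ i j ≡ bm Ap.L i j)
        nrm = normalise Ap.L (proj₁ Ap.below)
        L : Rank1s n
        L = proj₁ nrm
        len : length L ℕ.≤ x ℕ.^ 3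
        len = ℕₚ.≤-trans (proj₁ (proj₂ (proj₂ nrm))) Ap.len
        same : ∀ i j → bm L i j ≡ bm Ap.L i j
        same = proj₂ (proj₂ (proj₂ nrm))
        c₀≡ : Codes.c₀ {n} β m 1≤m ≡ # (4 ℕ.* β ℕ.+ 1)
        c₀≡ = trans (cong (λ b → # 1 * (b + # 1) + b * # 1) (#-* 2 β)) (trans
            (solve 1 (λ b → con (+ 1) :* (con (+ 2) :* b :+ con (+ 1)) :+ con (+ 2) :* b :* con (+ 1) := con (+ 4) :* b :+ con
            (+ 1)) refl (# β)) (sym (trans (#-+ (4 ℕ.* β) 1) (+-congˡ (#-* 4 β)))))
        m-large : # 8 * (# (length L) * Codes.c₀ {n} β m 1≤m) ≤ # m
        m-large = ≤-trans (≡⇒≤ (trans (cong (λ c → # 8 * (# (length L) * c)) c₀≡)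
            (trans (cong (# 8 *_) (sym (#-* (length L) (4 ℕ.* β ℕ.+ 1)))) (sym (#-* 8 _)))))
          (#-mono (ℕₚ.≤-trans (ℕₚ.*-monoʳ-≤ 8 (ℕₚ.*-monoˡ-≤ (4 ℕ.* β ℕ.+ 1) len)) m≥))
        open Weights B L (proj₁ (proj₂ nrm)) β m 1≤β 1≤m m-large
        open Cherries B L (proj₁ (proj₂ nrm)) β m 1≤m m-large using (s; e)

        T≤W : ∀ v i j → T v i j ≤ W v i j
        T≤W v i j with T-cherry v i j
        ... | inj₁ h = ≤-trans h (0≤W v i j)
        ... | inj₂ (h , Mvi , inj₁ (Mvj , Mij)) = ≤-trans h (≤-trans (cherry-weight (trans (Bounded01.symm B i v) Mvi) Mvj Mij)
            (≡⇒≤ (W-swap i v j)))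
        ... | inj₂ (h , Mvi , inj₂ (Mvj , Mij)) = ≤-trans h (cherry-weight Mvi Mij Mvj)

        boundᵃ : # 9 * # d * (tr (bm L) * β⁻²) ≤ # n
        boundᵃ = *-cancel 0<β² (
          # β * # β * (# 9 * # d * (tr (bm L) * β⁻²)) =⟨ solve 4 (λ b d t i → b :* (con (+ 9) :* d :* (t :* i)) := b :* i :*
              (con (+ 9) :* d :* t)) refl (# β * # β) (# d) (tr (bm L)) β⁻² ⟩
          # β * # β * β⁻² * (# 9 * # d * tr (bm L)) =⟨ trans (cong (_* (# 9 * # d * tr (bm L))) (inv-posʳ 0<β²)) (*-identityˡ _)
              ⟩
          # 9 * # d * tr (bm L) ≤⟨ *-monoˡ (*-nonneg (0≤# 9) (0≤# d)) (≤-trans (≡⇒≤ (sum-cong (λ i → same i i))) Ap.trace≤) ⟩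
          # 9 * # d * (# n * # (1 ℕ.+ x)) =⟨ trans (solve 3 (λ d n y → con (+ 9) :* d :* (n :* y) := con (+ 9) :* d :* y :* n)
              refl (# d) (# n) (# (1 ℕ.+ x))) (cong (_* # n) (sym (trans (#-* (9 ℕ.* d) (1 ℕ.+ x))
              (cong (_* # (1 ℕ.+ x)) (#-* 9 d))))) ⟩
          # (9 ℕ.* d ℕ.* (1 ℕ.+ x)) * # n ≤⟨ *-monoʳ (0≤# n) (#-mono β-large) ⟩
          # β * # n ≤⟨ *-monoʳ (0≤# n) (≤-trans (≡⇒≤ (sym (*-identityˡ (# β)))) (*-monoʳ (0≤# β) (#-mono 1≤β))) ⟩
          # β * # β * # n ∎)

        N≤N₀ : N ℕ.≤ suc (4 ℕ.* β ℕ.* m ℕ.+ 2) ℕ.^ (x ℕ.^ 3)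
        N≤N₀ = ℕₚ.^-monoʳ-≤ (suc (4 ℕ.* β ℕ.* m ℕ.+ 2)) len

        boundᵇ : # 9 * # d * (s * # N) ≤ # n
        boundᵇ = ≤-trans (≡⇒≤ (trans (cong₂ _*_ (sym (#-* 9 d)) (sym (#-* (10 ℕ.* K ℕ.+ 8) N))) (sym (#-* (9 ℕ.* d) _))))
            (#-mono (ℕₚ.≤-trans (ℕₚ.*-monoʳ-≤ (9 ℕ.* d) (ℕₚ.*-mono-≤ s≤ N≤N₀)) n-large))
          where
          s≤ : 10 ℕ.* K ℕ.+ 8 ℕ.≤ 18 ℕ.* K
          s≤ = ℕₚ.≤-trans (ℕₚ.+-monoʳ-≤ (10 ℕ.* K) (ℕₚ.*-monoʳ-≤ 8 1≤K)) (ℕₚ.≤-reflexive (sym (ℕₚ.*-distribʳ-+ K 10 8)))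

        boundᶜ : # 9 * # d * sπ ≤ # n * # n
        boundᶜ = *-cancel (0<#suc 63) (
          # 64 * (# 9 * # d * sπ) =⟨ trans (cong (λ q → # 64 * (# 9 * # d * q)) sπ≡)
              (solve 2 (λ d f → con (+ 64) :* (con (+ 9) :* d :* (con (+ 116) :* f)) := con (+ 66816) :* d :* f) refl (# d)
              (frob e)) ⟩
          # 66816 * # d * frob e =⟨ cong₂ _*_ (sym x≡) (sum-cong (λ i → sum-cong
              (λ j → cong₂ (λ a b → (M i j - a) * (M i j - b)) (same i j) (same i j)))) ⟩
          # x * frob (M ⊖ bm Ap.L) ≤⟨ Ap.error ⟩ # 64 * (# n * # n) ∎)

        conclusion : # d * ΣT ≤ # n * # n * # n
        conclusion = *-cancel (0<#suc 2) (
          # 3 * (# d * ΣT) ≤⟨ *-monoˡ (0≤# 3) (*-monoˡ (0≤# d) (≤-trans (sum-mono (λ v → sum-mono (λ i → sum-mono (T≤W v i))))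
              (≡⇒≤ sumW))) ⟩
          # 3 * (# d * (# 3 * (# n * # n * sν + # n * sπ))) =⟨ solve 4 (λ d n a b → con (+ 3) :*
              (d :* (con (+ 3) :* (n :* n :* a :+ n :* b))) := n :* n :* (con (+ 9) :* d :* a) :+ n :* (con (+ 9) :* d :* b))
              refl (# d) (# n) sν sπ ⟩
          # n * # n * (# 9 * # d * sν) + # n * (# 9 * # d * sπ) ≤⟨ +-mono (*-monoˡ (*-nonneg (0≤# n) (0≤# n)) sνd)
              (*-monoˡ (0≤# n) boundᶜ) ⟩
          # n * # n * (# n + # n) + # n * (# n * # n) =⟨ solve 1 (λ n → n :* n :* (n :+ n) :+ n :* (n :* n) := con (+ 3) :*
              (n :* n :* n)) refl (# n) ⟩
          # 3 * (# n * # n * # n) ∎)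
          where
          sνd : # 9 * # d * sν ≤ # n + # n
          sνd = ≤-trans (*-monoˡ (*-nonneg (0≤# 9) (0≤# d)) sν≤) (≤-trans (≡⇒≤ (distribˡ (# 9 * # d) _ _))
              (+-mono boundᵃ boundᵇ))

      few-cherries : # d * ΣT ≤ # n * # n * # n
      few-cherries = ¬¬≤ λ k → approximation x 2≤x λ Ap → k (Given.conclusion Ap)

  -- Moments of random sign sums

  ½ : ℚ
  ½ = inv (# 2)

  2*½ : # 2 * ½ ≡ # 1
  2*½ = inv-posʳ (0<#suc 1)

  0≤½ : # 0 ≤ ½
  0≤½ = <⇒≤ (inv-pos (0<#suc 1))

  -- Averages over independent random signs: E fs x Φ is the mean of Φ (x ± f₁ ± … ± fₖ).
  E : ∀ {n} → List (Vect n) → Vect n → (Vect n → ℚ) → ℚ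
  E [] x Φ = Φ x
  E (f ∷ fs) x Φ = ½ * (E fs (λ i → x i + f i) Φ + E fs (λ i → x i - f i) Φ)

  Eₛ : List ℚ → ℚ → (ℚ → ℚ) → ℚ
  Eₛ [] x φ = φ x
  Eₛ (a ∷ as) x φ = ½ * (Eₛ as (x + a) φ + Eₛ as (x - a) φ)

  E-coord : ∀ {n} (fs : List (Vect n)) x (φ : ℚ → ℚ) i → E fs x (λ z → φ (z i)) ≡ Eₛ (map (λ f → f i) fs) (x i) φ
  E-coord [] x φ i = refl
  E-coord (f ∷ fs) x φ i = cong₂ (λ a b → ½ * (a + b)) (E-coord fs _ φ i) (E-coord fs _ φ i)

  E-mono : ∀ {n} (fs : List (Vect n)) x {Φ Ψ} → (∀ z → Φ z ≤ Ψ z) → E fs x Φ ≤ E fs x Ψ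
  E-mono [] x h = h x
  E-mono (f ∷ fs) x h = *-monoˡ 0≤½ (+-mono (E-mono fs _ h) (E-mono fs _ h))

  E-+ : ∀ {n} (fs : List (Vect n)) x Φ Ψ → E fs x (λ z → Φ z + Ψ z) ≡ E fs x Φ + E fs x Ψ
  E-+ [] x Φ Ψ = refl
  E-+ (f ∷ fs) x Φ Ψ = trans (cong₂ (λ a b → ½ * (a + b)) (E-+ fs _ Φ Ψ) (E-+ fs _ Φ Ψ))
      (solve 5 (λ h a b c d → h :* ((a :+ b) :+ (c :+ d)) := h :* (a :+ c) :+ h :* (b :+ d)) refl ½ _ _ _ _)

  E-* : ∀ {n} (fs : List (Vect n)) x c Φ → E fs x (λ z → c * Φ z) ≡ c * E fs x Φ
  E-* [] x c Φ = refl
  E-* (f ∷ fs) x c Φ = trans (cong₂ (λ a b → ½ * (a + b)) (E-* fs _ c Φ) (E-* fs _ c Φ))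
      (solve 4 (λ h c a b → h :* (c :* a :+ c :* b) := c :* (h :* (a :+ b))) refl ½ c _ _)

  E-const : ∀ {n} (fs : List (Vect n)) x c → E fs x (λ _ → c) ≡ c
  E-const [] x c = refl
  E-const (f ∷ fs) x c = trans (cong₂ (λ a b → ½ * (a + b)) (E-const fs _ c) (E-const fs _ c))
      (trans (solve 2 (λ h c → h :* (c :+ c) := (con (+ 2) :* h) :* c) refl ½ c) (trans (cong (_* c) 2*½) (*-identityˡ c)))

  E-sum : ∀ {n k} (fs : List (Vect n)) x (Φ : Fin k → Vect n → ℚ) → E fs x (λ z → sum (λ i → Φ i z)) ≡ sum (λ i → E fs x (Φ i))
  E-sum [] x Φ = refl
  E-sum (f ∷ fs) x Φ = trans (cong₂ (λ a b → ½ * (a + b)) (E-sum fs _ Φ) (E-sum fs _ Φ))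
      (trans (cong (½ *_) (sym (sum-+ _ _))) (sym (sum-*ˡ ½ _)))

  E-cong : ∀ {n} (fs : List (Vect n)) x {Φ Ψ} → (∀ z → Φ z ≡ Ψ z) → E fs x Φ ≡ E fs x Ψ
  E-cong [] x h = h x
  E-cong (f ∷ fs) x h = cong₂ (λ a b → ½ * (a + b)) (E-cong fs _ h) (E-cong fs _ h)

  cov : ∀ {n} → List (Vect n) → Mat n
  cov [] i j = # 0
  cov (f ∷ fs) i j = f i * f j + cov fs i j

  E-cov : ∀ {n} (fs : List (Vect n)) x i j → E fs x (λ z → z i * z j) ≡ x i * x j + cov fs i j
  E-cov [] x i j = sym (+-identityʳ _)
  E-cov (f ∷ fs) x i j = trans (cong₂ (λ a b → ½ * (a + b)) (E-cov fs _ i j) (E-cov fs _ i j))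
    (trans (halve (x i) (x j) (f i) (f j) (cov fs i j) ½) (trans (cong (_* (x i * x j + (f i * f j + cov fs i j))) 2*½)
        (*-identityˡ _)))
    where
    halve : ∀ a b c d e h → h * (((a + c) * (b + d) + e) + ((a - c) * (b - d) + e)) ≡ # 2 * h * (a * b + (c * d + e))
    halve = solve 6 (λ a b c d e h → h :* (((a :+ c) :* (b :+ d) :+ e) :+ ((a :- c) :* (b :- d) :+ e)) := con (+ 2) :* h :*
        (a :* b :+ (c :* d :+ e))) refl

  -- The trace inner product of A with the Gram matrix `cov fs`.
  lform : ∀ {n} → Mat n → List (Vect n) → ℚ
  lform A [] = # 0
  lform A (f ∷ fs) = form A f f + lform A fs

  lform-cov : ∀ {n} (A : Mat n) fs → lform A fs ≡ sum (λ i → sum (λ j → A i j * cov fs i j))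
  lform-cov A [] = sym (sum-≡0 (λ i → sum-≡0 (λ j → zeroʳ (A i j))))
  lform-cov A (f ∷ fs) = trans (cong₂ _+_ (form-sum A f f) (lform-cov A fs))
      (trans (sym (sum-+ _ _)) (sum-cong (λ i → trans (sym (sum-+ _ _)) (sum-cong (λ j → sym (distribˡ (A i j) _ _))))))

  E-form : ∀ {n} (A : Mat n) fs → E fs (λ _ → # 0) (λ z → form A z z) ≡ lform A fs
  E-form A fs = trans (E-cong fs _ (λ z → form-sum A z z)) (trans (E-sum fs _ _)
      (trans (sum-cong (λ i → trans (E-sum fs _ _) (sum-cong (λ j → trans (E-* fs _ (A i j) _)
    (cong (A i j *_) (trans (E-cov fs _ i j) (solve 1 (λ c → con (+ 0) :* con (+ 0) :+ c := c) refl (cov fs i j))))))))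
        (sym (lform-cov A fs))))

  -- The even power z^(2p), built from squares so that sign and monotonicity in z² are immediate.
  P : ℕ → ℚ → ℚ
  P zero z = # 1
  P (suc p) z = z * z * P p z

  0≤P : ∀ p z → # 0 ≤ P p z
  0≤P zero z = 0≤# 1
  0≤P (suc p) z = *-nonneg (sq≥0 z) (0≤P p z)

  P-mono : ∀ p {a b} → b * b ≤ a * a → P p b ≤ P p a
  P-mono zero h = ≤-refl
  P-mono (suc p) {a} {b} h = *-mono (sq≥0 b) (0≤P p b) h (P-mono p h)

  P-mixed : ∀ p a b → a * a * P p b ≤ P (suc p) a + P (suc p) b
  P-mixed p a b with ≤-total (a * a) (b * b)
  ... | inj₁ h = ≤-trans (*-monoʳ (0≤P p b) h) (≤-by (0≤P (suc p) a) (+-comm _ _))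
  ... | inj₂ h = ≤-trans (*-monoˡ (sq≥0 a) (P-mono p h)) (≤-by (0≤P (suc p) b) refl)

  φ : ℕ → ℚ → ℚ
  φ p z = z * P p z

  k : ℕ → ℕ
  k zero = 1
  k (suc p) = 2 ℕ.* k p ℕ.+ 3

  -- A mean value bound for the odd power z^(2p+1). With s = a^(2p) and t = b^(2p), a³s - b³t =
  -- a²(as - bt) + (a - b)(ab + b²)t; absorbing the mixed powers by `P-mixed` doubles the constant
  -- and adds 3.
  φ-lipschitz : ∀ p a b → (a - b) * (φ p a - φ p b) ≤ # (k p) * ((a - b) * (a - b)) * (P p a + P p b)
  φ-lipschitz zero a b = ≤-by (sq≥0 (a - b)) (solve 2 (λ a b → con (+ 1) :* ((a :- b) :* (a :- b)) :* (con (+ 1) :+ con (+ 1))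
      := (a :- b) :* (a :* con (+ 1) :- b :* con (+ 1)) :+ (a :- b) :* (a :- b)) refl a b)
  φ-lipschitz (suc p) a b =
    (a - b) * (φ (suc p) a - φ (suc p) b) =⟨ solve 4 (λ a b s t → (a :- b) :* (a :* (a :* a :* s) :- b :* (b :* b :* t)) := a :*
        a :* ((a :- b) :* (a :* s :- b :* t)) :+ (a :- b) :* (a :- b) :* ((a :* b :+ b :* b) :* t)) refl a b (P p a) (P p b) ⟩
    a * a * ((a - b) * (φ p a - φ p b)) + d * ((a * b + b * b) * P p b) ≤⟨ +-mono (*-monoˡ (sq≥0 a) (φ-lipschitz p a b))
        (*-monoˡ (sq≥0 (a - b)) second) ⟩
    a * a * (# (k p) * d * (P p a + P p b)) + d * (# 3 * (P₁ a + P₁ b)) =⟨ solve 6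
        (λ q d K s t u → q :* (K :* d :* (s :+ t)) :+ d :* (con (+ 3) :* u) := K :* d :* (q :* s :+ q :* t) :+ d :*
        (con (+ 3) :* u)) refl (a * a) d (# (k p)) (P p a) (P p b) (P₁ a + P₁ b) ⟩
    # (k p) * d * (P₁ a + a * a * P p b) + d * (# 3 * (P₁ a + P₁ b)) ≤⟨ +-mono
        (*-monoˡ (*-nonneg (0≤# (k p)) (sq≥0 (a - b))) (≤-trans (+-mono ≤-refl (P-mixed p a b))
        (≤-by (0≤P (suc p) b) (solve 2 (λ s t → con (+ 2) :* (s :+ t) := s :+ (s :+ t) :+ t) refl (P₁ a) (P₁ b))))) ≤-refl ⟩
    # (k p) * d * (# 2 * (P₁ a + P₁ b)) + d * (# 3 * (P₁ a + P₁ b)) =⟨ trans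
        (solve 3 (λ K d u → K :* d :* (con (+ 2) :* u) :+ d :* (con (+ 3) :* u) := (con (+ 2) :* K :+ con (+ 3)) :* d :* u) refl
        (# (k p)) d (P₁ a + P₁ b)) (cong (λ c → c * d * (P₁ a + P₁ b)) (sym
        (trans (#-+ (2 ℕ.* k p) 3) (+-congˡ (#-* 2 (k p)))))) ⟩
    # (k (suc p)) * d * (P₁ a + P₁ b) ∎
    where
    P₁ : ℚ → ℚ
    P₁ = P (suc p)
    d : ℚ
    d = (a - b) * (a - b)
    second : (a * b + b * b) * P p b ≤ # 3 * (P₁ a + P₁ b)
    second = (a * b + b * b) * P p b ≤⟨ *-monoʳ (0≤P p b) ab≤ ⟩ (a * a + # 2 * (b * b)) * P p b =⟨ solve 3
        (λ a b t → (a :+ con (+ 2) :* b) :* t := a :* t :+ con (+ 2) :* (b :* t)) refl (a * a) (b * b) (P p b) ⟩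
      a * a * P p b + # 2 * P₁ b ≤⟨ +-mono (P-mixed p a b) ≤-refl ⟩ P₁ a + P₁ b + # 2 * P₁ b ≤⟨ ≤-by
          (*-nonneg (0≤# 2) (0≤P (suc p) a)) (solve 2 (λ s t → con (+ 3) :* (s :+ t) := s :+ t :+ con (+ 2) :* t :+ con (+ 2) :*
          s) refl (P₁ a) (P₁ b)) ⟩ # 3 * (P₁ a + P₁ b) ∎
      where
      ab≤ : a * b + b * b ≤ a * a + # 2 * (b * b)
      ab≤ = *-cancel (0<#suc 1) (≤-by (+-nonneg (sq≥0 (a - b)) (+-nonneg (sq≥0 a) (sq≥0 b)))
          (solve 2 (λ a b → con (+ 2) :* (a :* a :+ con (+ 2) :* (b :* b)) := con (+ 2) :* (a :* b :+ b :* b) :+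
          ((a :- b) :* (a :- b) :+ (a :* a :+ b :* b))) refl a b))

  φ-step : ∀ p u f → f * (φ p (u + f) - φ p (u - f)) ≤ # (2 ℕ.* k p) * (f * f) * (P p (u + f) + P p (u - f))
  φ-step p u f = *-cancel (0<#suc 1) (
    # 2 * (f * (φ p a - φ p b)) =⟨ trans (sym (*-assoc (# 2) f _)) (cong (_* (φ p a - φ p b)) (sym ab)) ⟩
    (a - b) * (φ p a - φ p b) ≤⟨ φ-lipschitz p a b ⟩
    # (k p) * ((a - b) * (a - b)) * (P p a + P p b) =⟨ trans (cong (λ d → # (k p) * (d * d) * (P p a + P p b)) ab)
        (trans (solve 3 (λ K f u → K :* (con (+ 2) :* f :* (con (+ 2) :* f)) :* u := con (+ 2) :*
        (con (+ 2) :* K :* (f :* f) :* u)) refl (# (k p)) f (P p a + P p b))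
        (cong (λ c → # 2 * (c * (f * f) * (P p a + P p b))) (sym (#-* 2 (k p))))) ⟩
    # 2 * (# (2 ℕ.* k p) * (f * f) * (P p a + P p b)) ∎)
    where
    a b : ℚ
    a = u + f
    b = u - f
    ab : a - b ≡ # 2 * f
    ab = solve 2 (λ u f → u :+ f :- (u :- f) := con (+ 2) :* f) refl u f

  Eₛ-mono : ∀ as x {φ ψ : ℚ → ℚ} → (∀ z → φ z ≤ ψ z) → Eₛ as x φ ≤ Eₛ as x ψ
  Eₛ-mono [] x h = h x
  Eₛ-mono (a ∷ as) x h = *-monoˡ 0≤½ (+-mono (Eₛ-mono as _ h) (Eₛ-mono as _ h))

  Eₛ-cong : ∀ as x {φ ψ : ℚ → ℚ} → (∀ z → φ z ≡ ψ z) → Eₛ as x φ ≡ Eₛ as x ψ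
  Eₛ-cong [] x h = h x
  Eₛ-cong (a ∷ as) x h = cong₂ (λ a b → ½ * (a + b)) (Eₛ-cong as _ h) (Eₛ-cong as _ h)

  Eₛ-+ : ∀ as x (φ ψ : ℚ → ℚ) → Eₛ as x (λ z → φ z + ψ z) ≡ Eₛ as x φ + Eₛ as x ψ
  Eₛ-+ [] x φ ψ = refl
  Eₛ-+ (a ∷ as) x φ ψ = trans (cong₂ (λ a b → ½ * (a + b)) (Eₛ-+ as _ φ ψ) (Eₛ-+ as _ φ ψ))
      (solve 5 (λ h a b c d → h :* ((a :+ b) :+ (c :+ d)) := h :* (a :+ c) :+ h :* (b :+ d)) refl ½ _ _ _ _)

  Eₛ-* : ∀ as x c (φ : ℚ → ℚ) → Eₛ as x (λ z → c * φ z) ≡ c * Eₛ as x φ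
  Eₛ-* [] x c φ = refl
  Eₛ-* (a ∷ as) x c φ = trans (cong₂ (λ a b → ½ * (a + b)) (Eₛ-* as _ c φ) (Eₛ-* as _ c φ))
      (solve 4 (λ h c a b → h :* (c :* a :+ c :* b) := c :* (h :* (a :+ b))) refl ½ c _ _)

  Eₛ-shift : ∀ as x a (φ : ℚ → ℚ) → Eₛ as (x + a) φ ≡ Eₛ as x (λ z → φ (z + a))
  Eₛ-shift [] x a φ = refl
  Eₛ-shift (b ∷ as) x a φ = cong₂ (λ u v → ½ * (u + v))
    (trans (cong (λ y → Eₛ as y φ) (solve 3 (λ x a b → x :+ a :+ b := x :+ b :+ a) refl x a b)) (Eₛ-shift as (x + b) a φ))
    (trans (cong (λ y → Eₛ as y φ) (solve 3 (λ x a b → x :+ a :- b := x :- b :+ a) refl x a b)) (Eₛ-shift as (x - b) a φ))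

  sumsq : List ℚ → ℚ
  sumsq [] = # 0
  sumsq (a ∷ as) = a * a + sumsq as

  -- Integration by parts for random signs.
  module Stein (φ ψ : ℚ → ℚ) (c : ℚ) (step : ∀ u f → f * (φ (u + f) - φ (u - f)) ≤ c * (f * f) * (ψ (u + f) + ψ (u - f))) where
    stein : ∀ as x → Eₛ as x (λ z → (z - x) * φ z) ≤ c * sumsq as * Eₛ as x ψ
    stein [] x = ≡⇒≤ (solve 4 (λ x p c s → (x :- x) :* p := c :* con (+ 0) :* s) refl x (φ x) c (ψ x))
    stein (a ∷ as) x = ½ * (Eₛ as (x + a) (λ z → (z - x) * φ z) + Eₛ as (x - a) (λ z → (z - x) * φ z))
        =⟨ cong₂ (λ u v → ½ * (u + v)) (split a (x + a) (solve 2 (λ x a → x := x :+ a :- a) refl x a))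
            (trans (split (- a) (x - a) (solve 2 (λ x a → x := x :- a :- (:- a)) refl x a))
            (+-congʳ (solve 2 (λ a b → :- a :* b := :- (a :* b)) refl a m))) ⟩
      ½ * ((Ip + a * p) + (Im + - (a * m))) =⟨ solve 6 (λ h i j a p m → h :* ((i :+ a :* p) :+ (j :+ :- (a :* m))) := h :*
          (i :+ j) :+ h :* (a :* (p :- m))) refl ½ Ip Im a p m ⟩
      ½ * (Ip + Im) + ½ * (a * (p - m)) ≤⟨ +-mono (*-monoˡ 0≤½ (+-mono (stein as (x + a)) (stein as (x - a))))
          (*-monoˡ 0≤½ coupled) ⟩
      ½ * (c * sumsq as * Sp + c * sumsq as * Sm) + ½ * (c * (a * a) * (Sp + Sm)) =⟨ solve 6
          (λ h c q s t a → h :* (c :* q :* s :+ c :* q :* t) :+ h :* (c :* a :* (s :+ t)) := c :* (a :+ q) :* (h :* (s :+ t)))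
          refl ½ c (sumsq as) Sp Sm (a * a) ⟩
      c * (a * a + sumsq as) * (½ * (Sp + Sm)) ∎
      where
      p m Sp Sm Ip Im : ℚ
      p = Eₛ as (x + a) φ
      m = Eₛ as (x - a) φ
      Sp = Eₛ as (x + a) ψ
      Sm = Eₛ as (x - a) ψ
      Ip = Eₛ as (x + a) (λ z → (z - (x + a)) * φ z)
      Im = Eₛ as (x - a) (λ z → (z - (x - a)) * φ z)
      split : ∀ b y → x ≡ y - b → Eₛ as y (λ z → (z - x) * φ z) ≡ Eₛ as y (λ z → (z - y) * φ z) + b * Eₛ as y φ
      split b y e = trans (Eₛ-cong as y (λ z → trans (cong (λ w → (z - w) * φ z) e)
          (solve 4 (λ z y b f → (z :- (y :- b)) :* f := (z :- y) :* f :+ b :* f) refl z y b (φ z))))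
          (trans (Eₛ-+ as y _ _) (+-congʳ (Eₛ-* as y b φ)))
      -- Both branches share the remaining signs, so the shifts by a move into the functions and
      -- `step` applies pointwise.
      coupled : a * (p - m) ≤ c * (a * a) * (Sp + Sm)
      coupled = a * (p - m) =⟨ trans (cong₂ (λ u v → a * (u - v)) (Eₛ-shift as x a φ) (Eₛ-shift as x (- a) φ))
          (sym (trans (Eₛ-* as x a _) (cong (a *_) (trans (Eₛ-+ as x _ _)
          (+-congʳ (trans (Eₛ-cong as x (λ z → solve 1 (λ u → :- u := (:- con (+ 1)) :* u) refl (φ (z - a))))
          (trans (Eₛ-* as x (- # 1) _) (solve 1 (λ u → (:- con (+ 1)) :* u := :- u) refl _)))))))) ⟩
        Eₛ as x (λ z → a * (φ (z + a) - φ (z - a))) ≤⟨ Eₛ-mono as x (λ z → step z a) ⟩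
        Eₛ as x (λ z → c * (a * a) * (ψ (z + a) + ψ (z - a))) =⟨ trans (Eₛ-* as x _ _)
            (cong (c * (a * a) *_) (trans (Eₛ-+ as x _ _) (cong₂ _+_ (sym (Eₛ-shift as x a ψ)) (sym (Eₛ-shift as x (- a) ψ)))))
            ⟩
        c * (a * a) * (Sp + Sm) ∎

  pw : ℚ → ℕ → ℚ
  pw x zero = # 1
  pw x (suc p) = x * pw x p

  0≤pw : ∀ {x} → # 0 ≤ x → ∀ p → # 0 ≤ pw x p
  0≤pw h zero = 0≤# 1
  0≤pw h (suc p) = *-nonneg h (0≤pw h p)

  cc : ℕ → ℕ
  cc zero = 1
  cc (suc p) = 2 ℕ.* k p ℕ.* cc p

  0≤sumsq : ∀ as → # 0 ≤ sumsq as
  0≤sumsq [] = ≤-refl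
  0≤sumsq (a ∷ as) = +-nonneg (sq≥0 a) (0≤sumsq as)

  Eₛ-const : ∀ as x → Eₛ as x (λ _ → # 1) ≡ # 1
  Eₛ-const [] x = refl
  Eₛ-const (a ∷ as) x = trans (cong₂ (λ u v → ½ * (u + v)) (Eₛ-const as _) (Eₛ-const as _))
      (trans (solve 1 (λ h → h :* (con (+ 1) :+ con (+ 1)) := con (+ 2) :* h) refl ½) 2*½)

  -- Khintchine's inequality with a crude constant: z^(2p+2) is z times an odd power, and each
  -- integration by parts trades a factor z² for 2k σ.
  moment : ∀ p as {σ} → sumsq as ≤ σ → Eₛ as (# 0) (P p) ≤ # (cc p) * pw σ p
  moment zero as h = ≡⇒≤ (trans (Eₛ-const as (# 0)) (sym (*-identityˡ (# 1))))
  moment (suc p) as {σ} h = Eₛ as (# 0) (P (suc p)) =⟨ Eₛ-cong as (# 0)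
      (λ z → solve 2 (λ z q → z :* z :* q := (z :- con (+ 0)) :* (z :* q)) refl z (P p z)) ⟩
    Eₛ as (# 0) (λ z → (z - # 0) * φ p z) ≤⟨ Stein.stein (φ p) (P p) (# (2 ℕ.* k p)) (φ-step p) as (# 0) ⟩
    # (2 ℕ.* k p) * sumsq as * Eₛ as (# 0) (P p) ≤⟨ *-mono (*-nonneg (0≤# (2 ℕ.* k p)) (0≤sumsq as))
        (≤-trans (≡⇒≤ (sym (Eₛ-zero as))) (Eₛ-mono as (# 0) (0≤P p))) (*-monoˡ (0≤# (2 ℕ.* k p)) h) (moment p as h) ⟩
    # (2 ℕ.* k p) * σ * (# (cc p) * pw σ p) =⟨ trans (solve 4 (λ a b c d → a :* b :* (c :* d) := a :* c :* (b :* d)) refl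
        (# (2 ℕ.* k p)) σ (# (cc p)) (pw σ p)) (cong (_* (σ * pw σ p)) (sym (#-* (2 ℕ.* k p) (cc p)))) ⟩
    # (cc (suc p)) * pw σ (suc p) ∎
    where
    Eₛ-zero : ∀ as → Eₛ as (# 0) (λ _ → # 0) ≡ # 0
    Eₛ-zero as = trans (Eₛ-cong as (# 0) (λ _ → sym (zeroˡ (# 1)))) (trans (Eₛ-* as (# 0) (# 0) (λ _ → # 1)) (zeroˡ _))

  sumsq-cov : ∀ {n} (fs : List (Vect n)) i → sumsq (map (λ f → f i) fs) ≡ cov fs i i
  sumsq-cov [] i = refl
  sumsq-cov (f ∷ fs) i = +-congʳ (sumsq-cov fs i)

  pw-mono : ∀ {a b} → # 0 ≤ a → a ≤ b → ∀ p → pw a p ≤ pw b p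
  pw-mono 0≤a h zero = ≤-refl
  pw-mono 0≤a h (suc p) = *-mono 0≤a (0≤pw 0≤a p) h (pw-mono 0≤a h p)

  pw-P : ∀ p z → pw (z * z) p ≡ P p z
  pw-P zero z = refl
  pw-P (suc p) z = cong (z * z *_) (pw-P p z)

  pw-* : ∀ a b p → pw (a * b) p ≡ pw a p * pw b p
  pw-* a b zero = sym (*-identityˡ _)
  pw-* a b (suc p) = trans (cong (a * b *_) (pw-* a b p)) (*-interchange a b (pw a p) (pw b p))

  0<P : ∀ {z} → # 0 < z → ∀ p → # 0 < P p z
  0<P h zero = 0<#suc 0
  0<P h (suc p) = *-pos (*-pos h h) (0<P h p)

  -- The Gram matrix of fs is rounded to bounded vectors by random signs and truncation at height ℓ.
  module Rounding {n} (A : Mat n) (0≤A : ∀ i j → # 0 ≤ A i j) (A≤1 : ∀ i j → A i j ≤ # 1) (κ₀ : ℚ) (0≤κ₀ : # 0 ≤ κ₀)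
    (cut-bound : ∀ ℓ → # 0 ≤ ℓ → ∀ t → (∀ i → In ℓ (t i)) → - (κ₀ * (ℓ * ℓ)) ≤ form A t t)
    (p Λ : ℕ) (1≤Λ : 1 ℕ.≤ Λ) (Λ-large : # (2 ℕ.* n ℕ.* cc (suc p)) ≤ P p (# Λ))
    (fs : List (Vect n)) (σ : ℚ) (0<σ : # 0 < σ) (cov≤ : ∀ i → cov fs i i ≤ σ) where

    a₀ : ℚ
    a₀ = # Λ * # Λ * σ
    0<a₀ : # 0 < a₀
    0<a₀ = *-pos (*-pos (#-mono-< 1≤Λ) (#-mono-< 1≤Λ)) 0<σ
    rt : Σ ℚ λ r → (# 0 < r) × (r * r ≤ a₀) × (a₀ ≤ # 4 * (r * r))
    rt = √≈ 0<a₀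
    ℓ : ℚ
    ℓ = # 2 * proj₁ rt
    0<ℓ : # 0 < ℓ
    0<ℓ = *-pos (0<#suc 1) (proj₁ (proj₂ rt))
    ℓ² : ℓ * ℓ ≡ # 4 * (proj₁ rt * proj₁ rt)
    ℓ² = solve 1 (λ r → con (+ 2) :* r :* (con (+ 2) :* r) := con (+ 4) :* (r :* r)) refl (proj₁ rt)
    a₀≤ℓ² : a₀ ≤ ℓ * ℓ
    a₀≤ℓ² = ≤-trans (proj₂ (proj₂ (proj₂ rt))) (≡⇒≤ (sym ℓ²))
    ℓ²≤4a₀ : ℓ * ℓ ≤ # 4 * a₀
    ℓ²≤4a₀ = ≤-trans (≡⇒≤ ℓ²) (*-monoˡ (0≤# 4) (proj₁ (proj₂ (proj₂ rt))))

    -- Large values go to 0 rather than to ±ℓ, so a truncated coordinate leaves the form, and only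
    -- the products that it took part in have to be paid for.
    trunc : ℚ → ℚ
    trunc z with (z * z) ≤? (ℓ * ℓ)
    ... | yes _ = z
    ... | no _ = # 0

    trunc-In : ∀ z → In ℓ (trunc z)
    trunc-In z with (z * z) ≤? (ℓ * ℓ)
    ... | yes h = sq≤⇒In (<⇒≤ 0<ℓ) h
    ... | no _ = ≤-by (<⇒≤ 0<ℓ) (solve 1 (λ l → con (+ 0) := :- l :+ l) refl ℓ) , <⇒≤ 0<ℓ

    iℓ : ℚ
    iℓ = inv (P p ℓ)
    0<Pℓ : # 0 < P p ℓ
    0<Pℓ = 0<P 0<ℓ p
    0≤iℓ : # 0 ≤ iℓ
    0≤iℓ = <⇒≤ (inv-pos 0<Pℓ)
    -- z^(2p+2) / ℓ^(2p): it dominates z² beyond height ℓ, and its mean is controlled by a moment.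
    G : ℚ → ℚ
    G z = iℓ * P (suc p) z
    0≤G : ∀ z → # 0 ≤ G z
    0≤G z = *-nonneg 0≤iℓ (0≤P (suc p) z)
    G-large : ∀ {z} → ℓ * ℓ ≤ z * z → z * z ≤ G z
    G-large {z} h = z * z =⟨ trans (sym (*-identityˡ _)) (trans (cong (_* (z * z)) (sym (inv-posʳ 0<Pℓ)))
        (solve 3 (λ a i q → a :* i :* q := i :* (q :* a)) refl (P p ℓ) iℓ (z * z))) ⟩
      iℓ * (z * z * P p ℓ) ≤⟨ *-monoˡ 0≤iℓ (*-monoˡ (sq≥0 z) (P-mono p h)) ⟩ G z ∎

    0≤G² : ∀ x y → # 0 ≤ G x + G y
    0≤G² x y = +-nonneg (0≤G x) (0≤G y)

    -- If both coordinates survive, `G` is only added slack. Otherwise |cxy| is at most the larger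
    -- of x² and y², which is beyond ℓ² and therefore at most its `G`.
    entry : ∀ {c} → # 0 ≤ c → c ≤ # 1 → ∀ x y → c * (trunc x * trunc y) - (G x + G y) ≤ c * (x * y)
    entry {c} 0≤c c≤1 x y = go ((x * x) ≤? (ℓ * ℓ)) ((y * y) ≤? (ℓ * ℓ))
      where
      lower : ∀ {x y} → y * y ≤ x * x → # 0 - c * (x * y) ≤ x * x
      lower {x} {y} h = *-cancel (0<#suc 1) (≤-by (+-nonneg (+-nonneg (*-nonneg 0≤c (sq≥0 (x + y))) (≤⇒0≤- h))
          (*-nonneg (≤⇒0≤- c≤1) (+-nonneg (sq≥0 x) (sq≥0 y))))
        (solve 3 (λ c x y → con (+ 2) :* (x :* x) := con (+ 2) :* (con (+ 0) :- c :* (x :* y)) :+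
            (c :* ((x :+ y) :* (x :+ y)) :+ (x :* x :- y :* y) :+ (con (+ 1) :- c) :* (x :* x :+ y :* y))) refl c x y))
      dropped : ℓ * ℓ ≤ x * x ⊎ ℓ * ℓ ≤ y * y → # 0 - (G x + G y) ≤ c * (x * y)
      dropped h with ≤-total (x * x) (y * y)
      ... | inj₁ q = flip (≤-trans (lower {y} {x} q) (≤-trans (G-large (big h)) (≤-by (0≤G x) (+-comm _ _))))
          (cong (c *_) (*-comm y x))
        where
        big : ℓ * ℓ ≤ x * x ⊎ ℓ * ℓ ≤ y * y → ℓ * ℓ ≤ y * y
        big (inj₁ p) = ≤-trans p q
        big (inj₂ p) = p
        flip : # 0 - c * (y * x) ≤ G x + G y → c * (y * x) ≡ c * (x * y) → # 0 - (G x + G y) ≤ c * (x * y)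
        flip u e = ≤-by (≤⇒0≤- u) (trans (sym e) (solve 2 (λ a g → a := con (+ 0) :- g :+ (g :- (con (+ 0) :- a))) refl
            (c * (y * x)) (G x + G y)))
      ... | inj₂ q = ≤-by (≤⇒0≤- (≤-trans (lower {x} {y} q) (≤-trans (G-large (big h)) (≤-by (0≤G y) refl))))
          (solve 2 (λ a g → a := con (+ 0) :- g :+ (g :- (con (+ 0) :- a))) refl (c * (x * y)) (G x + G y))
        where
        big : ℓ * ℓ ≤ x * x ⊎ ℓ * ℓ ≤ y * y → ℓ * ℓ ≤ x * x
        big (inj₁ p) = p
        big (inj₂ p) = ≤-trans p q
      zeroed : ∀ {u v} → u ≡ # 0 ⊎ v ≡ # 0 → c * (u * v) - (G x + G y) ≡ # 0 - (G x + G y)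
      zeroed {v = v} (inj₁ refl) = +-congˡ (solve 2 (λ c v → c :* (con (+ 0) :* v) := con (+ 0)) refl c v)
      zeroed {u = u} (inj₂ refl) = +-congˡ (solve 2 (λ c v → c :* (v :* con (+ 0)) := con (+ 0)) refl c u)
      trunc-keep : ∀ z → z * z ≤ ℓ * ℓ → trunc z ≡ z
      trunc-keep z h with (z * z) ≤? (ℓ * ℓ)
      ... | yes _ = refl
      ... | no np = ⊥-elim (np h)
      trunc-drop : ∀ z → ¬ (z * z ≤ ℓ * ℓ) → trunc z ≡ # 0
      trunc-drop z h with (z * z) ≤? (ℓ * ℓ)
      ... | yes p = ⊥-elim (h p)
      ... | no _ = refl
      go : (dx : Dec (x * x ≤ ℓ * ℓ)) (dy : Dec (y * y ≤ ℓ * ℓ)) → c * (trunc x * trunc y) - (G x + G y) ≤ c * (x * y)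
      go (yes hx) (yes hy) = ≤-by (0≤G² x y) (trans (solve 2 (λ a g → a := a :- g :+ g) refl (c * (x * y)) (G x + G y))
          (+-congˡ (+-congˡ (cong (c *_) (sym (cong₂ _*_ (trunc-keep x hx) (trunc-keep y hy)))))))
      go (no hx) _ = ≤-trans (≡⇒≤ (zeroed (inj₁ (trunc-drop x hx)))) (dropped (inj₁ (<⇒≤ (≰⇒> hx))))
      go (yes _) (no hy) = ≤-trans (≡⇒≤ (zeroed (inj₂ (trunc-drop y hy)))) (dropped (inj₂ (<⇒≤ (≰⇒> hy))))

    pointwise : ∀ z → - (κ₀ * (ℓ * ℓ)) - # 2 * # n * sum (λ i → G (z i)) ≤ form A z z
    pointwise z = ≤-trans (+-mono (cut-bound ℓ (<⇒≤ 0<ℓ) t (λ i → trunc-In (z i))) ≤-refl)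
      (≤-trans (≡⇒≤ (sym rearrange)) (≤-trans (sum-mono (λ i → sum-mono (λ j → entry (0≤A i j) (A≤1 i j) (z i) (z j))))
          (≡⇒≤ (sym (form-sum A z z)))))
      where
      t : Vect n
      t i = trunc (z i)
      g : ℚ
      g = sum (λ i → G (z i))
      rearrange : sum (λ i → sum (λ j → A i j * (t i * t j) - (G (z i) + G (z j)))) ≡ form A t t - # 2 * # n * g
      rearrange = trans (sum-cong (λ i → trans (sum-- _ _) (+-congʳ (cong -_
          (trans (sum-+ _ (λ j → G (z j))) (+-congˡ (sum-const {n} (G (z i)))))))))
        (trans (sum-- _ _) (cong₂ _-_ (sym (form-sum A t t)) (trans (sum-+ _ _)
            (trans (cong₂ _+_ (sum-*ˡ (# n) _) (sum-const {n} g)) (solve 2 (λ n g → n :* g :+ n :* g := con (+ 2) :* n :* g)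
            refl (# n) g)))))

    EG : ∀ i → E fs (λ _ → # 0) (λ z → G (z i)) ≤ iℓ * (# (cc (suc p)) * pw σ (suc p))
    EG i = ≤-trans (≡⇒≤ (trans (E-* fs _ iℓ _) (cong (iℓ *_) (E-coord fs _ (P (suc p)) i))))
        (*-monoˡ 0≤iℓ (moment (suc p) (map (λ f → f i) fs) (≤-trans (≡⇒≤ (sumsq-cov fs i)) (cov≤ i))))

    -- As ℓ² ≥ Λ²σ, division by ℓ^(2p) gains Λ^(2p), which by `Λ-large` outweighs 2n times the
    -- moment constant.
    tail≤ : # 2 * # n * (iℓ * (# (cc (suc p)) * pw σ (suc p))) ≤ σ
    tail≤ = *-cancel 0<Pℓ (
      P p ℓ * (# 2 * # n * (iℓ * (# (cc (suc p)) * pw σ (suc p)))) =⟨ solve 5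
          (λ a i n c s → a :* (con (+ 2) :* n :* (i :* (c :* s))) := a :* i :* (con (+ 2) :* n :* c :* s)) refl (P p ℓ) iℓ (# n)
          (# (cc (suc p))) (pw σ (suc p)) ⟩
      P p ℓ * iℓ * (# 2 * # n * # (cc (suc p)) * pw σ (suc p)) =⟨ trans
          (cong₂ _*_ (inv-posʳ 0<Pℓ) (cong (_* pw σ (suc p)) (sym (trans (#-* (2 ℕ.* n) (cc (suc p)))
          (cong (_* # (cc (suc p))) (#-* 2 n)))))) (*-identityˡ _) ⟩
      # (2 ℕ.* n ℕ.* cc (suc p)) * pw σ (suc p) ≤⟨ *-monoʳ (0≤pw (<⇒≤ 0<σ) (suc p)) Λ-large ⟩
      P p (# Λ) * (σ * pw σ p) =⟨ trans (solve 3 (λ a s t → a :* (s :* t) := a :* t :* s) refl (P p (# Λ)) σ (pw σ p))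
          (cong (_* σ) (sym (trans (pw-* (# Λ * # Λ) σ p) (cong (_* pw σ p) (pw-P p (# Λ)))))) ⟩
      pw a₀ p * σ ≤⟨ *-monoʳ (<⇒≤ 0<σ) (≤-trans (pw-mono (<⇒≤ 0<a₀) a₀≤ℓ² p) (≡⇒≤ (pw-P p ℓ))) ⟩
      P p ℓ * σ ∎)

    rounding : - (σ * (# 4 * κ₀ * (# Λ * # Λ) + # n)) ≤ lform A fs
    rounding = ≤-trans step (≤-trans (≡⇒≤ (sym expand)) (≤-trans (E-mono fs _ pointwise) (≡⇒≤ (E-form A fs))))
      where
      c₁ c₂ g : ℚ
      c₁ = - (κ₀ * (ℓ * ℓ))
      c₂ = - (# 2 * # n)
      g = sum (λ i → E fs (λ _ → # 0) (λ z → G (z i)))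
      expand : E fs (λ _ → # 0) (λ z → c₁ - # 2 * # n * sum (λ i → G (z i))) ≡ c₁ - # 2 * # n * g
      expand = trans (E-+ fs _ (λ _ → c₁) _) (cong₂ _+_ (E-const fs _ c₁)
          (trans (E-cong fs _ (λ z → solve 2 (λ a b → :- (a :* b) := (:- a) :* b) refl (# 2 * # n) (sum (λ i → G (z i)))))
          (trans (E-* fs _ c₂ _) (trans (cong (c₂ *_) (E-sum fs _ (λ i z → G (z i))))
          (solve 2 (λ a b → (:- a) :* b := :- (a :* b)) refl (# 2 * # n) g)))))
      g≤ : # 2 * # n * g ≤ # n * σ
      g≤ = ≤-trans (*-monoˡ (*-nonneg (0≤# 2) (0≤# n)) (≤-trans (sum-mono EG) (≡⇒≤ (sum-const {n} _))))
          (≤-trans (≡⇒≤ (solve 2 (λ n m → con (+ 2) :* n :* (n :* m) := n :* (con (+ 2) :* n :* m)) refl (# n) _))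
          (*-monoˡ (0≤# n) tail≤))
      step : - (σ * (# 4 * κ₀ * (# Λ * # Λ) + # n)) ≤ c₁ - # 2 * # n * g
      step = ≤-by (+-nonneg (*-nonneg 0≤κ₀ (≤⇒0≤- ℓ²≤4a₀)) (≤⇒0≤- g≤)) (solve 6
          (λ s K l n q r → :- (K :* q) :- r := :- (s :* (con (+ 4) :* K :* l :+ n)) :+
          (K :* (con (+ 4) :* (l :* s) :- q) :+ (n :* s :- r))) refl σ κ₀ (# Λ * # Λ) (# n) (ℓ * ℓ) (# 2 * # n * g))

  -- Linear programming duality

  -- A pair (a , c) stands for the affine constraint 0 ≤ a · D + c on D.
  Con : ℕ → Set
  Con d = Vect d × ℚ

  eval : ∀ {d} → Con d → Vect d → ℚ
  eval (a , c) D = dot a D + c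

  infixl 6 _⊕_
  infixl 7 _⊙_

  _⊕_ : ∀ {d} → Con d → Con d → Con d
  (a , c) ⊕ (b , e) = (λ i → a i + b i) , c + e

  _⊙_ : ∀ {d} → ℚ → Con d → Con d
  t ⊙ (a , c) = (λ i → t * a i) , t * c

  -- `𝒫` stands for the constraints derivable by any means. Keeping it abstract, instead of
  -- recording multipliers, makes a refutation come out in the form that rounding contradicts.
  record Cone {d} (𝒫 : Con d → Set) : Set where
    field
      add : ∀ {x y} → 𝒫 x → 𝒫 y → 𝒫 (x ⊕ y)
      scale : ∀ {t x} → # 0 < t → 𝒫 x → 𝒫 (t ⊙ x)

  eval-⊕ : ∀ {d} (x y : Con d) D → eval (x ⊕ y) D ≡ eval x D + eval y D
  eval-⊕ (a , c) (b , e) D = trans (+-congˡ (dot-+ˡ D a b)) (solve 4 (λ p q c e → p :+ q :+ (c :+ e) := p :+ c :+ (q :+ e)) refl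
      (dot a D) (dot b D) c e)

  eval-⊙ : ∀ {d} t (x : Con d) D → eval (t ⊙ x) D ≡ t * eval x D
  eval-⊙ t (a , c) D = trans (+-congˡ (dot-*ˡ D a t)) (sym (distribˡ t _ _))

  hd : ∀ {d} → Con (suc d) → ℚ
  hd (a , c) = a zero

  tl : ∀ {d} → Con (suc d) → Con d
  tl (a , c) = (λ i → a (suc i)) , c

  _∷ᵛ_ : ∀ {d} → ℚ → Vect d → Vect (suc d)
  (y ∷ᵛ D) zero = y
  (y ∷ᵛ D) (suc i) = D i

  eval-∷ : ∀ {d} (x : Con (suc d)) y D → eval x (y ∷ᵛ D) ≡ hd x * y + eval (tl x) D
  eval-∷ (a , c) y D = trans (+-congˡ (sum-suc _)) (+-assoc _ _ _)

  Refutation : ∀ {d} → (Con d → Set) → Set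
  Refutation 𝒫 = Σ (Con _) λ x → 𝒫 x × (∀ i → proj₁ x i ≡ # 0) × (proj₂ x < # 0)

  Solution : ∀ {d} → List (Con d) → Set
  Solution cs = Σ (Vect _) λ D → All (λ x → # 0 ≤ eval x D) cs

  record Split {d} (𝒫 : Con (suc d) → Set) (cs : List (Con (suc d))) : Set₁ where
    field
      ps ns zs : List (Con (suc d))
      allp : All (λ x → 𝒫 x × (# 0 < hd x)) ps
      alln : All (λ x → 𝒫 x × (hd x < # 0)) ns
      allz : All (λ x → 𝒫 x × (hd x ≡ # 0)) zs
      merge : ∀ (R : Con (suc d) → Set) → All R ps → All R ns → All R zs → All R cs

  split : ∀ {d} {𝒫 : Con (suc d) → Set} (cs : List (Con (suc d))) → All 𝒫 cs → Split 𝒫 cs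
  split [] [] = record { ps = [] ; ns = [] ; zs = [] ; allp = [] ; alln = [] ; allz = [] ; merge = λ _ _ _ _ → [] }
  split (x ∷ cs) (h ∷ hs) with split cs hs | hd x ≟ # 0 | # 0 ≤? hd x
  ... | S | yes e | _ = record { Split S hiding (zs; allz; merge) ; zs = x ∷ Split.zs S ; allz = (h , e) ∷ Split.allz S ; merge
      = λ { R p n (r ∷ z) → r ∷ Split.merge S R p n z } }
  ... | S | no ne | yes q = record { Split S hiding (ps; allp; merge) ; ps = x ∷ Split.ps S ; allp = (h , nonneg≢0⇒pos q ne) ∷
      Split.allp S ; merge = λ { R (r ∷ p) n z → r ∷ Split.merge S R p n z } }
  ... | S | no ne | no nq = record { Split S hiding (ns; alln; merge) ; ns = x ∷ Split.ns S ; alln = (h , ≰⇒> nq) ∷ Split.alln S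
      ; merge = λ { R p (r ∷ n) z → r ∷ Split.merge S R p n z } }

  -- Fourier–Motzkin elimination of the leading variable.
  comb : ∀ {d} → Con (suc d) → Con (suc d) → Con (suc d)
  comb p n = (- hd n) ⊙ p ⊕ hd p ⊙ n

  cross : ∀ {d} → List (Con (suc d)) → List (Con (suc d)) → List (Con (suc d))
  cross [] ns = []
  cross (p ∷ ps) ns = map (comb p) ns ++ cross ps ns

  interval : ∀ {A : Set} (lo hi : A → ℚ) (ls hs : List A) → All (λ l → All (λ h → lo l ≤ hi h) hs) ls → Σ ℚ λ y → All
      (λ l → lo l ≤ y) ls × All (λ h → y ≤ hi h) hs
  interval lo hi [] [] [] = # 0 , [] , []
  interval lo hi [] (h ∷ hs) [] with interval lo hi [] hs []
  ... | y , _ , below with ≤-total y (hi h)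
  ... | inj₁ q = y , [] , q ∷ below
  ... | inj₂ q = hi h , [] , ≤-refl ∷ All.map (≤-trans q) below
  interval lo hi (l ∷ ls) hs (a ∷ as) with interval lo hi ls hs as
  ... | y , above , below with ≤-total (lo l) y
  ... | inj₁ q = y , q ∷ above , below
  ... | inj₂ q = lo l , ≤-refl ∷ All.map (λ r → ≤-trans r q) above , a

  cross-elim : ∀ {d} {R : Con (suc d) → Set} (ps ns : List (Con (suc d))) → All R (cross ps ns) → All
      (λ p → All (λ n → R (comb p n)) ns) ps
  cross-elim [] ns [] = []
  cross-elim (p ∷ ps) ns h = Allₚ.map⁻ (Allₚ.++⁻ˡ (map (comb p) ns) h) ∷ cross-elim ps ns (Allₚ.++⁻ʳ (map (comb p) ns) h)

  cross-intro : ∀ {d} {R : Con (suc d) → Set} (ps ns : List (Con (suc d))) → All (λ p → All (λ n → R (comb p n)) ns) ps → All R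
      (cross ps ns)
  cross-intro [] ns [] = []
  cross-intro (p ∷ ps) ns (h ∷ hs) = Allₚ.++⁺ (Allₚ.map⁺ h) (cross-intro ps ns hs)

  -- The members of `𝒫` that do not involve the leading variable, moved to one dimension less.
  -- Coefficients are compared pointwise, in place of equality of functions.
  zeroHead : ∀ {d} → (Con (suc d) → Set) → Con d → Set
  zeroHead 𝒫 y = Σ (Con _) λ x → 𝒫 x × (hd x ≡ # 0) × (∀ i → proj₁ x (suc i) ≡ proj₁ y i) × (proj₂ x ≡ proj₂ y)

  zeroHead-cone : ∀ {d} {𝒫 : Con (suc d) → Set} → Cone 𝒫 → Cone (zeroHead 𝒫)
  zeroHead-cone C = record
    { add = λ { (x , px , hx , tx , cx) (y , py , hy , ty , cy) → x ⊕ y , Cone.add C px py , trans (cong₂ _+_ hx hy)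
        (+-identityˡ _) , (λ i → cong₂ _+_ (tx i) (ty i)) , cong₂ _+_ cx cy }
    ; scale = λ { {t} 0<t (x , px , hx , tx , cx) → t ⊙ x , Cone.scale C 0<t px , trans (cong (t *_) hx) (zeroʳ t) ,
        (λ i → cong (t *_) (tx i)) , cong (t *_) cx } }

  module Eliminate {d} {𝒫 : Con (suc d) → Set} (C : Cone 𝒫) {cs : List (Con (suc d))} (S : Split 𝒫 cs) where
    open Split S
    reduced : List (Con d)
    reduced = map tl (cross ps ns ++ zs)

    0<-n : ∀ {n} → n < # 0 → # 0 < - n
    0<-n {n} h = subst (# 0 <_) (+-identityˡ (- n)) (<⇒0<- h)

    reduced-cone : All (zeroHead 𝒫) reduced
    reduced-cone = Allₚ.map⁺ (Allₚ.++⁺ (cross-intro ps ns (All.map (λ {p} hp → All.map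
        (λ {n} hn → comb p n , Cone.add C (Cone.scale C (0<-n (proj₂ hn)) (proj₁ hp)) (Cone.scale C (proj₂ hp) (proj₁ hn)) ,
        solve 2 (λ a b → (:- b) :* a :+ a :* b := con (+ 0)) refl (hd p) (hd n) , (λ _ → refl) , refl) alln) allp))
      (All.map (λ {x} h → x , proj₁ h , proj₂ h , (λ _ → refl) , refl) allz))

    module _ (D : Vect d) (sol : All (λ x → # 0 ≤ eval x D) reduced) where
      e lo hi : Con (suc d) → ℚ
      e x = eval (tl x) D
      lo p = - e p * inv (hd p)
      hi n = e n * inv (- hd n)

      pairs : All (λ p → All (λ n → # 0 ≤ eval (tl (comb p n)) D) ns) ps
      pairs = cross-elim ps ns (Allₚ.++⁻ˡ (cross ps ns) (Allₚ.map⁻ sol))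

      lo≤hi : ∀ {p n} → # 0 < hd p → hd n < # 0 → # 0 ≤ eval (tl (comb p n)) D → lo p ≤ hi n
      lo≤hi {p} {n} 0<p n<0 h = *-cancel (*-pos 0<p 0<-n′) (
        hd p * (- hd n) * (- e p * inv (hd p)) =⟨ solve 4 (λ a b u i → a :* b :* (:- u :* i) := :- (b :* u) :* (a :* i)) refl
            (hd p) (- hd n) (e p) (inv (hd p)) ⟩
        - (- hd n * e p) * (hd p * inv (hd p)) =⟨ trans (cong (- (- hd n * e p) *_) (inv-posʳ 0<p)) (*-identityʳ _) ⟩
        - (- hd n * e p) ≤⟨ ≤-by h (trans (solve 2 (λ a b → b := :- a :+ (a :+ b)) refl (- hd n * e p) (hd p * e n))
            (+-congʳ (sym (trans (eval-⊕ (tl ((- hd n) ⊙ p)) (tl (hd p ⊙ n)) D)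
            (cong₂ _+_ (eval-⊙ (- hd n) (tl p) D) (eval-⊙ (hd p) (tl n) D)))))) ⟩
        hd p * e n =⟨ trans (sym (*-identityʳ _)) (cong (hd p * e n *_) (sym (inv-posʳ 0<-n′))) ⟩
        hd p * e n * (- hd n * inv (- hd n)) =⟨ solve 4 (λ a u b i → a :* u :* (b :* i) := a :* b :* (u :* i)) refl (hd p) (e n)
            (- hd n) (inv (- hd n)) ⟩
        hd p * (- hd n) * (e n * inv (- hd n)) ∎)
        where
        0<-n′ : # 0 < - hd n
        0<-n′ = 0<-n n<0

      between : Σ ℚ λ y → All (λ p → lo p ≤ y) ps × All (λ n → y ≤ hi n) ns
      between = interval lo hi ps ns (All.zipWith (λ { {p} ((_ , 0<p) , h) → All.zipWith
          (λ { {n} ((_ , n<0) , r) → lo≤hi {p} {n} 0<p n<0 r }) (alln , h) }) (allp , pairs))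
      y : ℚ
      y = proj₁ between

      solution : Solution cs
      solution = y ∷ᵛ D , All.map (λ {x} h → ≤-trans h (≡⇒≤ (sym (eval-∷ x y D)))) (merge (λ x → # 0 ≤ hd x * y + e x)
        (All.zipWith (λ { {p} ((_ , 0<p) , h) → subst (# 0 ≤_) (trans (solve 4
            (λ a y u i → a :* (y :- (:- u :* i)) := a :* y :+ a :* i :* u) refl (hd p) y (e p) (inv (hd p)))
            (+-congʳ (trans (cong (_* e p) (inv-posʳ 0<p)) (*-identityˡ _)))) (*-nonneg (<⇒≤ 0<p) (≤⇒0≤- h)) })
            (allp , proj₁ (proj₂ between)))
        (All.zipWith (λ { {n} ((_ , n<0) , h) → subst (# 0 ≤_) (trans (solve 4
            (λ b y u i → b :* (u :* i :- y) := (:- b) :* y :+ b :* i :* u) refl (- hd n) y (e n) (inv (- hd n)))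
            (cong₂ _+_ (cong (_* y) (solve 1 (λ a → :- (:- a) := a) refl (hd n)))
            (trans (cong (_* e n) (inv-posʳ (0<-n n<0))) (*-identityˡ _)))) (*-nonneg (<⇒≤ (0<-n n<0)) (≤⇒0≤- h)) })
            (alln , proj₂ (proj₂ between)))
        (All.zipWith (λ { {x} ((_ , z) , h) → ≤-trans h (≡⇒≤ (sym (trans (+-congˡ (trans (cong (_* y) z) (zeroˡ y)))
            (+-identityˡ _)))) }) (allz , Allₚ.++⁻ʳ (cross ps ns) (Allₚ.map⁻ sol))))

  -- Induction on the number of variables. The reduced system consists of positive combinations, so
  -- a refutation of it lifts, while a solution extends by a value between the lower and the upper
  -- bounds.
  farkas : ∀ {d} {𝒫 : Con d → Set} → Cone 𝒫 → (cs : List (Con d)) → All 𝒫 cs → Solution cs ⊎ Refutation 𝒫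
  farkas {zero} C [] [] = inj₁ ((λ ()) , [])
  farkas {zero} C (x ∷ cs) (h ∷ hs) with # 0 ≤? proj₂ x | farkas C cs hs
  ... | no q | _ = inj₂ (x , h , (λ ()) , ≰⇒> q)
  ... | yes q | inj₂ r = inj₂ r
  ... | yes q | inj₁ (D , sol) = inj₁ (D , ≤-trans q (≡⇒≤ (sym (trans (+-congˡ (sum-empty _)) (+-identityˡ _)))) ∷ sol)
  farkas {suc d} {𝒫} C cs hs = finish (farkas (zeroHead-cone C) El.reduced El.reduced-cone)
    where
    module El = Eliminate C (split cs hs)
    finish : Solution El.reduced ⊎ Refutation (zeroHead 𝒫) → Solution cs ⊎ Refutation 𝒫
    finish (inj₁ (D , sol)) = inj₁ (El.solution D sol)
    finish (inj₂ (y , (x , px , hx , tx , cx) , zs , c<0)) = inj₂ (x , px , (λ { zero → hx ; (suc i) → trans (tx i) (zs i) }) ,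
        subst (_< # 0) (sym cx) c<0)

  cov-++ : ∀ {n} (fs gs : List (Vect n)) i j → cov (fs ++ gs) i j ≡ cov fs i j + cov gs i j
  cov-++ [] gs i j = sym (+-identityˡ _)
  cov-++ (f ∷ fs) gs i j = trans (+-congʳ (cov-++ fs gs i j)) (sym (+-assoc _ _ _))

  lform-++ : ∀ {n} (A : Mat n) fs gs → lform A (fs ++ gs) ≡ lform A fs + lform A gs
  lform-++ A [] gs = sym (+-identityˡ _)
  lform-++ A (f ∷ fs) gs = trans (+-congʳ (lform-++ A fs gs)) (sym (+-assoc _ _ _))

  dilate : ∀ {n} → ℚ → List (Vect n) → List (Vect n)
  dilate r = map (λ f i → r * f i)

  cov-dilate : ∀ {n} r (fs : List (Vect n)) i j → cov (dilate r fs) i j ≡ r * r * cov fs i j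
  cov-dilate r [] i j = sym (zeroʳ _)
  cov-dilate r (f ∷ fs) i j = trans (+-congʳ (cov-dilate r fs i j)) (solve 4
      (λ r a b c → r :* a :* (r :* b) :+ r :* r :* c := r :* r :* (a :* b :+ c)) refl r (f i) (f j) (cov fs i j))

  lform-dilate : ∀ {n} r (A : Mat n) fs → lform A (dilate r fs) ≡ r * r * lform A fs
  lform-dilate r A [] = sym (zeroʳ _)
  lform-dilate r A (f ∷ fs) = trans (cong₂ _+_ (trans (form-*ˡ A _ f r) (cong (r *_) (form-*ʳ A f f r))) (lform-dilate r A fs))
      (solve 3 (λ r a c → r :* (r :* a) :+ r :* r :* c := r :* r :* (a :+ c)) refl r (form A f f) (lform A fs))

  repeat : ∀ {n} → ℕ → List (Vect n) → List (Vect n)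
  repeat zero fs = []
  repeat (suc k) fs = fs ++ repeat k fs

  cov-repeat : ∀ {n} k (fs : List (Vect n)) i j → cov (repeat k fs) i j ≡ # k * cov fs i j
  cov-repeat zero fs i j = sym (zeroˡ _)
  cov-repeat (suc k) fs i j = trans (cov-++ fs (repeat k fs) i j) (trans (+-congʳ (cov-repeat k fs i j))
      (trans (solve 2 (λ k c → c :+ k :* c := (con (+ 1) :+ k) :* c) refl (# k) (cov fs i j))
      (cong (_* cov fs i j) (sym (#-+ 1 k)))))

  lform-repeat : ∀ {n} k (A : Mat n) fs → lform A (repeat k fs) ≡ # k * lform A fs
  lform-repeat zero A fs = sym (zeroˡ _)
  lform-repeat (suc k) A fs = trans (lform-++ A fs (repeat k fs)) (trans (+-congʳ (lform-repeat k A fs))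
      (trans (solve 2 (λ k c → c :+ k :* c := (con (+ 1) :+ k) :* c) refl (# k) (lform A fs))
      (cong (_* lform A fs) (sym (#-+ 1 k)))))

  -- A positive rational multiple of a Gram matrix, without square roots: p/q = (pq)·(1/q)².
  rescale : ∀ {n} t → # 0 < t → (fs : List (Vect n)) → Σ (List (Vect n)) λ gs → (∀ i j → cov gs i j ≡ t * cov fs i j) ×
      (∀ A → lform A gs ≡ t * lform A fs)
  rescale t 0<t fs = repeat kk (dilate r fs)
      , (λ i j → trans (cov-repeat kk _ i j) (trans (cong (# kk *_) (cov-dilate r fs i j))
          (trans (sym (*-assoc _ _ _)) (cong (_* cov fs i j) krr))))
      , (λ A → trans (lform-repeat kk A _) (trans (cong (# kk *_) (lform-dilate r A fs))
          (trans (sym (*-assoc _ _ _)) (cong (_* lform A fs) krr))))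
    where
    fr : Σ ℤ λ p → Σ ℕ λ q → t * # (suc q) ≡ ι p
    fr = fraction t
    q : ℕ
    q = proj₁ (proj₂ fr)
    r : ℚ
    r = inv (# (suc q))
    nat : Σ ℕ λ m → proj₁ fr ≡ + m
    nat = ι-nonneg (proj₁ fr) (subst (# 0 ≤_) (proj₂ (proj₂ fr)) (*-nonneg (<⇒≤ 0<t) (0≤# (suc q))))
    kk : ℕ
    kk = proj₁ nat ℕ.* suc q
    krr : # kk * (r * r) ≡ t
    krr = trans (cong (_* (r * r)) (trans (#-* (proj₁ nat) (suc q)) (cong (_* # (suc q))
        (sym (trans (proj₂ (proj₂ fr)) (cong ι (proj₂ nat)))))))
      (trans (solve 3 (λ t q r → t :* q :* q :* (r :* r) := t :* (q :* r) :* (q :* r)) refl t (# (suc q)) r)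
          (trans (cong (λ u → t * u * u) (inv-posʳ (0<#suc q))) (solve 1 (λ t → t :* con (+ 1) :* con (+ 1) := t) refl t)))

  -- Semidefiniteness from finitely many grid vectors

  consF : ∀ {n b} → Fin b → (Fin n → Fin b) → Fin (suc n) → Fin b
  consF c f zero = c
  consF c f (suc i) = f i

  funs : ∀ n b → List (Fin n → Fin b)
  funs zero b = (λ ()) ∷ []
  funs (suc n) b = concatMap (λ c → map (consF c) (funs n b)) (allFin b)

  -- The enumeration meets a given function only up to pointwise equality, so users have to
  -- transport along it.
  funs-complete : ∀ {n b} {R : (Fin n → Fin b) → Set} → All R (funs n b) → ∀ (g : Fin n → Fin b) → Σ (Fin n → Fin b) λ f → R f ×
      (∀ i → f i ≡ g i)
  funs-complete {zero} (r ∷ []) g = _ , r , λ ()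
  funs-complete {suc n} {b} {R} h g with funs-complete (Allₚ.map⁻ (All.lookup
      (Allₚ.map⁻ (Allₚ.concat⁻ {xss = map (λ c → map (consF c) (funs n b)) (allFin b)} h)) (∈-allFin (g zero))))
      (λ i → g (suc i))
  ... | f , r , eq = _ , r , λ { zero → refl ; (suc i) → eq i }

  grid : ∀ {n} B {b} → (Fin n → Fin b) → Vect n
  grid B f i = # (F.toℕ (f i)) - # B

  -- Finitely many tests yield semidefiniteness up to a small defect, which the extra identity in
  -- `M` repairs: rounding y with |y|² ≥ B²/4 to the grid costs at most 2B times the sum of all
  -- entries, and `B-large` keeps this below |y|².
  module GridPSD {n} (A : Mat n) (A-symm : Symm A) (0≤A : ∀ i j → # 0 ≤ A i j) (A≤1 : ∀ i j → A i j ≤ # 1) (κ B b₀ : ℕ)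
      (B-large : 8 ℕ.* (n ℕ.* n ℕ.+ κ) ℕ.≤ B) (1≤B : 1 ℕ.≤ B) (b₀≡ : b₀ ≡ B ℕ.+ B)
    (D : Vect n) (0≤D : ∀ i → # 0 ≤ D i) (D≤κ : sum D ≤ # κ)
    (grid-D : ∀ (f : Fin n → Fin (suc b₀)) → # 0 ≤ form A (grid B f) (grid B f) + sum (λ i → D i * (grid B f i * grid B f i)))
        where

    A⁺D : Mat n
    A⁺D i j = A i j + Id i j * D i

    formD : ∀ (c x : Vect n) → form (λ i j → A i j + Id i j * c i) x x ≡ form A x x + sum (λ i → c i * (x i * x i))
    formD c x = trans (form-+ᴹ A (λ i j → Id i j * c i) x x) (+-congʳ (sum-cong
        (λ i → trans (cong (x i *_) (trans (sum-cong (λ j → solve 3 (λ d e y → d :* e :* y := e :* (d :* y)) refl (Id i j) (c i)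
        (x j))) (trans (sum-*ˡ (c i) _) (cong (c i *_) (mv-Id x i)))))
      (solve 2 (λ x e → x :* (e :* x) := e :* (x :* x)) refl (x i) (c i)))))

    grid-form : ∀ (f : Fin n → Fin (suc b₀)) → # 0 ≤ form A⁺D (grid B f) (grid B f)
    grid-form f = ≤-trans (grid-D f) (≡⇒≤ (sym (formD D (grid B f))))

    0≤A⁺D : ∀ i j → # 0 ≤ A⁺D i j
    0≤A⁺D i j = +-nonneg (0≤A i j) (*-nonneg (0≤Id i j) (0≤D i))

    total : ℚ
    total = sum (λ i → sum (A⁺D i))

    total≤ : total ≤ # (n ℕ.* n ℕ.+ κ)
    total≤ = ≤-trans (≡⇒≤ (trans (sum-cong (λ i → trans (sum-+ (A i) _)
        (+-congʳ (trans (sum-*ʳ (D i) (Id i)) (trans (cong (_* D i) (trans (sum-cong (λ j → sym (*-identityʳ (Id i j))))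
        (mv-Id (λ _ → # 1) i))) (*-identityˡ _)))))) (sum-+ _ D)))
      (≤-trans (+-mono (≤-trans (sum-mono (λ i → ≤-trans (sum-mono (A≤1 i))
          (≡⇒≤ (trans (sum-const {n} (# 1)) (*-identityʳ _))))) (≡⇒≤ (sum-const {n} (# n)))) D≤κ)
          (≡⇒≤ (sym (trans (#-+ (n ℕ.* n) κ) (+-congˡ (#-* n n))))))

    M : Mat n
    M i j = A i j + Id i j * (D i + # 1)

    -- Every direction, scaled to length about B, is within 1 of a grid point in each coordinate.
    module Direction (x : Vect n) (0<S : # 0 < dot x x) where
      rt : Σ ℚ λ r → (# 0 < r) × (r * r ≤ dot x x) × (dot x x ≤ # 4 * (r * r))
      rt = √≈ 0<S
      r c : ℚ
      r = proj₁ rt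
      0<r : # 0 < r
      0<r = proj₁ (proj₂ rt)
      0<2r : # 0 < # 2 * r
      0<2r = *-pos (0<#suc 1) 0<r
      c = # B * inv (# 2 * r)
      0<B : # 0 < # B
      0<B = #-mono-< 1≤B
      0<c : # 0 < c
      0<c = *-pos 0<B (inv-pos 0<2r)
      c2r : c * (# 2 * r) ≡ # B
      c2r = trans (*-assoc _ _ _) (trans (cong (# B *_) (trans (*-comm _ _) (inv-posʳ 0<2r))) (*-identityʳ _))
      y : Vect n
      y i = c * x i
      y-In : ∀ i → In (# B) (y i)
      y-In i = subst (λ b → In b (y i)) c2r (In-* (≤-trans (≤-by (<⇒≤ 0<c) (solve 1 (λ c → con (+ 0) := :- c :+ c) refl c))
          (<⇒≤ 0<c) , ≤-refl)
        (sq≤⇒In (<⇒≤ 0<2r) (≤-trans (term≤sum (λ j → sq≥0 (x j)) i) (≤-trans (proj₂ (proj₂ (proj₂ rt)))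
            (≡⇒≤ (solve 1 (λ r → con (+ 4) :* (r :* r) := con (+ 2) :* r :* (con (+ 2) :* r)) refl r))))))
      f : Fin n → Fin (suc b₀)
      f i = bucket b₀ (y i + # B)
      g ρ : Vect n
      g = grid B f
      ρ i = y i - g i
      0≤y+B : ∀ i → # 0 ≤ y i + # B
      0≤y+B i = subst (# 0 ≤_) (solve 2 (λ b y → y :- (:- b) := y :+ b) refl (# B) (y i)) (≤⇒0≤- (proj₁ (y-In i)))
      0≤ρ : ∀ i → # 0 ≤ ρ i
      0≤ρ i = subst (# 0 ≤_) (solve 3 (λ y b k → y :+ b :- k := y :- (k :- b)) refl (y i) (# B) (# (F.toℕ (f i))))
          (≤⇒0≤- (bucket-lower b₀ (y i + # B) (0≤y+B i)))
      ρ≤1 : ∀ i → ρ i ≤ # 1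
      ρ≤1 i = ≤-by (≤⇒0≤- (<⇒≤ (bucket-upper b₀ (y i + # B) (≤-<-trans (≤-trans (+-mono (proj₂ (y-In i)) ≤-refl)
          (≡⇒≤ (trans (sym (#-+ B B)) (cong # (sym b₀≡))))) (#-mono-< (ℕₚ.n<1+n b₀))))))
        (trans (solve 3 (λ y b k → con (+ 1) := y :- (k :- b) :+ (con (+ 1) :+ k :- (y :+ b))) refl (y i) (# B)
            (# (F.toℕ (f i)))) (+-congʳ (+-congˡ (sym (#-+ 1 (F.toℕ (f i)))))))
      -B≤g : ∀ i → - # B ≤ g i
      -B≤g i = ≤-by (0≤# (F.toℕ (f i))) (+-comm _ _)

      -- Rounding down keeps `ρ` in [0, 1]. As all entries are nonnegative, only this cross term can
      -- be negative, and `g` ≥ -B limits it.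
      gρ≥ : - (# B * total) ≤ form A⁺D g ρ
      gρ≥ = ≤-trans (≡⇒≤ (sym (trans (sum-cong (λ i → trans (sum-*ˡ (- # B) (A⁺D i)) refl))
          (trans (sum-*ˡ (- # B) _) (solve 2 (λ b t → :- b :* t := :- (b :* t)) refl (# B) total)))))
        (≤-trans (sum-mono (λ i → sum-mono (λ j → each i j))) (≡⇒≤ (sym (form-sum A⁺D g ρ))))
        where
        each : ∀ i j → - # B * A⁺D i j ≤ A⁺D i j * (g i * ρ j)
        each i j = ≤-trans (≡⇒≤ (*-comm _ _)) (*-monoˡ (0≤A⁺D i j) (≤-by
            (+-nonneg (*-nonneg (0≤ρ j) (≤⇒0≤- (-B≤g i))) (*-nonneg (0≤# B) (≤⇒0≤- (ρ≤1 j))))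
            (solve 3 (λ b g r → g :* r := :- b :+ (r :* (g :- (:- b)) :+ b :* (con (+ 1) :- r))) refl (# B) (g i) (ρ j))))

      ρρ≥ : # 0 ≤ form A⁺D ρ ρ
      ρρ≥ = ≤-trans (sum-nonneg (λ i → sum-nonneg (λ j → *-nonneg (0≤A⁺D i j) (*-nonneg (0≤ρ i) (0≤ρ j)))))
          (≡⇒≤ (sym (form-sum A⁺D ρ ρ)))

      A⁺D-symm : Symm A⁺D
      A⁺D-symm i j = cong₂ _+_ (A-symm i j) swap
        where
        swap : Id i j * D i ≡ Id j i * D j
        swap with Id-cases i j
        ... | inj₁ e = trans (trans (cong (_* D i) e) (zeroˡ _)) (sym (trans (cong (_* D j) (trans (Id-symm j i) e)) (zeroˡ _)))
        ... | inj₂ refl = refl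

      y-form : - (# 2 * (# B * total)) ≤ form A⁺D y y
      y-form = ≤-trans (≤-by (+-nonneg (+-nonneg (grid-form f) ρρ≥) (*-nonneg (0≤# 2) (≤⇒0≤- gρ≥)))
        (solve 4 (λ a b c t → con (+ 1) :* con (+ 1) :* a :+ con (+ 2) :* (con (+ 1) :* con (+ 1)) :* b :+ con (+ 1) :* con
            (+ 1) :* c := :- (con (+ 2) :* t) :+ (a :+ c :+ con (+ 2) :* (b :- (:- t)))) refl (form A⁺D g g) (form A⁺D g ρ)
            (form A⁺D ρ ρ) (# B * total)))
        (≡⇒≤ (trans (sym (form-lin A⁺D-symm (# 1) (# 1) g ρ)) (form-cong {M = A⁺D} (λ _ _ → refl) y≡ y≡)))
        where
        y≡ : ∀ i → # 1 * g i + # 1 * ρ i ≡ y i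
        y≡ i = solve 2 (λ y g → con (+ 1) :* g :+ con (+ 1) :* (y :- g) := y) refl (y i) (g i)

      yy≥ : # B * # B ≤ # 4 * dot y y
      yy≥ = # B * # B =⟨ cong₂ _*_ (sym c2r) (sym c2r) ⟩ c * (# 2 * r) * (c * (# 2 * r)) =⟨ solve 2
          (λ c r → c :* (con (+ 2) :* r) :* (c :* (con (+ 2) :* r)) := con (+ 4) :* (c :* c :* (r :* r))) refl c r ⟩
        # 4 * (c * c * (r * r)) ≤⟨ *-monoˡ (0≤# 4) (*-monoˡ (sq≥0 c) (proj₁ (proj₂ (proj₂ rt)))) ⟩ # 4 * (c * c * dot x x) =⟨
            cong (# 4 *_) (trans (*-assoc c c _) (sym (trans (dot-*ˡ y x c) (cong (c *_) (dot-*ʳ x x c))))) ⟩ # 4 * dot y y ∎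

      8total≤B : # 8 * total ≤ # B
      8total≤B = ≤-trans (*-monoˡ (0≤# 8) total≤) (≤-trans (≡⇒≤ (sym (#-* 8 (n ℕ.* n ℕ.+ κ)))) (#-mono B-large))

      y-psd : # 0 ≤ form A⁺D y y + dot y y
      y-psd = *-cancel (0<#suc 3) (≤-trans (≡⇒≤ (zeroʳ (# 4))) (≤-trans
          (+-nonneg (+-nonneg (*-nonneg (0≤# 4) (≤⇒0≤- y-form)) (≤⇒0≤- yy≥)) (*-nonneg (0≤# B) (≤⇒0≤- 8total≤B)))
        (≡⇒≤ (solve 4 (λ a d b t → con (+ 4) :* (a :- (:- (con (+ 2) :* (b :* t)))) :+ (con (+ 4) :* d :- b :* b) :+ b :*
            (b :- con (+ 8) :* t) := con (+ 4) :* (a :+ d)) refl (form A⁺D y y) (dot y y) (# B) total))))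

      x-psd : # 0 ≤ form A⁺D x x + dot x x
      x-psd = *-cancel (*-pos 0<c 0<c) (≤-trans (≡⇒≤ (zeroʳ (c * c))) (≤-trans y-psd
          (≡⇒≤ (trans (cong₂ _+_ (trans (form-*ˡ A⁺D y x c) (cong (c *_) (form-*ʳ A⁺D x x c)))
          (trans (dot-*ˡ y x c) (cong (c *_) (dot-*ʳ x x c))))
        (solve 3 (λ c a d → c :* (c :* a) :+ c :* (c :* d) := c :* c :* (a :+ d)) refl c (form A⁺D x x) (dot x x))))))

    M-form : ∀ x → form M x x ≡ form A⁺D x x + dot x x
    M-form x = trans (formD (λ i → D i + # 1) x) (trans (+-congʳ (trans
        (sum-cong (λ i → trans (distribʳ (x i * x i) (D i) (# 1)) (+-congʳ (*-identityˡ _)))) (sum-+ _ _)))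
        (trans (sym (+-assoc _ _ _)) (+-congˡ (sym (formD D x)))))

    M-psd : PSD M
    M-psd x with dot x x ≟ # 0
    ... | no ne = ≤-trans (Direction.x-psd x (nonneg≢0⇒pos (dot-self x) ne)) (≡⇒≤ (sym (M-form x)))
    ... | yes e = ≡⇒≤ (sym (sum-≡0 (λ i → trans (cong (_* mv M x i) (dot-self≡0 e i)) (zeroˡ _))))

  module Duality {n} (A : Mat n) (κ : ℕ)
    (rounded : ∀ fs σ → # 0 < σ → (∀ i → cov fs i i ≤ σ) → - (σ * # κ) ≤ lform A fs) (B b₀ : ℕ) where

    -- For D ≥ 0, membership gives a · D + c ≥ ⟨A + diag D, cov fs⟩ + σ(κ - sum D). These are the
    -- constraints that follow from semidefiniteness of A + diag D and the budget.
    𝒫 : Con n → Set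
    𝒫 (a , c) = Σ (List (Vect n)) λ fs → Σ ℚ λ σ → (# 0 ≤ σ) × (∀ i → cov fs i i ≤ a i + σ) × (lform A fs + σ * # κ ≤ c)

    cone : Cone 𝒫
    cone = record { add = add ; scale = scale }
      where
      add : ∀ {x y} → 𝒫 x → 𝒫 y → 𝒫 (x ⊕ y)
      add {a , c} {b , e} (fs , σ , 0≤σ , cv , lf) (gs , τ , 0≤τ , cv′ , lf′) = fs ++ gs , σ + τ , +-nonneg 0≤σ 0≤τ
        , (λ i → ≤-trans (≡⇒≤ (cov-++ fs gs i i)) (≤-trans (+-mono (cv i) (cv′ i))
            (≡⇒≤ (solve 4 (λ a s b t → a :+ s :+ (b :+ t) := a :+ b :+ (s :+ t)) refl (a i) σ (b i) τ))))
        , ≤-trans (≡⇒≤ (trans (+-congˡ (lform-++ A fs gs)) (solve 5 (λ a b s t k → a :+ b :+ (s :+ t) :* k := a :+ s :* k :+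
            (b :+ t :* k)) refl (lform A fs) (lform A gs) σ τ (# κ)))) (+-mono lf lf′)
      scale : ∀ {t x} → # 0 < t → 𝒫 x → 𝒫 (t ⊙ x)
      scale {t} {a , c} 0<t (fs , σ , 0≤σ , cv , lf) = proj₁ rs , t * σ , *-nonneg (<⇒≤ 0<t) 0≤σ
        , (λ i → ≤-trans (≡⇒≤ (proj₁ (proj₂ rs) i i)) (≤-trans (*-monoˡ (<⇒≤ 0<t) (cv i)) (≡⇒≤ (distribˡ t _ _))))
        , ≤-trans (≡⇒≤ (trans (+-congˡ (proj₂ (proj₂ rs) A)) (solve 4 (λ t l s k → t :* l :+ t :* s :* k := t :* (l :+ s :* k))
            refl t (lform A fs) σ (# κ)))) (*-monoˡ (<⇒≤ 0<t) lf)
        where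
        rs : Σ (List (Vect n)) λ gs → (∀ i j → cov gs i j ≡ t * cov fs i j) × (∀ A → lform A gs ≡ t * lform A fs)
        rs = rescale t 0<t fs

    testCon : (Fin n → Fin (suc b₀)) → Con n
    testCon f = (λ i → grid B f i * grid B f i) , form A (grid B f) (grid B f)
    posCon : Fin n → Con n
    posCon i = Id i , # 0
    budget : Con n
    budget = (λ _ → - # 1) , # κ

    constraints : List (Con n)
    constraints = budget ∷ map posCon (allFin n) ++ map testCon (funs n (suc b₀))

    constraints-𝒫 : All 𝒫 constraints
    constraints-𝒫 = ([] , # 1 , 0≤# 1 , (λ i → ≡⇒≤ (solve 0 (con (+ 0) := :- con (+ 1) :+ con (+ 1)) refl)) , ≡⇒≤
        (solve 1 (λ k → con (+ 0) :+ con (+ 1) :* k := k) refl (# κ)))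
      ∷ Allₚ.++⁺ (Allₚ.map⁺ (All.universal (λ i → [] , # 0 , ≤-refl , (λ j → ≤-trans (0≤Id i j) (≡⇒≤ (sym (+-identityʳ _)))) ,
          ≡⇒≤ (solve 1 (λ k → con (+ 0) :+ con (+ 0) :* k := con (+ 0)) refl (# κ))) (allFin n)))
          (Allₚ.map⁺ (All.universal (λ f → grid B f ∷ [] , # 0 , ≤-refl , (λ i → ≤-refl) , ≡⇒≤
              (solve 2 (λ l k → l :+ con (+ 0) :+ con (+ 0) :* k := l) refl (form A (grid B f) (grid B f)) (# κ)))
              (funs n (suc b₀))))

    -- With a = 0 the Gram diagonal is at most σ although `lform A fs` ≤ c - σκ, against `rounded`.
    -- As σ may be 0, it is raised by η = -c/(κ + 1), small enough that c + ηκ stays negative.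
    no-refutation : ¬ Refutation 𝒫
    no-refutation ((a , c) , (fs , σ , 0≤σ , cv , lf) , a≡0 , c<0) = ≤∧>⇒⊥ bound (≤-<-trans ≤-refl small)
      where
      K₁ η : ℚ
      K₁ = # κ + # 1
      0<K₁ : # 0 < K₁
      0<K₁ = <-≤-trans (0<#suc 0) (≤-by (0≤# κ) (+-comm _ _))
      0<-c : # 0 < - c
      0<-c = subst (# 0 <_) (+-identityˡ (- c)) (<⇒0<- c<0)
      η = - c * inv K₁
      0<η : # 0 < η
      0<η = *-pos 0<-c (inv-pos 0<K₁)
      ηK : η * K₁ ≡ - c
      ηK = trans (*-assoc _ _ _) (trans (cong (- c *_) (trans (*-comm _ _) (inv-posʳ 0<K₁))) (*-identityʳ _))
      0<σ+η : # 0 < σ + η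
      0<σ+η = <-≤-trans 0<η (≤-by 0≤σ (+-comm _ _))
      low : - ((σ + η) * # κ) ≤ lform A fs
      low = rounded fs (σ + η) 0<σ+η (λ i → ≤-trans (cv i) (≤-trans (≡⇒≤ (trans (+-congˡ (a≡0 i)) (+-identityˡ σ)))
          (≤-by (<⇒≤ 0<η) refl)))
      bound : # 0 ≤ c + η * # κ
      bound = ≤-trans (+-nonneg (≤⇒0≤- low) (≤⇒0≤- lf)) (≡⇒≤ (solve 5 (λ l s e k c → l :- (:- ((s :+ e) :* k)) :+
          (c :- (l :+ s :* k)) := c :+ e :* k) refl (lform A fs) σ η (# κ) c))
      small : c + η * # κ < # 0
      small = <-≤-trans (subst₂ _<_ (+-identityˡ (c + η * # κ)) refl (+-mono-<-≤ 0<η (≤-refl {c + η * # κ})))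
          (≡⇒≤ (trans (solve 3 (λ e k c → e :+ (c :+ e :* k) := c :+ e :* (k :+ con (+ 1))) refl η (# κ) c)
          (trans (+-congʳ ηK) (solve 1 (λ c → c :+ :- c := con (+ 0)) refl c))))

    -- Sealed, so that the elimination is not unfolded wherever `D` occurs.
    opaque
      solution : Solution constraints
      solution = [ (λ s → s) , (λ r → ⊥-elim (no-refutation r)) ]′ (farkas cone constraints constraints-𝒫)

    D : Vect n
    D = proj₁ solution

    0≤D : ∀ i → # 0 ≤ D i
    0≤D i = ≤-trans (All.lookup (Allₚ.map⁻ (Allₚ.++⁻ˡ (map posCon (allFin n)) (All.tail (proj₂ solution)))) (∈-allFin i))
        (≡⇒≤ (trans (+-identityʳ _) (mv-Id D i)))

    D≤κ : sum D ≤ # κ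
    D≤κ = ≤-by (All.head (proj₂ solution)) (trans (solve 2 (λ k s → k := s :+ (:- s :+ k)) refl (# κ) (sum D))
        (+-congʳ (+-congˡ (sym (trans (sum-cong (λ i → solve 1 (λ d → :- con (+ 1) :* d := :- d) refl (D i))) (sum-neg D))))))

    grid-D : ∀ (f : Fin n → Fin (suc b₀)) → # 0 ≤ form A (grid B f) (grid B f) + sum (λ i → D i * (grid B f i * grid B f i))
    grid-D g = transfer (funs-complete (Allₚ.map⁻ (Allₚ.++⁻ʳ (map posCon (allFin n)) (All.tail (proj₂ solution)))) g)
      where
      transfer : (Σ (Fin n → Fin (suc b₀)) λ f → (# 0 ≤ eval (testCon f) D) × (∀ i → f i ≡ g i)) → # 0 ≤ form A (grid B g)
          (grid B g) + sum (λ i → D i * (grid B g i * grid B g i))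
      transfer (f , h , eq) = ≤-trans h (≡⇒≤ (trans (+-comm _ _) (cong₂ _+_ (form-cong {M = A} (λ _ _ → refl) same same)
          (sum-cong (λ i → trans (*-comm _ _) (cong (λ u → D i * (u * u)) (same i)))))))
        where
        same : ∀ i → grid B f i ≡ grid B g i
        same i = cong (λ k → # (F.toℕ k) - # B) (eq i)

  -- Cuts as quadratic forms

  ⟦_⟧ : Bool → ℚ
  ⟦ true ⟧ = # 1
  ⟦ false ⟧ = # 0

  0≤⟦⟧ : ∀ b → # 0 ≤ ⟦ b ⟧
  0≤⟦⟧ true = 0≤# 1
  0≤⟦⟧ false = ≤-refl

  ⟦⟧≤1 : ∀ b → ⟦ b ⟧ ≤ # 1
  ⟦⟧≤1 true = ≤-refl
  ⟦⟧≤1 false = 0≤# 1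

  ℕsum-tabulate : ∀ {m n} (f : Fin m → ℕ) (g : Fin n → Fin m) → # (ℕsum (map f (tabulate g))) ≡ sum (λ i → # (f (g i)))
  ℕsum-tabulate {n = zero} f g = sym (sum-empty _)
  ℕsum-tabulate {n = suc n} f g = trans (#-+ (f (g zero)) _) (trans (+-congʳ (ℕsum-tabulate f (λ i → g (suc i))))
      (sym (sum-suc _)))

  lt : ∀ {n} → Fin n → Fin n → Bool
  lt i j = F.toℕ i <ᵇ F.toℕ j

  pairCount-sum : ∀ {n} (R : Fin n → Fin n → Bool) → # (pairCount n R) ≡ sum (λ i → sum (λ j → ⟦ lt i j ⟧ * ⟦ R i j ⟧))
  pairCount-sum {n} R = trans (ℕsum-tabulate {n} _ (λ i → i)) (sum-cong
      (λ i → trans (ℕsum-tabulate {n} _ (λ j → j)) (sum-cong (λ j → each (lt i j) (R i j)))))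
    where
    each : ∀ a b → # (if a ∧ b then 1 else 0) ≡ ⟦ a ⟧ * ⟦ b ⟧
    each true true = sym (*-identityˡ _)
    each true false = sym (*-identityˡ _)
    each false b = sym (zeroˡ _)

  lt-trichotomy : ∀ {n} (i j : Fin n) → i ≢ j → ⟦ lt i j ⟧ + ⟦ lt j i ⟧ ≡ # 1
  lt-trichotomy {suc n} zero zero ne = ⊥-elim (ne refl)
  lt-trichotomy {suc n} zero (suc j) ne = +-identityʳ _
  lt-trichotomy {suc n} (suc i) zero ne = +-identityˡ _
  lt-trichotomy {suc n} (suc i) (suc j) ne = lt-trichotomy i j (λ e → ne (cong suc e))

  double-count : ∀ {n} (X : Mat n) → Symm X → (∀ i → X i i ≡ # 0) → sum (λ i → sum (X i)) ≡ # 2 * sum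
      (λ i → sum (λ j → ⟦ lt i j ⟧ * X i j))
  double-count {n} X sy irr = trans (sum-cong (λ i → trans (sum-cong (λ j → each i j)) (sum-+ _ _)))
      (trans (sum-+ _ _) (trans (+-congʳ (trans (sum-swap (λ i j → ⟦ lt j i ⟧ * X i j))
      (sum-cong (λ j → sum-cong (λ i → cong (⟦ lt j i ⟧ *_) (sy i j))))))
    (solve 1 (λ s → s :+ s := con (+ 2) :* s) refl _)))
    where
    each : ∀ i j → X i j ≡ ⟦ lt i j ⟧ * X i j + ⟦ lt j i ⟧ * X i j
    each i j with i F.≟ j
    ... | yes refl = trans (irr i) (sym (trans (cong (λ x → ⟦ lt i i ⟧ * x + ⟦ lt i i ⟧ * x) (irr i))
        (solve 1 (λ a → a :* con (+ 0) :+ a :* con (+ 0) := con (+ 0)) refl ⟦ lt i i ⟧)))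
    ... | no ne = trans (sym (*-identityˡ (X i j))) (trans (cong (_* X i j) (sym (lt-trichotomy i j ne))) (distribʳ _ _ _))

  pairCount-double : ∀ {n} (R : Fin n → Fin n → Bool) → (∀ i j → R i j ≡ R j i) → (∀ i → R i i ≡ false) → # 2 * #
      (pairCount n R) ≡ sum (λ i → sum (λ j → ⟦ R i j ⟧))
  pairCount-double R sy irr = trans (cong (# 2 *_) (pairCount-sum R)) (sym
      (double-count (λ i j → ⟦ R i j ⟧) (λ i j → cong ⟦_⟧ (sy i j)) (λ i → cong ⟦_⟧ (irr i))))

  ⊔-foldr : ∀ (x : ℕ) xs → x ∈ xs → x ℕ.≤ foldr ℕ._⊔_ 0 xs
  ⊔-foldr x (y ∷ xs) (here refl) = ℕₚ.m≤m⊔n x _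
  ⊔-foldr x (y ∷ xs) (there h) = ℕₚ.≤-trans (⊔-foldr x xs h) (ℕₚ.m≤n⊔m y _)

  -- Stated for abstract `a` and `b` with their equations, because the two extensions inside
  -- `allColourings` are anonymous functions.
  extensions-complete : ∀ {n} (a b : (Fin n → Bool) → Fin (suc n) → Bool) → (∀ f → a f zero ≡ false) →
      (∀ f i → a f (suc i) ≡ f i) → (∀ f → b f zero ≡ true) → (∀ f i → b f (suc i) ≡ f i) →
    ∀ (S : Fin (suc n) → Bool) fs → Any (λ S′ → ∀ i → S′ i ≡ S (suc i)) fs → Any (λ S′ → ∀ i → S′ i ≡ S i)
        (concatMap (λ f → a f ∷ b f ∷ []) fs)
  extensions-complete a b a₀ aₛ b₀ bₛ S (f ∷ fs) (there h) = there (there (extensions-complete a b a₀ aₛ b₀ bₛ S fs h))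
  extensions-complete a b a₀ aₛ b₀ bₛ S (f ∷ fs) (here h) with S zero in eq
  ... | false = here (λ { zero → trans (a₀ f) (sym eq) ; (suc i) → trans (aₛ f i) (h i) })
  ... | true = there (here (λ { zero → trans (b₀ f) (sym eq) ; (suc i) → trans (bₛ f i) (h i) }))

  colourings-complete : ∀ n (S : Fin n → Bool) → Any (λ S′ → ∀ i → S′ i ≡ S i) (allColourings n)
  colourings-complete zero S = here (λ ())
  colourings-complete (suc n) S = extensions-complete _ _ (λ _ → refl) (λ _ _ → refl) (λ _ → refl) (λ _ _ → refl) S
      (allColourings n) (colourings-complete n (λ i → S (suc i)))

  Sign : ℚ → Set
  Sign x = (x ≡ # 1) ⊎ (x ≡ - # 1)

  module CutForm {n} (G : Graph n) where
    A : Mat n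
    A i j = ⟦ adj G i j ⟧

    A-symm : Symm A
    A-symm i j = cong ⟦_⟧ (adj-sym G i j)

    A-diag : ∀ i → A i i ≡ # 0
    A-diag i = cong ⟦_⟧ (irrefl G i)

    σ : Bool → ℚ
    σ true = # 1
    σ false = - # 1

    xor-sym : ∀ a b → a xor b ≡ b xor a
    xor-sym true true = refl
    xor-sym true false = refl
    xor-sym false true = refl
    xor-sym false false = refl

    -- An edge with signs s and t contributes (1 - st)/2 to the cut, and the double sum meets it
    -- twice.
    cut-value : ∀ S → # 4 * # (cut G S) ≡ # 2 * # (edges G) - form A (λ i → σ (S i)) (λ i → σ (S i))
    cut-value S = trans (solve 1 (λ c → con (+ 4) :* c := con (+ 2) :* (con (+ 2) :* c)) refl (# (cut G S)))
        (trans (cong (# 2 *_) (pairCount-double _ (λ i j → cong₂ _∧_ (adj-sym G i j) (xor-sym (S i) (S j)))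
        (λ i → cong (_∧ (S i xor S i)) (irrefl G i))))
      (trans (sym (trans (sum-cong (λ i → sum-*ˡ (# 2) _)) (sum-*ˡ (# 2) _)))
          (trans (sum-cong (λ i → trans (sum-cong (λ j → each (adj G i j) (S i) (S j))) (sum-- _ _))) (trans (sum-- _ _)
        (cong₂ _-_ (sym (pairCount-double (adj G) (adj-sym G) (irrefl G))) (sym (form-sum A _ _)))))))
      where
      each : ∀ a s t → # 2 * ⟦ a ∧ (s xor t) ⟧ ≡ ⟦ a ⟧ - ⟦ a ⟧ * (σ s * σ t)
      each false s t = solve 1 (λ u → con (+ 2) :* con (+ 0) := con (+ 0) :- con (+ 0) :* u) refl (σ s * σ t)
      each true true true = solve 0 (con (+ 2) :* con (+ 0) := con (+ 1) :- con (+ 1) :* (con (+ 1) :* con (+ 1))) refl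
      each true true false = solve 0 (con (+ 2) :* con (+ 1) := con (+ 1) :- con (+ 1) :* (con (+ 1) :* (:- con (+ 1)))) refl
      each true false true = solve 0 (con (+ 2) :* con (+ 1) := con (+ 1) :- con (+ 1) :* ((:- con (+ 1)) :* con (+ 1))) refl
      each true false false = solve 0 (con (+ 2) :* con (+ 0) := con (+ 1) :- con (+ 1) :* ((:- con (+ 1)) :* (:- con (+ 1))))
          refl

    cut≤mc : ∀ S → # (cut G S) ≤ # (mc G)
    cut≤mc S = go (colourings-complete n S)
      where
      cut-cong : ∀ {S′} → (∀ i → S′ i ≡ S i) → # (cut G S) ≡ # (cut G S′)
      cut-cong {S′} h = trans (pairCount-sum _) (trans (sum-cong (λ i → sum-cong
          (λ j → cong₂ (λ a b → ⟦ lt i j ⟧ * ⟦ adj G i j ∧ (a xor b) ⟧) (sym (h i)) (sym (h j))))) (sym (pairCount-sum _)))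
      go : Any (λ S′ → ∀ i → S′ i ≡ S i) (allColourings n) → # (cut G S) ≤ # (mc G)
      go a = ≤-trans (≡⇒≤ (cut-cong (Anyₚ.lookup-result a))) (#-mono (⊔-foldr _ _
          (∈-map⁺ (cut G) (∈-lookup {xs = allColourings n} (Any.index a)))))

    -- By `cut-value` the form at a sign vector is 2m - 4 cut ≥ 2m - 4 mc, which is -2 times the
    -- doubled surplus.
    κ₀ : ℚ
    κ₀ = # (2 ℕ.* twiceSp G)

    sign-bound : ∀ S → - κ₀ ≤ form A (λ i → σ (S i)) (λ i → σ (S i))
    sign-bound S = ≤-by (+-nonneg (*-nonneg (0≤# 4) (≤⇒0≤- (cut≤mc S))) (*-nonneg (0≤# 2) (≤⇒0≤- monus)))
      (trans (solve 3 (λ f c m → f := con (+ 2) :* m :- con (+ 4) :* c :+ (f :- (con (+ 2) :* m :- con (+ 4) :* c))) refl f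
          (# (cut G S)) (# (edges G)))
        (trans (cong (λ q → # 2 * # (edges G) - # 4 * # (cut G S) + (f - (# 2 * # (edges G) - q))) (cut-value S))
          (trans (solve 5 (λ f c m t s → con (+ 2) :* m :- con (+ 4) :* c :+ (f :- (con (+ 2) :* m :- (con (+ 2) :* m :- f))) :=
              :- (con (+ 2) :* s) :+ (con (+ 4) :* (t :- c) :+ con (+ 2) :* (s :- (con (+ 2) :* t :- m)))) refl f (# (cut G S))
              (# (edges G)) (# (mc G)) (# (twiceSp G)))
            (+-congˡ (cong -_ (sym (#-* 2 (twiceSp G))))))))
      where
      f : ℚ
      f = form A (λ i → σ (S i)) (λ i → σ (S i))
      monus : # 2 * # (mc G) - # (edges G) ≤ # (twiceSp G)
      monus = ≤-trans (≤-by (≤⇒0≤- (≤-trans (#-mono (ℕₚ.m≤n+m∸n (2 ℕ.* mc G) (edges G))) (≡⇒≤ (#-+ (edges G) (twiceSp G)))))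
          refl) (≡⇒≤ (trans (cong (λ q → # 2 * # (mc G) - # (edges G) + (# (edges G) + # (twiceSp G) - q)) (#-* 2 (mc G)))
          (solve 3 (λ t m s → con (+ 2) :* t :- m :+ (m :+ s :- con (+ 2) :* t) := s) refl (# (mc G)) (# (edges G))
          (# (twiceSp G)))))

    Cube : Vect n → Set
    Cube t = ∀ i → In (# 1) (t i)

    put : Vect n → Fin n → ℚ → Vect n
    put t k s i with i F.≟ k
    ... | yes _ = s
    ... | no _ = t i

    put-lin : ∀ t k s i → put t k s i ≡ # 1 * put t k (# 0) i + s * Id k i
    put-lin t k s i with i F.≟ k
    ... | yes refl = trans (sym (*-identityʳ s)) (trans (cong (s *_) (sym (Id-diag i)))
        (solve 2 (λ s d → s :* d := con (+ 1) :* con (+ 0) :+ s :* d) refl s (Id i i)))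
    ... | no ne = trans (solve 2 (λ t s → t := con (+ 1) :* t :+ s :* con (+ 0)) refl (t i) s)
        (cong (λ d → # 1 * t i + s * d) (sym (Id-off k i (λ e → ne (sym e)))))

    put-same : ∀ t k i → put t k (t k) i ≡ t i
    put-same t k i with i F.≟ k
    ... | yes refl = refl
    ... | no _ = refl

    put-form : ∀ t k s → form A (put t k s) (put t k s) ≡ form A (put t k (# 0)) (put t k (# 0)) + # 2 * s * form A
        (put t k (# 0)) (Id k)
    put-form t k s = trans (form-cong {M = A} (λ _ _ → refl) (put-lin t k s) (put-lin t k s))
        (trans (form-lin A-symm (# 1) s _ (Id k)) (trans (cong (λ d → # 1 * # 1 * a + # 2 * (# 1 * s) * g + s * s * d)
        (trans (form-column A k) (A-diag k)))
      (solve 3 (λ a g s → con (+ 1) :* con (+ 1) :* a :+ con (+ 2) :* (con (+ 1) :* s) :* g :+ s :* s :* con (+ 0) := a :+ con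
          (+ 2) :* s :* g) refl a g s)))
      where
      a g : ℚ
      a = form A (put t k (# 0)) (put t k (# 0))
      g = form A (put t k (# 0)) (Id k)

    -- The form is affine in each coordinate, so some choice of sign does not increase it.
    best-sign : ∀ t k → In (# 1) (t k) → Σ ℚ λ s → Sign s × (form A (put t k s) (put t k s) ≤ form A t t)
    best-sign t k (lo , hi) = choose (≤-total (# 0) g)
      where
      a g : ℚ
      a = form A (put t k (# 0)) (put t k (# 0))
      g = form A (put t k (# 0)) (Id k)
      here-form : form A t t ≡ a + # 2 * t k * g
      here-form = trans (sym (form-cong {M = A} (λ _ _ → refl) (put-same t k) (put-same t k))) (put-form t k (t k))
      choose : # 0 ≤ g ⊎ g ≤ # 0 → Σ ℚ λ s → Sign s × (form A (put t k s) (put t k s) ≤ form A t t)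
      choose (inj₁ 0≤g) = - # 1 , inj₂ refl , ≤-by (*-nonneg (0≤# 2) (*-nonneg 0≤g (≤⇒0≤- lo)))
          (trans here-form (trans (solve 3 (λ a g t → a :+ con (+ 2) :* t :* g := a :+ con (+ 2) :* (:- con (+ 1)) :* g :+ con
          (+ 2) :* (g :* (t :- (:- con (+ 1))))) refl a g (t k)) (+-congˡ (sym (put-form t k (- # 1))))))
      choose (inj₂ g≤0) = # 1 , inj₁ refl , ≤-by (*-nonneg (0≤# 2) (*-nonneg (≤0⇒0≤- g≤0) (≤⇒0≤- hi)))
          (trans here-form (trans (solve 3 (λ a g t → a :+ con (+ 2) :* t :* g := a :+ con (+ 2) :* con (+ 1) :* g :+ con (+ 2)
          :* (:- g :* (con (+ 1) :- t))) refl a g (t k)) (+-congˡ (sym (put-form t k (# 1))))))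

    sign-In : ∀ {s} → Sign s → In (# 1) s
    sign-In (inj₁ refl) = ≤-trans neg (0≤# 1) , ≤-refl
      where
      neg : - # 1 ≤ # 0
      neg = ≤-by (0≤# 1) (solve 0 (con (+ 0) := :- con (+ 1) :+ con (+ 1)) refl)
    sign-In (inj₂ refl) = ≤-refl , ≤-trans (≤-by (0≤# 1) (solve 0 (con (+ 0) := :- con (+ 1) :+ con (+ 1)) refl)) (0≤# 1)

    -- Coordinates are replaced one at a time; the last component records that finished coordinates
    -- remain signs.
    to-signs : ∀ (ks : List (Fin n)) t → Cube t → Σ (Vect n) λ t′ → Cube t′ × (form A t′ t′ ≤ form A t t) × All
        (λ k → Sign (t′ k)) ks × (∀ i → Sign (t i) → Sign (t′ i))
    to-signs [] t c = t , c , ≤-refl , [] , λ i s → s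
    to-signs (k ∷ ks) t c = extend (to-signs ks (put t k (proj₁ bs)) cube′)
      where
      bs : Σ ℚ λ s → Sign s × (form A (put t k s) (put t k s) ≤ form A t t)
      bs = best-sign t k (c k)
      cube′ : Cube (put t k (proj₁ bs))
      cube′ i with i F.≟ k
      ... | yes _ = sign-In (proj₁ (proj₂ bs))
      ... | no _ = c i
      new : Sign (put t k (proj₁ bs) k)
      new with k F.≟ k
      ... | yes _ = proj₁ (proj₂ bs)
      ... | no ne = ⊥-elim (ne refl)
      old : ∀ i → Sign (t i) → Sign (put t k (proj₁ bs) i)
      old i h with i F.≟ k
      ... | yes _ = proj₁ (proj₂ bs)
      ... | no _ = h
      extend : (Σ (Vect n) λ t′ → Cube t′ × (form A t′ t′ ≤ form A (put t k (proj₁ bs)) (put t k (proj₁ bs))) × All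
          (λ k → Sign (t′ k)) ks × (∀ i → Sign (put t k (proj₁ bs) i) → Sign (t′ i))) →
        Σ (Vect n) λ t′ → Cube t′ × (form A t′ t′ ≤ form A t t) × All (λ k → Sign (t′ k)) (k ∷ ks) ×
            (∀ i → Sign (t i) → Sign (t′ i))
      extend (t′ , c′ , le , sg , keep) = t′ , c′ , ≤-trans le (proj₂ (proj₂ bs)) , keep k new ∷ sg , λ i h → keep i (old i h)

    cube-bound : ∀ t → Cube t → - κ₀ ≤ form A t t
    cube-bound t c = conclude (to-signs (allFin n) t c)
      where
      conclude : (Σ (Vect n) λ t′ → Cube t′ × (form A t′ t′ ≤ form A t t) × All (λ k → Sign (t′ k)) (allFin n) ×
          (∀ i → Sign (t i) → Sign (t′ i))) → - κ₀ ≤ form A t t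
      conclude (t′ , _ , le , sg , _) = ≤-trans (sign-bound S) (≤-trans (≡⇒≤ (form-cong {M = A} (λ _ _ → refl) S≡ S≡)) le)
        where
        toBool : ∀ {x} → Sign x → Bool
        toBool (inj₁ _) = true
        toBool (inj₂ _) = false
        toBool-σ : ∀ {x} (s : Sign x) → σ (toBool s) ≡ x
        toBool-σ (inj₁ e) = sym e
        toBool-σ (inj₂ e) = sym e
        S : Fin n → Bool
        S i = toBool (All.lookup sg (∈-allFin i))
        S≡ : ∀ i → σ (S i) ≡ t′ i
        S≡ i = toBool-σ (All.lookup sg (∈-allFin i))

    cut-bound : ∀ ℓ → # 0 ≤ ℓ → ∀ t → (∀ i → In ℓ (t i)) → - (κ₀ * (ℓ * ℓ)) ≤ form A t t
    cut-bound ℓ 0≤ℓ t c with ℓ ≟ # 0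
    -- Scaling to the unit cube fails for ℓ = 0, but then t vanishes.
    ... | yes refl = ≡⇒≤ (trans (solve 1 (λ k → :- (k :* (con (+ 0) :* con (+ 0))) := con (+ 0)) refl κ₀)
        (sym (sum-≡0 (λ i → trans (cong (_* mv A t i) (≤-antisym (proj₂ (c i))
        (≤-trans (≡⇒≤ (solve 0 (con (+ 0) := :- con (+ 0)) refl)) (proj₁ (c i))))) (zeroˡ _)))))
    ... | no ne = ≤-trans (≡⇒≤ (solve 2 (λ k l → :- (k :* l) := l :* (:- k)) refl κ₀ (ℓ * ℓ)))
        (≤-trans (*-monoˡ (sq≥0 ℓ) (cube-bound u cu)) (≡⇒≤ scaled))
      where
      i′ : ℚ
      i′ = inv ℓ
      0<ℓ : # 0 < ℓ
      0<ℓ = nonneg≢0⇒pos 0≤ℓ ne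
      ℓi : ℓ * i′ ≡ # 1
      ℓi = inv-inverse ne
      u : Vect n
      u j = i′ * t j
      cu : Cube u
      cu j = *-cancel 0<ℓ (≤-trans (≡⇒≤ (solve 1 (λ l → l :* (:- con (+ 1)) := :- l) refl ℓ))
          (≤-trans (proj₁ (c j)) (≡⇒≤ (sym ℓu))))
           , *-cancel 0<ℓ (≤-trans (≡⇒≤ ℓu) (≤-trans (proj₂ (c j)) (≡⇒≤ (sym (*-identityʳ ℓ)))))
        where
        ℓu : ℓ * u j ≡ t j
        ℓu = trans (sym (*-assoc ℓ i′ (t j))) (trans (cong (_* t j) ℓi) (*-identityˡ _))
      scaled : ℓ * ℓ * form A u u ≡ form A t t
      scaled = trans (cong (ℓ * ℓ *_) (trans (form-*ˡ A u t i′) (cong (i′ *_) (form-*ʳ A t t i′))))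
          (trans (solve 3 (λ l i f → l :* l :* (i :* (i :* f)) := l :* i :* (l :* i) :* f) refl ℓ i′ (form A t t))
          (trans (cong (λ v → v * v * form A t t) ℓi) (solve 1 (λ f → con (+ 1) :* con (+ 1) :* f := f) refl (form A t t))))

  -- Pivot clustering

  eqᵇ : ∀ {n} → Fin n → Fin n → Bool
  eqᵇ i j = ⌊ i F.≟ j ⌋

  eqᵇ-refl : ∀ {n} (i : Fin n) → eqᵇ i i ≡ true
  eqᵇ-refl i with i F.≟ i
  ... | yes _ = refl
  ... | no ne = ⊥-elim (ne refl)

  eqᵇ-true : ∀ {n} (i j : Fin n) → eqᵇ i j ≡ true → i ≡ j
  eqᵇ-true i j e with i F.≟ j
  ... | yes p = p
  eqᵇ-true i j () | no _

  eqᵇ-false : ∀ {n} (i j : Fin n) → i ≢ j → eqᵇ i j ≡ false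
  eqᵇ-false i j ne with i F.≟ j
  ... | yes p = ⊥-elim (ne p)
  ... | no _ = refl

  eqᵇ-sym : ∀ {n} (i j : Fin n) → eqᵇ i j ≡ eqᵇ j i
  eqᵇ-sym i j with i F.≟ j
  ... | yes refl = sym (eqᵇ-refl i)
  ... | no ne = sym (eqᵇ-false j i (λ e → ne (sym e)))

  leᵇ : ℚ → ℚ → Bool
  leᵇ x y = ⌊ x ≤? y ⌋

  leᵇ-true : ∀ x y → leᵇ x y ≡ true → x ≤ y
  leᵇ-true x y e with x ≤? y
  ... | yes p = p
  leᵇ-true x y () | no _

  leᵇ-false : ∀ x y → leᵇ x y ≡ false → y < x
  leᵇ-false x y e with x ≤? y
  ... | no np = ≰⇒> np
  leᵇ-false x y () | yes _

  -- A label names the pivot of a cluster. `nothing` marks an isolated vertex, hence two such labels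
  -- do not count as the same.
  module Labelling {n : ℕ} (lab : Fin n → Maybe (Fin n)) where
    same : Maybe (Fin n) → Maybe (Fin n) → Bool
    same (just p) (just q) = eqᵇ p q
    same (just _) nothing = false
    same nothing _ = false

    same-sym : ∀ a b → same a b ≡ same b a
    same-sym (just p) (just q) = eqᵇ-sym p q
    same-sym (just _) nothing = refl
    same-sym nothing (just _) = refl
    same-sym nothing nothing = refl

    H : Graph n
    H = record { adj = λ i j → not (eqᵇ i j) ∧ same (lab i) (lab j)
      ; sym = λ i j → cong₂ (λ a b → not a ∧ b) (eqᵇ-sym i j) (same-sym (lab i) (lab j))
      ; irrefl = λ i → cong (λ a → not a ∧ same (lab i) (lab i)) (eqᵇ-refl i) }

    Together : Fin n → Fin n → Set
    Together i j = Σ (Fin n) λ p → (lab i ≡ just p) × (lab j ≡ just p)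

    same-together : ∀ i j → same (lab i) (lab j) ≡ true → Together i j
    same-together i j e with lab i | lab j
    ... | just p | just q = p , refl , cong just (sym (eqᵇ-true p q e))
    same-together i j () | just _ | nothing
    same-together i j () | nothing | _

    reach : ∀ {i j} → Reachable H i j → (i ≡ j) ⊎ Together i j
    reach r-here = inj₁ refl
    reach (r-step {i} {j} e r) with same-together i j (∧-right (not (eqᵇ i j)) _ e) | reach r
      where
      ∧-right : ∀ a b → a ∧ b ≡ true → b ≡ true
      ∧-right true b e = e
      ∧-right false b ()
    ... | t | inj₁ refl = inj₂ t
    ... | p , ei , ej | inj₂ (q , ej′ , ek) = inj₂ (p , ei , trans ek (trans (sym ej′) ej))

    H-cliques : IsDisjointUnionOfCliques H
    H-cliques i j ne r with reach r
    ... | inj₁ e = ⊥-elim (ne e)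
    ... | inj₂ (p , ei , ej) = cong₂ (λ a b → not a ∧ b) (eqᵇ-false i j ne) (trans (cong₂ same ei ej) (eqᵇ-refl p))

  module Clustering {n : ℕ} (G : Graph n) where
    adj⁺ : Fin n → Fin n → Bool
    adj⁺ i j = eqᵇ i j ∨ adj G i j

    -- The pairs misplaced when the closed neighbourhood of v becomes a cluster: i lies in it, and j
    -- belongs to the closed neighbourhood of exactly one of v and i.
    bad : Fin n → Fin n → Fin n → Bool
    bad v i j = adj⁺ v i ∧ (adj⁺ v j xor adj⁺ i j)

    cost : Fin n → ℚ
    cost v = sum (λ i → sum (λ j → ⟦ bad v i j ⟧))

    err : (Fin n → Maybe (Fin n)) → Fin n → Fin n → ℚ
    err lab i j = ⟦ adj G i j xor adj (Labelling.H lab) i j ⟧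

    size : (Fin n → Bool) → ℚ
    size S = sum (λ i → ⟦ S i ⟧)

    deg : (Fin n → Bool) → Fin n → ℚ
    deg S v = sum (λ i → ⟦ S i ∧ adj⁺ v i ⟧)

    errS : (Fin n → Bool) → (Fin n → Maybe (Fin n)) → ℚ
    errS S lab = sum (λ i → sum (λ j → ⟦ S i ⟧ * ⟦ S j ⟧ * err lab i j))

    -- Each pivot removes at least n/e vertices, so there are at most e of them, each costing 2c,
    -- and the leftover costs `R` = 2n²/e. The later choice c = n²/e² balances the two costs.
    module Run (e : ℕ) (1≤e : 1 ℕ.≤ e) (c R : ℚ) (0≤c : # 0 ≤ c) (eR : # e * R ≡ # 2 * (# n * # n))
        (cheap : # e * sum cost < # n * c) where
      0<e : # 0 < # e
      0<e = #-mono-< 1≤e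

      high : (Fin n → Bool) → Fin n → Bool
      high S v = S v ∧ leᵇ (# n) (# e * deg S v)

      -- `pivots` keeps the labels inside S, so the label of a removed pivot is never reused by the
      -- remainder.
      record Result (S : Fin n → Bool) (bound : ℚ) : Set where
        field
          lab : Fin n → Maybe (Fin n)
          outside : ∀ i → S i ≡ false → lab i ≡ nothing
          pivots : ∀ i w → lab i ≡ just w → S w ≡ true
          small : errS S lab ≤ bound

      ∧-split : ∀ a b → a ∧ b ≡ true → (a ≡ true) × (b ≡ true)
      ∧-split true true _ = refl , refl

      -- Few vertices of large degree are left: isolate everything in S.
      stop : ∀ S → # e * sum (λ v → ⟦ high S v ⟧) ≤ # n → Result S R
      stop S few = record { lab = λ _ → nothing ; outside = λ _ _ → refl ; pivots = λ _ _ () ; small = *-cancel 0<e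
          (≤-trans (≡⇒≤ (sym (sum-*ˡ (# e) _))) (≤-trans (sum-mono row)
          (≤-trans (≡⇒≤ (trans (sum-+ _ _) (cong₂ _+_ (trans (sum-*ʳ (# n) _) (cong (_* # n) (sum-*ˡ (# e) _)))
              (sum-const {n} (# n))))) (≤-trans (+-mono (*-monoʳ (0≤# n) few) ≤-refl)
              (≡⇒≤ (trans (solve 1 (λ n → n :* n :+ n :* n := con (+ 2) :* (n :* n)) refl (# n)) (sym eR))))))) }
        where
        err≤ : ∀ i j → ⟦ S i ⟧ * ⟦ S j ⟧ * err (λ _ → nothing) i j ≤ ⟦ S i ⟧ * ⟦ S j ∧ adj⁺ i j ⟧
        err≤ i j = ≤-trans (≡⇒≤ (*-assoc _ _ _)) (*-monoˡ (0≤⟦⟧ (S i)) (each (S j) (adj G i j) (eqᵇ i j)))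
          where
          each : ∀ s a q → ⟦ s ⟧ * ⟦ a xor (not q ∧ false) ⟧ ≤ ⟦ s ∧ (q ∨ a) ⟧
          each false a q = ≡⇒≤ (zeroˡ _)
          each true false true = ≤-trans (≡⇒≤ (*-identityˡ _)) (0≤# 1)
          each true true true = ≡⇒≤ (*-identityˡ _)
          each true false false = ≡⇒≤ (*-identityˡ _)
          each true true false = ≡⇒≤ (*-identityˡ _)
        deg≤n : ∀ i → deg S i ≤ # n
        deg≤n i = ≤-trans (sum-mono (λ j → ⟦⟧≤1 (S j ∧ adj⁺ i j))) (≡⇒≤ (trans (sum-const {n} (# 1)) (*-identityʳ _)))
        row : ∀ i → # e * sum (λ j → ⟦ S i ⟧ * ⟦ S j ⟧ * err (λ _ → nothing) i j) ≤ # e * ⟦ high S i ⟧ * # n + # n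
        row i = ≤-trans (*-monoˡ (0≤# e) (≤-trans (sum-mono (err≤ i)) (≡⇒≤ (sum-*ˡ ⟦ S i ⟧ _))))
            (cases (S i) (leᵇ (# n) (# e * deg S i)) refl)
          where
          cases : ∀ s h → leᵇ (# n) (# e * deg S i) ≡ h → # e * (⟦ s ⟧ * deg S i) ≤ # e * ⟦ s ∧ h ⟧ * # n + # n
          cases false h q = ≤-trans (≡⇒≤ (solve 2 (λ e d → e :* (con (+ 0) :* d) := con (+ 0)) refl (# e) (deg S i)))
              (+-nonneg (*-nonneg (*-nonneg (0≤# e) ≤-refl) (0≤# n)) (0≤# n))
          cases true true q = ≤-trans (*-monoˡ (0≤# e) (≤-trans (≡⇒≤ (*-identityˡ _)) (deg≤n i)))
              (≤-by (0≤# n) (solve 2 (λ e n → e :* con (+ 1) :* n :+ n := e :* n :+ n) refl (# e) (# n)))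
          cases true false q = ≤-trans (≡⇒≤ (cong (# e *_) (*-identityˡ _)))
              (≤-trans (<⇒≤ (leᵇ-false (# n) (# e * deg S i) q)) (≡⇒≤ (solve 2 (λ e n → n := e :* con (+ 0) :* n :+ n) refl
              (# e) (# n))))

      -- If each of the more than n/e vertices of high degree cost more than c, the total would
      -- reach nc/e, against `cheap`.
      find-pivot : ∀ S → # n < # e * sum (λ v → ⟦ high S v ⟧) → Σ (Fin n) λ v → (high S v ≡ true) × (cost v ≤ c)
      find-pivot S many = decide (Finₚ.any? (λ v → pair? v))
        where
        pair? : ∀ v → Dec ((high S v ≡ true) × (cost v ≤ c))
        pair? v with high S v Boolₚ.≟ true | cost v ≤? c
        ... | yes p | yes q = yes (p , q)
        ... | no p | _ = no (λ h → p (proj₁ h))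
        ... | yes _ | no q = no (λ h → q (proj₂ h))
        decide : Dec (Σ (Fin n) λ v → (high S v ≡ true) × (cost v ≤ c)) → Σ (Fin n) λ v → (high S v ≡ true) × (cost v ≤ c)
        decide (yes r) = r
        decide (no none) = ⊥-elim (≤∧>⇒⊥ (
            # n * c ≤⟨ *-monoʳ 0≤c (<⇒≤ many) ⟩
            # e * sum (λ v → ⟦ high S v ⟧) * c =⟨ trans (*-assoc _ _ _) (cong (# e *_) (sym (sum-*ʳ c _))) ⟩
            # e * sum (λ v → ⟦ high S v ⟧ * c) ≤⟨ *-monoˡ (0≤# e) (sum-mono each) ⟩
            # e * sum cost ∎) cheap)
          where
          0≤cost : ∀ v → # 0 ≤ cost v
          0≤cost v = sum-nonneg (λ i → sum-nonneg (λ j → 0≤⟦⟧ (bad v i j)))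
          each : ∀ v → ⟦ high S v ⟧ * c ≤ cost v
          each v = by (high S v) refl
            where
            by : ∀ b → high S v ≡ b → ⟦ b ⟧ * c ≤ cost v
            by false _ = ≤-trans (≡⇒≤ (zeroˡ c)) (0≤cost v)
            by true q = ≤-trans (≡⇒≤ (*-identityˡ c)) (<⇒≤ (≰⇒> (λ r → none (v , q , r))))

      module Pivoting (S : Fin n → Bool) (v : Fin n) (high-v : high S v ≡ true) where
        S′ : Fin n → Bool
        S′ i = S i ∧ not (adj⁺ v i)

        v∈S : S v ≡ true
        v∈S = proj₁ (∧-split (S v) _ high-v)

        size-drop : # e * size S′ + # n ≤ # e * size S
        size-drop = ≤-trans (+-mono ≤-refl (leᵇ-true (# n) (# e * deg S v) (proj₂ (∧-split (S v) _ high-v))))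
            (≡⇒≤ (trans (sym (distribˡ (# e) _ _)) (cong (# e *_) (trans (sym (sum-+ _ _))
            (sum-cong (λ i → each (S i) (adj⁺ v i)))))))
          where
          each : ∀ s a → ⟦ s ∧ not a ⟧ + ⟦ s ∧ a ⟧ ≡ ⟦ s ⟧
          each false a = +-identityˡ _
          each true true = +-identityˡ _
          each true false = +-identityʳ _

        1≤size : # 1 ≤ size S
        1≤size = ≤-trans (≡⇒≤ (cong ⟦_⟧ (sym v∈S))) (term≤sum (λ i → 0≤⟦⟧ (S i)) v)

        v∉S′ : S′ v ≡ false
        v∉S′ = trans (cong (λ a → S v ∧ not (a ∨ adj G v v)) (eqᵇ-refl v)) (Boolₚ.∧-zeroʳ (S v))

        module Extend {b : ℚ} (r : Result S′ b) where
          module r = Result r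
          lab : Fin n → Maybe (Fin n)
          lab i = if S i ∧ adj⁺ v i then just v else r.lab i

          outside : ∀ i → S i ≡ false → lab i ≡ nothing
          outside i e = trans (cong (λ s → if s ∧ adj⁺ v i then just v else r.lab i) e)
              (r.outside i (cong (_∧ not (adj⁺ v i)) e))

          pivots : ∀ i w → lab i ≡ just w → S w ≡ true
          pivots i w e with S i ∧ adj⁺ v i
          pivots i w refl | true = v∈S
          ... | false = proj₁ (∧-split (S w) _ (r.pivots i w e))

          lab-in : ∀ i → S i ≡ true → adj⁺ v i ≡ true → lab i ≡ just v
          lab-in i s a = cong₂ (λ s a → if s ∧ a then just v else r.lab i) s a

          lab-out : ∀ i → adj⁺ v i ≡ false → lab i ≡ r.lab i
          lab-out i a = cong (λ a → if a then just v else r.lab i) (trans (cong (S i ∧_) a) (Boolₚ.∧-zeroʳ (S i)))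

          not-v : ∀ j → r.lab j ≢ just v
          not-v j e = true≢false (trans (sym (r.pivots j v e)) v∉S′)
            where
            true≢false : true ≢ false
            true≢false ()

          open Labelling using (same; same-sym)

          same-v : ∀ x → x ≢ just v → same lab (just v) x ≡ false
          same-v nothing _ = refl
          same-v (just w) ne = eqᵇ-false v w (λ e → ne (cong just (sym e)))

          0≤bad² : ∀ i j → # 0 ≤ ⟦ bad v i j ⟧ + ⟦ bad v j i ⟧
          0≤bad² i j = +-nonneg (0≤⟦⟧ (bad v i j)) (0≤⟦⟧ (bad v j i))

          xor-rhs : ∀ i j {x} → same lab (lab i) (lab j) ≡ x → err lab i j ≡ ⟦ adj G i j xor (not (eqᵇ i j) ∧ x) ⟧
          xor-rhs i j e = cong (λ x → ⟦ adj G i j xor (not (eqᵇ i j) ∧ x) ⟧) e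

          -- With both vertices outside the new cluster the error is inherited. Otherwise an error
          -- is a bad pair for v, charged in the order that puts a vertex of the cluster first.
          inside : ∀ i j → S i ≡ true → S j ≡ true → ∀ a b → adj⁺ v i ≡ a → adj⁺ v j ≡ b → err lab i j ≤ ⟦ not a ⟧ * ⟦ not b ⟧ *
              err r.lab i j + (⟦ bad v i j ⟧ + ⟦ bad v j i ⟧)
          inside i j si sj false false ei ej = ≤-by (0≤bad² i j) (+-congˡ
              (trans (solve 1 (λ e → con (+ 1) :* con (+ 1) :* e := e) refl (err r.lab i j))
              (cong (λ x → ⟦ adj G i j xor (not (eqᵇ i j) ∧ x) ⟧) (sym (cong₂ (same lab) (lab-out i ei) (lab-out j ej))))))
          inside i j si sj true true ei ej = ≤-trans (≡⇒≤ (xor-rhs i j (trans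
              (cong₂ (same lab) (lab-in i si ei) (lab-in j sj ej)) (eqᵇ-refl v))))
              (≤-trans (≤-trans (both (adj G i j) (eqᵇ i j) (λ q → trans (cong (adj G i) (sym (eqᵇ-true i j q))) (irrefl G i)))
              (≡⇒≤ (cong₂ (λ a b → ⟦ a ∧ (b xor adj⁺ i j) ⟧) (sym ei) (sym ej))))
              (≤-by (0≤⟦⟧ (bad v j i)) (trans (solve 3 (λ e x y → con (+ 0) :* con (+ 0) :* e :+ (x :+ y) := x :+ y) refl
              (err r.lab i j) ⟦ bad v i j ⟧ ⟦ bad v j i ⟧) refl)))
            where
            both : ∀ a q → (q ≡ true → a ≡ false) → ⟦ a xor (not q ∧ true) ⟧ ≤ ⟦ true ∧ (true xor (q ∨ a)) ⟧
            both a true h = ≡⇒≤ (trans (cong (λ a → ⟦ a xor false ⟧) (h refl)) refl)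
            both true false h = ≤-refl
            both false false h = ≤-refl
          inside i j si sj true false ei ej = ≤-trans (≡⇒≤ (xor-rhs i j
              (trans (cong₂ (same lab) (lab-in i si ei) (lab-out j ej)) (same-v (r.lab j) (not-v j)))))
              (≤-trans (≤-trans (one (adj G i j) (eqᵇ i j)) (≡⇒≤ (cong₂ (λ a b → ⟦ a ∧ (b xor adj⁺ i j) ⟧) (sym ei) (sym ej))))
              (≤-by (0≤⟦⟧ (bad v j i)) (solve 3 (λ e x y → con (+ 0) :* con (+ 1) :* e :+ (x :+ y) := x :+ y) refl
              (err r.lab i j) ⟦ bad v i j ⟧ ⟦ bad v j i ⟧)))
            where
            one : ∀ a q → ⟦ a xor (not q ∧ false) ⟧ ≤ ⟦ true ∧ (false xor (q ∨ a)) ⟧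
            one a true = ⟦⟧≤1 (a xor false)
            one true false = ≤-refl
            one false false = ≤-refl
          inside i j si sj false true ei ej = ≤-trans (≡⇒≤ (xor-rhs i j
              (trans (cong₂ (same lab) (lab-out i ei) (lab-in j sj ej))
              (trans (same-sym lab (r.lab i) (just v)) (same-v (r.lab i) (not-v i))))))
              (≤-trans (≤-trans (one (adj G i j) (eqᵇ i j)) (≡⇒≤ (trans
              (cong (λ a → ⟦ true ∧ (false xor a) ⟧) (cong₂ _∨_ (eqᵇ-sym i j) (adj-sym G i j)))
              (cong₂ (λ a b → ⟦ a ∧ (b xor adj⁺ j i) ⟧) (sym ej) (sym ei)))))
              (≤-by (0≤⟦⟧ (bad v i j)) (solve 3 (λ e x y → con (+ 1) :* con (+ 0) :* e :+ (x :+ y) := y :+ x) refl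
              (err r.lab i j) ⟦ bad v i j ⟧ ⟦ bad v j i ⟧)))
            where
            one : ∀ a q → ⟦ a xor (not q ∧ false) ⟧ ≤ ⟦ true ∧ (false xor (q ∨ a)) ⟧
            one a true = ⟦⟧≤1 (a xor false)
            one true false = ≤-refl
            one false false = ≤-refl

          entry : ∀ i j → ⟦ S i ⟧ * ⟦ S j ⟧ * err lab i j ≤ ⟦ S′ i ⟧ * ⟦ S′ j ⟧ * err r.lab i j +
              (⟦ bad v i j ⟧ + ⟦ bad v j i ⟧)
          entry i j = by (S i) (S j) refl refl
            where
            by : ∀ s t → S i ≡ s → S j ≡ t → ⟦ s ⟧ * ⟦ t ⟧ * err lab i j ≤ ⟦ s ∧ not (adj⁺ v i) ⟧ * ⟦ t ∧ not (adj⁺ v j) ⟧ * err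
                r.lab i j + (⟦ bad v i j ⟧ + ⟦ bad v j i ⟧)
            by true true es et = ≤-trans (≡⇒≤ (solve 1 (λ e → con (+ 1) :* con (+ 1) :* e := e) refl (err lab i j)))
                (inside i j es et (adj⁺ v i) (adj⁺ v j) refl refl)
            by false t es et = ≤-trans (≡⇒≤ (solve 2 (λ t e → con (+ 0) :* t :* e := con (+ 0)) refl ⟦ t ⟧ (err lab i j)))
                (≤-trans (0≤bad² i j) (≡⇒≤ (solve 3 (λ u e x → x := con (+ 0) :* u :* e :+ x) refl ⟦ t ∧ not (adj⁺ v j) ⟧
                (err r.lab i j) (⟦ bad v i j ⟧ + ⟦ bad v j i ⟧))))
            by true false es et = ≤-trans (≡⇒≤ (solve 1 (λ e → con (+ 1) :* con (+ 0) :* e := con (+ 0)) refl (err lab i j)))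
                (≤-trans (0≤bad² i j) (≡⇒≤ (solve 3 (λ u e x → x := u :* con (+ 0) :* e :+ x) refl ⟦ not (adj⁺ v i) ⟧
                (err r.lab i j) (⟦ bad v i j ⟧ + ⟦ bad v j i ⟧))))

          result : cost v ≤ c → Result S (b + # 2 * c)
          result cheap-v = record { lab = lab ; outside = outside ; pivots = pivots ; small =
            ≤-trans (sum-mono (λ i → sum-mono (entry i))) (≤-trans (≡⇒≤
                (trans (sum-cong (λ i → trans (sum-+ _ _) (+-congʳ (sum-+ _ _))))
                (trans (sum-+ _ _) (+-congʳ (trans (sum-+ _ _) (+-congʳ (sum-swap (λ i j → ⟦ bad v j i ⟧))))))))
              (+-mono r.small (≤-trans (+-mono cheap-v cheap-v) (≡⇒≤ (solve 1 (λ c → c :+ c := con (+ 2) :* c) refl c))))) }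

      weaken : ∀ {S b b′} → b ≤ b′ → Result S b → Result S b′
      weaken h r = record { Result r hiding (small) ; small = ≤-trans (Result.small r) h }

      -- `fuel` counts portions of n/e vertices that may remain; at 0 the set is empty and cannot
      -- contain a pivot.
      run : ∀ fuel S → # e * size S ≤ # fuel * # n → Result S (R + # fuel * (# 2 * c))
      run fuel S h with (# e * sum (λ v → ⟦ high S v ⟧)) ≤? (# n)
      ... | yes few = weaken (≤-by (*-nonneg (0≤# fuel) (*-nonneg (0≤# 2) 0≤c)) refl) (stop S few)
      run zero S h | no nfew = ⊥-elim (≤∧>⇒⊥ (≤-trans (*-monoˡ (0≤# e) (Pivoting.1≤size S (proj₁ pv) (proj₁ (proj₂ pv))))
          (≤-trans h (≡⇒≤ (zeroˡ _)))) (*-pos 0<e (0<#suc 0)))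
        where
        pv : Σ (Fin n) λ v → (high S v ≡ true) × (cost v ≤ c)
        pv = find-pivot S (≰⇒> nfew)
      run (suc fuel) S h | no nfew = weaken (≡⇒≤ (trans (solve 3 (λ r f c → r :+ f :* c :+ c := r :+ (con (+ 1) :+ f) :* c) refl
          R (# fuel) (# 2 * c)) (+-congʳ (cong (_* (# 2 * c)) (sym (#-+ 1 fuel))))))
          (Pv.Extend.result (run fuel Pv.S′ smaller) (proj₂ (proj₂ pv)))
        where
        pv : Σ (Fin n) λ v → (high S v ≡ true) × (cost v ≤ c)
        pv = find-pivot S (≰⇒> nfew)
        module Pv = Pivoting S (proj₁ pv) (proj₁ (proj₂ pv))
        smaller : # e * size Pv.S′ ≤ # fuel * # n
        smaller = ≤-by (≤⇒0≤- (≤-trans Pv.size-drop h)) (sym (trans (cong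
            (λ q → # e * size Pv.S′ + (q * # n - (# e * size Pv.S′ + # n))) (#-+ 1 fuel))
            (solve 3 (λ s f n → s :+ ((con (+ 1) :+ f) :* n :- (s :+ n)) := f :* n) refl (# e * size Pv.S′) (# fuel) (# n))))

      all-result : Result (λ _ → true) (R + # e * (# 2 * c))
      all-result = run e (λ _ → true) (≡⇒≤ (cong (# e *_) (trans (sum-const {n} (# 1)) (*-identityʳ _))))

      lab : Fin n → Maybe (Fin n)
      lab = Result.lab all-result

      open Labelling lab using (H; H-cliques)

      edit-bound : # 2 * # (editDist G H Perm.id) ≤ R + # e * (# 2 * c)
      edit-bound = ≤-trans (≡⇒≤ (pairCount-double (λ i j → adj G i j xor adj H i j)
          (λ i j → cong₂ _xor_ (adj-sym G i j) (adj-sym H i j)) (λ i → cong₂ _xor_ (irrefl G i) (irrefl H i))))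
        (≤-trans (≡⇒≤ (sum-cong (λ i → sum-cong (λ j → solve 1 (λ x → x := con (+ 1) :* con (+ 1) :* x) refl (err lab i j)))))
            (Result.small all-result))

  opaque
    unfolding _+_

    to-close : ∀ {n} (ε : ℚ) (G H : Graph n) → # (editDist G H Perm.id) ≤ ε * # (n ℕ.^ 2) → Close ε G H
    to-close ε G H h = Perm.id , h

  -- Choice of parameters

  opaque
    unfolding _+_

    positive⇒0< : ∀ {ε} → Rat.Positive ε → # 0 < ε
    positive⇒0< {ε} p = Ratₚ.positive⁻¹ ε {{p}}

  module Assembly {n : ℕ} (G : Graph n) (1≤n : 1 ℕ.≤ n) (e d x β m p Λ K κ : ℕ)
    (1≤e : 1 ℕ.≤ e) (d≡ : # d ≡ # 3 * (# e * # e * # e)) (2≤x : 2 ℕ.≤ x) (x≡ : # x ≡ # 66816 * # d)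
    (1≤β : 1 ℕ.≤ β) (β-large : 9 ℕ.* d ℕ.* (1 ℕ.+ x) ℕ.≤ β) (1≤m : 1 ℕ.≤ m)
        (m-large : 8 ℕ.* (x ℕ.^ 3 ℕ.* (4 ℕ.* β ℕ.+ 1)) ℕ.≤ m)
    (1≤Λ : 1 ℕ.≤ Λ) (Λ-large : # (2 ℕ.* n ℕ.* cc (suc p)) ≤ P p (# Λ))
    (κ≡ : # κ ≡ # 4 * CutForm.κ₀ G * (# Λ * # Λ) + # n)
    (1≤K : 1 ℕ.≤ K) (K⁸≤n : K ℕ.^ 8 ℕ.≤ n) (n-large : 9 ℕ.* d ℕ.* (18 ℕ.* K ℕ.* suc (4 ℕ.* β ℕ.* m ℕ.+ 2) ℕ.^ (x ℕ.^ 3)) ℕ.≤ n)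
    (K-large : # 9 * (# e * # e * # e) * (# κ + # n) ≤ # K * # n) where

    open CutForm G

    0<n : # 0 < # n
    0<n = #-mono-< 1≤n
    0<K : # 0 < # K
    0<K = #-mono-< 1≤K

    0≤A : ∀ i j → # 0 ≤ A i j
    0≤A i j = 0≤⟦⟧ (adj G i j)
    A≤1 : ∀ i j → A i j ≤ # 1
    A≤1 i j = ⟦⟧≤1 (adj G i j)

    rounded : ∀ fs σ → # 0 < σ → (∀ i → cov fs i i ≤ σ) → - (σ * # κ) ≤ lform A fs
    rounded fs σ 0<σ cv = ≤-trans (≡⇒≤ (cong (λ k → - (σ * k)) κ≡)) (Rounding.rounding A 0≤A A≤1 κ₀ (0≤# (2 ℕ.* twiceSp G))
        cut-bound p Λ 1≤Λ Λ-large fs σ 0<σ cv)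

    module WithMultipliers (D : Vect n) (0≤D : ∀ i → # 0 ≤ D i) (D≤κ : sum D ≤ # κ)
        (M-psd : PSD (λ i j → A i j + Id i j * (D i + # 1))) where
      M : Mat n
      M i j = A i j + Id i j * (D i + # 1)

      keep : Fin n → Bool
      keep i = leᵇ (D i + # 1) (# K)
      g : Vect n
      g i = ⟦ keep i ⟧

      -- Rows and columns with diagonal above K are erased by a congruence, written in the shape of
      -- `form-scale`. By Markov's inequality at most (κ + n)/K vertices are lost.
      M′ : Mat n
      M′ i j = M i j * (# 1 * (g i * g j))

      M-off : ∀ i j → i ≢ j → M i j ≡ A i j
      M-off i j ne = trans (+-congʳ (trans (cong (_* (D i + # 1)) (Id-off i j ne)) (zeroˡ _))) (+-identityʳ _)

      M-symm : Symm M
      M-symm i j with i F.≟ j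
      ... | yes refl = refl
      ... | no ne = trans (M-off i j ne) (trans (A-symm i j) (sym (M-off j i (λ q → ne (sym q)))))

      M-diag : ∀ i → M i i ≡ D i + # 1
      M-diag i = trans (cong₂ (λ a b → a + b * (D i + # 1)) (A-diag i) (Id-diag i))
          (solve 1 (λ d → con (+ 0) :+ con (+ 1) :* d := d) refl (D i + # 1))

      ⟦⟧-idem : ∀ b → ⟦ b ⟧ * ⟦ b ⟧ ≡ ⟦ b ⟧
      ⟦⟧-idem true = *-identityˡ _
      ⟦⟧-idem false = zeroˡ _

      bounded : Bounded01 K M′
      bounded = record
        { symm = λ i j → cong₂ (λ a b → a * (# 1 * b)) (M-symm i j) (*-comm (g i) (g j))
        ; psd = λ x → subst (# 0 ≤_) (sym (trans (form-scale M (# 1) g x) (*-identityˡ _))) (M-psd (λ i → x i * g i))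
        ; off = λ i j ne → trans (cong (λ a → a * (# 1 * (g i * g j)) * (a * (# 1 * (g i * g j)))) (M-off i j ne))
            (trans (solve 3 (λ a g h → a :* (con (+ 1) :* (g :* h)) :* (a :* (con (+ 1) :* (g :* h))) := a :* a :*
            (con (+ 1) :* (g :* g :* (h :* h)))) refl (A i j) (g i) (g j))
            (trans (cong₂ (λ a b → a * (# 1 * b)) (⟦⟧-idem (adj G i j)) (cong₂ _*_ (⟦⟧-idem (keep i)) (⟦⟧-idem (keep j))))
                (cong (_* (# 1 * (g i * g j))) (sym (M-off i j ne)))))
        ; diag≤ = λ i → ≤-trans (≡⇒≤ (cong₂ (λ a b → a * (# 1 * b)) (M-diag i) (⟦⟧-idem (keep i)))) (by i (keep i) refl) }
        where
        by : ∀ i b → keep i ≡ b → (D i + # 1) * (# 1 * ⟦ b ⟧) ≤ # K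
        by i true q = ≤-trans (≡⇒≤ (solve 1 (λ d → d :* (con (+ 1) :* con (+ 1)) := d) refl (D i + # 1))) (leᵇ-true _ _ q)
        by i false q = ≤-trans (≡⇒≤ (solve 1 (λ d → d :* (con (+ 1) :* con (+ 0)) := con (+ 0)) refl (D i + # 1))) (0≤# K)

      open Clustering G

      T : Fin n → Fin n → Fin n → ℚ
      T v i j = ⟦ bad v i j ⟧ * (g v * (g i * g j))

      bad-distinct : ∀ v i j → bad v i j ≡ true → (v ≢ i) × (v ≢ j) × (i ≢ j)
      bad-distinct v i j h = p₁ , p₂ , p₃
        where
        contra : ∀ {b} → b ≡ true → b ≡ false → ⊥
        contra refl ()
        self : ∀ a → adj⁺ a a ≡ true
        self a = cong (_∨ adj G a a) (eqᵇ-refl a)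
        xor-same : ∀ b → b xor b ≡ false
        xor-same true = refl
        xor-same false = refl
        first : adj⁺ v i ≡ true
        first = fst (adj⁺ v i) _ h
          where
          fst : ∀ a b → a ∧ b ≡ true → a ≡ true
          fst true b _ = refl
        p₁ : v ≢ i
        p₁ refl = contra h (trans (cong (adj⁺ v v ∧_) (xor-same (adj⁺ v j))) (Boolₚ.∧-zeroʳ (adj⁺ v v)))
        p₂ : v ≢ j
        p₂ refl = contra h (trans (cong₂ (λ a b → adj⁺ v i ∧ (a xor b)) (self v)
            (trans (cong₂ _∨_ (eqᵇ-sym i v) (adj-sym G i v)) first)) (Boolₚ.∧-zeroʳ (adj⁺ v i)))
        p₃ : i ≢ j
        p₃ refl = contra h (trans (cong₂ (λ a b → adj⁺ v i ∧ (a xor b)) first (self i)) (Boolₚ.∧-zeroʳ (adj⁺ v i)))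

      M′-entry : ∀ i j → i ≢ j → keep i ≡ true → keep j ≡ true → M′ i j ≡ ⟦ adj⁺ i j ⟧
      M′-entry i j ne ki kj = trans (cong₂ (λ a b → a * (# 1 * b)) (M-off i j ne) (cong₂ (λ a b → ⟦ a ⟧ * ⟦ b ⟧) ki kj))
          (trans (solve 1 (λ a → a :* (con (+ 1) :* (con (+ 1) :* con (+ 1))) := a) refl (A i j))
          (cong (λ b → ⟦ b ∨ adj G i j ⟧) (sym (eqᵇ-false i j ne))))

      T-cherry : ∀ v i j → CherryLike M′ v i j (T v i j)
      T-cherry v i j = by (bad v i j) (keep v) (keep i) (keep j) refl refl refl refl
        where
        by : ∀ b kv ki kj → bad v i j ≡ b → keep v ≡ kv → keep i ≡ ki → keep j ≡ kj → CherryLike M′ v i j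
            (⟦ b ⟧ * (⟦ kv ⟧ * (⟦ ki ⟧ * ⟦ kj ⟧)))
        by false kv ki kj _ _ _ _ = inj₁ (≡⇒≤ (zeroˡ _))
        by true false ki kj _ _ _ _ = inj₁ (≡⇒≤ (solve 1 (λ a → con (+ 1) :* (con (+ 0) :* a) := con (+ 0)) refl
            (⟦ ki ⟧ * ⟦ kj ⟧)))
        by true true false kj _ _ _ _ = inj₁ (≡⇒≤ (solve 1 (λ a → con (+ 1) :* (con (+ 1) :* (con (+ 0) :* a)) := con (+ 0))
            refl ⟦ kj ⟧))
        by true true true false _ _ _ _ = inj₁ (≡⇒≤ (solve 0 (con (+ 1) :* (con (+ 1) :* (con (+ 1) :* con (+ 0))) := con (+ 0))
            refl))
        by true true true true h kv ki kj = inj₂ (≡⇒≤ (solve 0 (con (+ 1) :* (con (+ 1) :* (con (+ 1) :* con (+ 1))) := con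
            (+ 1)) refl) , entries (adj⁺ v i) (adj⁺ v j) (adj⁺ i j) h
            (M′-entry v i (proj₁ ds) kv ki) (M′-entry v j (proj₁ (proj₂ ds)) kv kj) (M′-entry i j (proj₂ (proj₂ ds)) ki kj))
          where
          ds : (v ≢ i) × (v ≢ j) × (i ≢ j)
          ds = bad-distinct v i j h
          entries : ∀ a b c → a ∧ (b xor c) ≡ true → M′ v i ≡ ⟦ a ⟧ → M′ v j ≡ ⟦ b ⟧ → M′ i j ≡ ⟦ c ⟧ → (M′ v i ≡ # 1) ×
              (((M′ v j ≡ # 1) × (M′ i j ≡ # 0)) ⊎ ((M′ v j ≡ # 0) × (M′ i j ≡ # 1)))
          entries true true false _ x y z = x , inj₁ (y , z)
          entries true false true _ x y z = x , inj₂ (y , z)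

      k⁻ : Fin n → ℚ
      k⁻ i = # 1 - g i

      -- A bad triple that meets an erased vertex is charged to that vertex.
      bad≤ : ∀ v i j → ⟦ bad v i j ⟧ ≤ T v i j + (k⁻ v + (k⁻ i + k⁻ j))
      bad≤ v i j = by (keep v) (keep i) (keep j) refl refl refl
        where
        t : ℚ
        t = ⟦ bad v i j ⟧
        t≤1 : # 0 ≤ # 1 - t
        t≤1 = ≤⇒0≤- (⟦⟧≤1 (bad v i j))
        by : ∀ a b c → keep v ≡ a → keep i ≡ b → keep j ≡ c → t ≤ t * (⟦ a ⟧ * (⟦ b ⟧ * ⟦ c ⟧)) +
            ((# 1 - ⟦ a ⟧) + ((# 1 - ⟦ b ⟧) + (# 1 - ⟦ c ⟧)))
        by true true true _ _ _ = ≡⇒≤ (solve 1 (λ t → t := t :* (con (+ 1) :* (con (+ 1) :* con (+ 1))) :+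
            ((con (+ 1) :- con (+ 1)) :+ ((con (+ 1) :- con (+ 1)) :+ (con (+ 1) :- con (+ 1))))) refl t)
        by false b c _ _ _ = ≤-by (+-nonneg t≤1 (+-nonneg (≤⇒0≤- (⟦⟧≤1 b)) (≤⇒0≤- (⟦⟧≤1 c))))
            (solve 3 (λ t b c → t :* (con (+ 0) :* (b :* c)) :+ ((con (+ 1) :- con (+ 0)) :+
            ((con (+ 1) :- b) :+ (con (+ 1) :- c))) := t :+ ((con (+ 1) :- t) :+ ((con (+ 1) :- b) :+ (con (+ 1) :- c)))) refl t
            ⟦ b ⟧ ⟦ c ⟧)
        by true false c _ _ _ = ≤-by (+-nonneg t≤1 (≤⇒0≤- (⟦⟧≤1 c))) (solve 2
            (λ t c → t :* (con (+ 1) :* (con (+ 0) :* c)) :+ ((con (+ 1) :- con (+ 1)) :+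
            ((con (+ 1) :- con (+ 0)) :+ (con (+ 1) :- c))) := t :+ ((con (+ 1) :- t) :+ (con (+ 1) :- c))) refl t ⟦ c ⟧)
        by true true false _ _ _ = ≤-by t≤1 (solve 1 (λ t → t :* (con (+ 1) :* (con (+ 1) :* con (+ 0))) :+
            ((con (+ 1) :- con (+ 1)) :+ ((con (+ 1) :- con (+ 1)) :+ (con (+ 1) :- con (+ 0)))) := t :+ (con (+ 1) :- t)) refl
            t)

      ΣT killed : ℚ
      ΣT = sum (λ v → sum (λ i → sum (T v i)))
      killed = sum k⁻

      Σbad≤ : sum cost ≤ ΣT + # 3 * (# n * # n * killed)
      Σbad≤ = ≤-trans (sum-mono (λ v → sum-mono (λ i → sum-mono (bad≤ v i))))
          (≡⇒≤ (trans (sum-cong (λ v → trans (sum-cong (λ i → trans (sum-+ (T v i) _)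
          (+-congʳ (trans (sum-+ _ _) (cong₂ _+_ (sum-const {n} (k⁻ v))
          (trans (sum-+ _ k⁻) (+-congˡ (sum-const {n} (k⁻ i))))))))) (trans (sum-+ _ _)
          (+-congʳ (trans (sum-+ _ _) (cong₂ _+_ (sum-const {n} _) (trans (sum-+ _ _)
          (cong₂ _+_ (sum-*ˡ (# n) k⁻) (sum-const {n} killed)))))))))
        (trans (sum-+ _ _) (+-congʳ (trans (sum-+ _ _) (trans (cong₂ _+_
            (trans (sum-*ˡ (# n) _) (cong (# n *_) (sum-*ˡ (# n) k⁻))) (sum-const {n} _))
            (solve 2 (λ n k → n :* (n :* k) :+ n :* (n :* k :+ n :* k) := con (+ 3) :* (n :* n :* k)) refl (# n) killed)))))))

      killed≤ : # K * killed ≤ # κ + # n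
      killed≤ = ≤-trans (≡⇒≤ (sym (sum-*ˡ (# K) k⁻))) (≤-trans (sum-mono (λ i → by i (keep i) refl))
          (≤-trans (≡⇒≤ (trans (sum-+ D _) (+-congʳ (trans (sum-const {n} (# 1)) (*-identityʳ _))))) (+-mono D≤κ ≤-refl)))
        where
        by : ∀ i b → keep i ≡ b → # K * (# 1 - ⟦ b ⟧) ≤ D i + # 1
        by i true _ = ≤-trans (≡⇒≤ (solve 1 (λ k → k :* (con (+ 1) :- con (+ 1)) := con (+ 0)) refl (# K)))
            (+-nonneg (0≤D i) (0≤# 1))
        by i false q = ≤-trans (≡⇒≤ (solve 1 (λ k → k :* (con (+ 1) :- con (+ 0)) := k) refl (# K))) (<⇒≤ (leᵇ-false _ _ q))

      few : # d * ΣT ≤ # n * # n * # n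
      few = FewCherries.few-cherries d x β m 2≤x x≡ 1≤β β-large 1≤m m-large bounded 1≤K K⁸≤n n-large T T-cherry

      E³ N³ : ℚ
      E³ = # e * # e * # e
      N³ = # n * # n * # n

      0<N³ : # 0 < N³
      0<N³ = *-pos (*-pos 0<n 0<n) 0<n

      killed-small : # 9 * E³ * killed ≤ # n
      killed-small = *-cancel 0<K (# K * (# 9 * E³ * killed) =⟨ solve 3 (λ k c x → k :* (c :* x) := c :* (k :* x)) refl (# K)
          (# 9 * E³) killed ⟩ # 9 * E³ * (# K * killed) ≤⟨ *-monoˡ (*-nonneg (0≤# 9)
          (*-nonneg (*-nonneg (0≤# e) (0≤# e)) (0≤# e))) killed≤ ⟩ # 9 * E³ * (# κ + # n) ≤⟨ K-large ⟩ # K * # n ∎)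

      -- Cherries account for n³ because d = 3e³, and erased vertices for another n³. The factor 3
      -- on the left leaves the gap that makes `cheap` strict.
      bad-small : # 3 * (E³ * sum cost) ≤ # 2 * N³
      bad-small = # 3 * (E³ * sum cost) ≤⟨ *-monoˡ (0≤# 3) (*-monoˡ (*-nonneg (*-nonneg (0≤# e) (0≤# e)) (0≤# e)) Σbad≤) ⟩
        # 3 * (E³ * (ΣT + # 3 * (# n * # n * killed))) =⟨ solve 4 (λ c t n k → con (+ 3) :*
            (c :* (t :+ con (+ 3) :* (n :* n :* k))) := con (+ 3) :* c :* t :+ n :* n :* (con (+ 9) :* c :* k)) refl E³ ΣT (# n)
            killed ⟩
        # 3 * E³ * ΣT + # n * # n * (# 9 * E³ * killed) ≤⟨ +-mono (≤-trans (≡⇒≤ (cong (_* ΣT) (sym d≡))) few)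
            (*-monoˡ (*-nonneg (0≤# n) (0≤# n)) killed-small) ⟩
        N³ + # n * # n * # n =⟨ solve 1 (λ t → t :+ t := con (+ 2) :* t) refl N³ ⟩ # 2 * N³ ∎

      0<e : # 0 < # e
      0<e = #-mono-< 1≤e
      ie c R : ℚ
      ie = inv (# e)
      c = ie * ie * (# n * # n)
      R = # 2 * (ie * (# n * # n))
      e·ie : # e * ie ≡ # 1
      e·ie = inv-posʳ 0<e
      0≤c : # 0 ≤ c
      0≤c = *-nonneg (sq≥0 ie) (*-nonneg (0≤# n) (0≤# n))
      eR : # e * R ≡ # 2 * (# n * # n)
      eR = trans (solve 3 (λ e i n → e :* (con (+ 2) :* (i :* n)) := e :* i :* (con (+ 2) :* n)) refl (# e) ie (# n * # n))
          (trans (cong (_* (# 2 * (# n * # n))) e·ie) (*-identityˡ _))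
      cheap : # e * sum cost < # n * c
      cheap = ≰⇒> λ h → ≤∧>⇒⊥ (≤-trans (≤-trans (*-monoˡ (0≤# 3) (≤-trans (≡⇒≤ e²nc)
          (≤-trans (*-monoˡ (sq≥0 (# e)) h) (≡⇒≤ (sym (*-assoc (# e * # e) (# e) (sum cost))))))) bad-small) ≤-refl)
          (subst (# 2 * N³ <_) (solve 1 (λ t → t :+ con (+ 2) :* t := con (+ 3) :* t) refl N³)
          (subst (_< N³ + # 2 * N³) (+-identityˡ _) (+-mono-<-≤ 0<N³ ≤-refl)))
        where
        e²nc : N³ ≡ # e * # e * (# n * c)
        e²nc = sym (trans (solve 3 (λ e i n → e :* e :* (n :* (i :* i :* (n :* n))) := e :* i :* (e :* i) :* (n :* n :* n)) refl
            (# e) ie (# n)) (trans (cong (λ u → u * u * N³) e·ie) (solve 1 (λ t → con (+ 1) :* con (+ 1) :* t := t) refl N³)))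

      open Run e 1≤e c R 0≤c eR cheap using (lab; edit-bound)
      open Labelling lab using (H; H-cliques)

      edit-small : # e * # (editDist G H Perm.id) ≤ # 2 * (# n * # n)
      edit-small = *-cancel (0<#suc 1) (≤-trans (≡⇒≤ (solve 2 (λ e t → con (+ 2) :* (e :* t) := e :* (con (+ 2) :* t)) refl
          (# e) _)) (≤-trans (*-monoˡ (0≤# e) edit-bound) (≡⇒≤ (trans (distribˡ (# e) _ _)
          (trans (cong₂ _+_ eR ec) (solve 1 (λ n → con (+ 2) :* n :+ con (+ 2) :* n := con (+ 2) :* (con (+ 2) :* n)) refl
          (# n * # n)))))))
        where
        ec : # e * (# e * (# 2 * c)) ≡ # 2 * (# n * # n)
        ec = trans (solve 3 (λ e i n → e :* (e :* (con (+ 2) :* (i :* i :* n))) := e :* i :* (e :* i) :* (con (+ 2) :* n)) refl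
            (# e) ie (# n * # n)) (trans (cong (λ u → u * u * (# 2 * (# n * # n))) e·ie)
            (solve 1 (λ t → con (+ 1) :* con (+ 1) :* t := t) refl (# 2 * (# n * # n))))

      not-far : ∀ ε → # 2 ≤ ε * # e → FarFromCliqueUnions ε G → ⊥
      not-far ε h far = far H H-cliques (to-close ε G H (*-cancel 0<e (≤-trans edit-small
          (≤-trans (*-monoʳ (*-nonneg (0≤# n) (0≤# n)) h) (≡⇒≤ (trans (solve 3 (λ x e n → x :* e :* n := e :* (x :* n)) refl ε
          (# e) (# n * # n)) (cong (λ u → # e * (ε * u)) (trans (sym (#-* n n))
          (cong (λ k → # (n ℕ.* k)) (sym (ℕₚ.*-identityʳ n)))))))))))

    -- The multipliers D come from the dual of a linear program with one constraint per grid vector.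
    module WithGrid (B b₀ : ℕ) (B-large : 8 ℕ.* (n ℕ.* n ℕ.+ κ) ℕ.≤ B) (1≤B : 1 ℕ.≤ B) (b₀≡ : b₀ ≡ B ℕ.+ B) where
      module Du = Duality A κ rounded B b₀
      module Gr = GridPSD A A-symm 0≤A A≤1 κ B b₀ B-large 1≤B b₀≡ Du.D Du.0≤D Du.D≤κ Du.grid-D

      grid-not-far : ∀ ε → # 2 ≤ ε * # e → FarFromCliqueUnions ε G → ⊥
      grid-not-far = WithMultipliers.not-far Du.D Du.0≤D Du.D≤κ Gr.M-psd

    not-far : ∀ ε → # 2 ≤ ε * # e → FarFromCliqueUnions ε G → ⊥
    not-far = WithGrid.grid-not-far B (B ℕ.+ B) (ℕₚ.m≤m+n _ 1) (ℕₚ.m≤n+m 1 _) refl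
      where
      B : ℕ
      B = 8 ℕ.* (n ℕ.* n ℕ.+ κ) ℕ.+ 1

  -- Integer roots and the exponent

  root : ∀ k n → Σ ℕ λ q → (q ℕ.^ suc k ℕ.≤ n) × (n ℕ.< suc q ℕ.^ suc k)
  root k zero = 0 , ℕ.z≤n , ℕₚ.≤-reflexive (sym (ℕₚ.^-zeroˡ (suc k)))
  root k (suc n) = next (root k n)
    where
    next : (Σ ℕ λ q → (q ℕ.^ suc k ℕ.≤ n) × (n ℕ.< suc q ℕ.^ suc k)) → Σ ℕ λ q → (q ℕ.^ suc k ℕ.≤ suc n) ×
        (suc n ℕ.< suc q ℕ.^ suc k)
    next (q , lo , hi) = decide (suc n ℕ.<? suc q ℕ.^ suc k)
      where
      decide : Dec (suc n ℕ.< suc q ℕ.^ suc k) → Σ ℕ λ q → (q ℕ.^ suc k ℕ.≤ suc n) × (suc n ℕ.< suc q ℕ.^ suc k)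
      decide (yes h) = q , ℕₚ.m≤n⇒m≤1+n lo , h
      decide (no h) = suc q , ℕₚ.≮⇒≥ h , ℕₚ.≤-<-trans hi (ℕₚ.^-monoˡ-< (suc k) (ℕₚ.n<1+n (suc q)))

  ^-distribʳ-* : ∀ k a b → (a ℕ.* b) ℕ.^ k ≡ a ℕ.^ k ℕ.* b ℕ.^ k
  ^-distribʳ-* zero a b = refl
  ^-distribʳ-* (suc k) a b = trans (cong (a ℕ.* b ℕ.*_) (^-distribʳ-* k a b))
      (NS.solve 4 (λ a b c d → a NS.:* b NS.:* (c NS.:* d) NS.:= a NS.:* c NS.:* (b NS.:* d)) refl a b (a ℕ.^ k) (b ℕ.^ k))

  -- If t > 2nq, then t^k ≥ 2^k n^k q^k ≥ 2^k n^(k+1).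
  surplus-bound : ∀ k t n q → t ℕ.^ k ℕ.< 2 ℕ.^ k ℕ.* n ℕ.^ suc k → n ℕ.< q ℕ.^ k → t ℕ.≤ 2 ℕ.* n ℕ.* q
  surplus-bound k t n q small n<q with t ℕ.≤? 2 ℕ.* n ℕ.* q
  ... | yes h = h
  ... | no h = ⊥-elim (ℕₚ.<⇒≱ small (ℕₚ.≤-trans (ℕₚ.≤-trans (ℕₚ.≤-reflexive (solve-eq (2 ℕ.^ k) n (n ℕ.^ k)))
      (ℕₚ.≤-trans (ℕₚ.*-monoʳ-≤ (2 ℕ.^ k ℕ.* n ℕ.^ k) (ℕₚ.<⇒≤ n<q)) (ℕₚ.≤-reflexive
      (sym (trans (^-distribʳ-* k (2 ℕ.* n) q) (cong (ℕ._* q ℕ.^ k) (^-distribʳ-* k 2 n)))))))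
      (ℕₚ.^-monoˡ-≤ k (ℕₚ.<⇒≤ (ℕₚ.≰⇒> h)))))
    where
    solve-eq : ∀ a n b → a ℕ.* (n ℕ.* b) ≡ a ℕ.* b ℕ.* n
    solve-eq = NS.solve 3 (λ a n b → a NS.:* (n NS.:* b) NS.:= a NS.:* b NS.:* n) refl

  -- The bracket is 8tY + 2n ≤ 18nQY, and 9 · 18 = 162; the constant 162E is absorbed by one factor
  -- Q of K = Q · QY.
  K-large-ℕ : ∀ E t n Q Y → t ℕ.≤ 2 ℕ.* n ℕ.* Q → 162 ℕ.* E ℕ.≤ Q → 1 ℕ.≤ Q → 1 ℕ.≤ Y → 9 ℕ.* E ℕ.*
      (4 ℕ.* (2 ℕ.* t) ℕ.* Y ℕ.+ n ℕ.+ n) ℕ.≤ Q ℕ.* (Q ℕ.* Y) ℕ.* n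
  K-large-ℕ E t n Q Y t≤ E≤ 1≤Q 1≤Y = ℕₚ.≤-trans (ℕₚ.*-monoʳ-≤ (9 ℕ.* E)
      (ℕₚ.≤-trans (ℕₚ.≤-reflexive (e₁ t n Y)) (ℕₚ.+-mono-≤ (ℕₚ.*-monoˡ-≤ Y (ℕₚ.*-monoʳ-≤ 8 t≤))
      (ℕₚ.*-monoʳ-≤ (2 ℕ.* n) (ℕₚ.*-mono-≤ 1≤Q 1≤Y)))))
    (ℕₚ.≤-trans (ℕₚ.≤-reflexive (e₂ E n Q Y)) (ℕₚ.≤-trans (ℕₚ.*-monoˡ-≤ (n ℕ.* (Q ℕ.* Y)) E≤)
        (ℕₚ.≤-reflexive (e₃ Q n (Q ℕ.* Y)))))
    where
    e₁ : ∀ t n Y → 4 ℕ.* (2 ℕ.* t) ℕ.* Y ℕ.+ n ℕ.+ n ≡ 8 ℕ.* t ℕ.* Y ℕ.+ 2 ℕ.* n ℕ.* (1 ℕ.* 1)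
    e₁ = NS.solve 3 (λ t n Y → NS.con 4 NS.:* (NS.con 2 NS.:* t) NS.:* Y NS.:+ n NS.:+ n NS.:= NS.con 8 NS.:* t NS.:* Y NS.:+
        NS.con 2 NS.:* n NS.:* (NS.con 1 NS.:* NS.con 1)) refl
    e₂ : ∀ E n Q Y → 9 ℕ.* E ℕ.* (8 ℕ.* (2 ℕ.* n ℕ.* Q) ℕ.* Y ℕ.+ 2 ℕ.* n ℕ.* (Q ℕ.* Y)) ≡ 162 ℕ.* E ℕ.* (n ℕ.* (Q ℕ.* Y))
    e₂ = NS.solve 4 (λ E n Q Y → NS.con 9 NS.:* E NS.:* (NS.con 8 NS.:* (NS.con 2 NS.:* n NS.:* Q) NS.:* Y NS.:+ NS.con 2 NS.:*
        n NS.:* (Q NS.:* Y)) NS.:= NS.con 162 NS.:* E NS.:* (n NS.:* (Q NS.:* Y))) refl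
    e₃ : ∀ Q n R → Q ℕ.* (n ℕ.* R) ≡ Q ℕ.* R ℕ.* n
    e₃ = NS.solve 3 (λ Q n R → Q NS.:* (n NS.:* R) NS.:= Q NS.:* R NS.:* n) refl

  -- `C` collects what the root of n has to exceed: `C₁` the moment constant, `C₂` the ratio of K to
  -- κ/n, `C₃` the number of cells, `C₄` the passage from q to Q = q + 1.
  record Parameters (e : ℕ) : Set where
    field
      d x β m C : ℕ
      d≡ : # d ≡ # 3 * (# e * # e * # e)
      2≤x : 2 ℕ.≤ x
      x≡ : # x ≡ # 66816 * # d
      1≤β : 1 ℕ.≤ β
      β-large : 9 ℕ.* d ℕ.* (1 ℕ.+ x) ℕ.≤ β
      1≤m : 1 ℕ.≤ m
      m-large : 8 ℕ.* (x ℕ.^ 3 ℕ.* (4 ℕ.* β ℕ.+ 1)) ℕ.≤ m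
      C₁ : 2 ℕ.* cc 14 ℕ.≤ C
      C₂ : 162 ℕ.* (e ℕ.* e ℕ.* e) ℕ.≤ C
      C₃ : 9 ℕ.* d ℕ.* (18 ℕ.* suc (4 ℕ.* β ℕ.* m ℕ.+ 2) ℕ.^ (x ℕ.^ 3)) ℕ.≤ C
      C₄ : 16 ℕ.≤ C

  scaled≥2 : ∀ c d → 2 ℕ.≤ c → 1 ℕ.≤ d → 2 ℕ.≤ c ℕ.* d
  scaled≥2 c d 2≤c 1≤d = ℕₚ.*-mono-≤ {2} {c} {1} {d} 2≤c 1≤d

  -- The large constants arrive as variables with equations, and `parameters` fixes one variable at
  -- a time, so that checking does not compute these numbers.
  make-parameters : ∀ e d x β m C₁ C₂ C₃ → # d ≡ # 3 * (# e * # e * # e) → 2 ℕ.≤ x → # x ≡ # 66816 * # d → 9 ℕ.* d ℕ.* (1 ℕ.+ x)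
      ℕ.≤ β → 1 ℕ.≤ β → 8 ℕ.* (x ℕ.^ 3 ℕ.* (4 ℕ.* β ℕ.+ 1)) ℕ.≤ m → 1 ℕ.≤ m →
    2 ℕ.* cc 14 ≡ C₁ → 162 ℕ.* (e ℕ.* e ℕ.* e) ≡ C₂ → 9 ℕ.* d ℕ.* (18 ℕ.* suc (4 ℕ.* β ℕ.* m ℕ.+ 2) ℕ.^ (x ℕ.^ 3)) ≡ C₃ →
        Parameters e
  make-parameters e d x β m C₁ C₂ C₃ d≡ 2≤x x≡ β≥ 1≤β m≥ 1≤m c₁ c₂ c₃ = record
      { d = d ; x = x ; β = β ; m = m ; C = C₁ ℕ.+ (C₂ ℕ.+ (C₃ ℕ.+ 16)) ; d≡ = d≡ ; 2≤x = 2≤x ; x≡ = x≡ ; 1≤β = 1≤β ; β-large =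
      β≥ ; 1≤m = 1≤m ; m-large = m≥
    ; C₁ = ℕₚ.≤-trans (ℕₚ.≤-reflexive c₁) (ℕₚ.m≤m+n C₁ _)
    ; C₂ = ℕₚ.≤-trans (ℕₚ.≤-reflexive c₂) (ℕₚ.≤-trans (ℕₚ.m≤m+n C₂ _) (ℕₚ.m≤n+m _ C₁))
    ; C₃ = ℕₚ.≤-trans (ℕₚ.≤-reflexive c₃) (ℕₚ.≤-trans (ℕₚ.m≤m+n C₃ 16) (ℕₚ.≤-trans (ℕₚ.m≤n+m _ C₂) (ℕₚ.m≤n+m _ C₁)))
    ; C₄ = ℕₚ.≤-trans (ℕₚ.m≤n+m 16 C₃) (ℕₚ.≤-trans (ℕₚ.m≤n+m _ C₂) (ℕₚ.m≤n+m _ C₁)) }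

  opaque
    parameters : ∀ e → 1 ℕ.≤ e → Parameters e
    parameters e 1≤e = with-d (3 ℕ.* (e ℕ.* e ℕ.* e)) (ℕₚ.≤-trans 1≤e³ (ℕₚ.m≤m+n _ _))
        (trans (#-* 3 (e ℕ.* e ℕ.* e)) (cong (# 3 *_) (trans (#-* (e ℕ.* e) e) (cong (_* # e) (#-* e e)))))
      where
      1≤e³ : 1 ℕ.≤ e ℕ.* e ℕ.* e
      1≤e³ = ℕₚ.*-mono-≤ (ℕₚ.*-mono-≤ 1≤e 1≤e) 1≤e
      with-β : ∀ d x β → # d ≡ # 3 * (# e * # e * # e) → 2 ℕ.≤ x → # x ≡ # 66816 * # d → 9 ℕ.* d ℕ.* (1 ℕ.+ x) ℕ.≤ β → 1 ℕ.≤ β →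
          Parameters e
      with-β d x β d≡ 2≤x x≡ β≥ 1≤β = make-parameters e d x β (suc (8 ℕ.* (x ℕ.^ 3 ℕ.* (4 ℕ.* β ℕ.+ 1)))) _ _ _ d≡ 2≤x x≡ β≥ 1≤β
          (ℕₚ.n≤1+n _) (ℕ.s≤s ℕ.z≤n) refl refl refl
      with-x : ∀ d x → # d ≡ # 3 * (# e * # e * # e) → 2 ℕ.≤ x → # x ≡ # 66816 * # d → Parameters e
      with-x d x d≡ 2≤x x≡ = with-β d x (suc (9 ℕ.* d ℕ.* (1 ℕ.+ x))) d≡ 2≤x x≡ (ℕₚ.n≤1+n _) (ℕ.s≤s ℕ.z≤n)
      with-d : ∀ d → 1 ℕ.≤ d → # d ≡ # 3 * (# e * # e * # e) → Parameters e
      with-d d 1≤d d≡ = with-x d (66816 ℕ.* d) d≡ (scaled≥2 66816 d (ℕ.s≤s (ℕ.s≤s ℕ.z≤n)) 1≤d) (#-* 66816 d)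

  #-P : ∀ p z → P p (# z) ≡ # ((z ℕ.* z) ℕ.^ p)
  #-P zero z = refl
  #-P (suc p) z = trans (cong₂ _*_ (sym (#-* z z)) (#-P p z)) (sym (#-* (z ℕ.* z) _))

  module Final (e : ℕ) (1≤e : 1 ℕ.≤ e) (Pa : Parameters e) {n : ℕ} (G : Graph n) (q Q : ℕ) (Q≡ : Q ≡ suc q)
      (q≥C : Parameters.C Pa ℕ.≤ q) (lo : q ℕ.^ 100 ℕ.≤ n) (hi : n ℕ.< Q ℕ.^ 100)
    (t≤ : twiceSp G ℕ.≤ 2 ℕ.* n ℕ.* Q) where
    open Parameters Pa

    C≤Q : C ℕ.≤ Q
    C≤Q = subst (C ℕ.≤_) (sym Q≡) (ℕₚ.m≤n⇒m≤1+n q≥C)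
    1≤Q : 1 ℕ.≤ Q
    1≤Q = subst (1 ℕ.≤_) (sym Q≡) (ℕ.s≤s ℕ.z≤n)
    16≤q : 16 ℕ.≤ q
    16≤q = ℕₚ.≤-trans C₄ q≥C

    1≤pow : ∀ k → 1 ℕ.≤ Q ℕ.^ k
    1≤pow k = ℕₚ.≤-trans (ℕₚ.≤-reflexive (sym (ℕₚ.^-zeroˡ k))) (ℕₚ.^-monoˡ-≤ k 1≤Q)

    -- Q ≤ 2q costs a factor 2^80 = 16^20, which q^20 pays because q ≥ 16; q^100 ≤ n does the rest.
    Q⁸⁰≤n : Q ℕ.^ 80 ℕ.≤ n
    Q⁸⁰≤n = ℕₚ.≤-trans (ℕₚ.^-monoˡ-≤ 80 Q≤2q) (ℕₚ.≤-trans (ℕₚ.≤-reflexive (^-distribʳ-* 80 2 q))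
        (ℕₚ.≤-trans (ℕₚ.*-monoˡ-≤ (q ℕ.^ 80) (ℕₚ.≤-trans (ℕₚ.≤-reflexive (sym (ℕₚ.^-*-assoc 2 4 20))) (ℕₚ.^-monoˡ-≤ 20 16≤q)))
        (ℕₚ.≤-trans (ℕₚ.≤-reflexive (sym (ℕₚ.^-distribˡ-+-* q 20 80))) lo)))
      where
      Q≤2q : Q ℕ.≤ 2 ℕ.* q
      Q≤2q = ℕₚ.≤-trans (ℕₚ.≤-reflexive Q≡) (ℕₚ.≤-trans (ℕₚ.+-monoˡ-≤ q (ℕₚ.≤-trans (ℕ.s≤s ℕ.z≤n) 16≤q))
          (ℕₚ.≤-reflexive (cong (q ℕ.+_) (sym (ℕₚ.+-identityʳ q)))))

    1≤n : 1 ℕ.≤ n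
    1≤n = ℕₚ.≤-trans (1≤pow 80) Q⁸⁰≤n

    Λ K κ : ℕ
    Λ = Q ℕ.^ 4
    K = Q ℕ.* (Q ℕ.* (Λ ℕ.* Λ))
    κ = 4 ℕ.* (2 ℕ.* twiceSp G) ℕ.* (Λ ℕ.* Λ) ℕ.+ n

    Λ² : Λ ℕ.* Λ ≡ Q ℕ.^ 8
    Λ² = sym (ℕₚ.^-distribˡ-+-* Q 4 4)

    K≡ : K ≡ Q ℕ.^ 10
    K≡ = cong (λ y → Q ℕ.* (Q ℕ.* y)) Λ²

    -- The right side is Λ^26 = Q^104. Since n < Q^100, a factor Q⁴ is left for the moment constant.
    Λ-large : # (2 ℕ.* n ℕ.* cc 14) ≤ P 13 (# Λ)
    Λ-large = ≤-trans (#-mono (ℕₚ.≤-trans (ℕₚ.≤-reflexive (rearrange n (cc 14)))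
        (ℕₚ.≤-trans (ℕₚ.*-mono-≤ (ℕₚ.<⇒≤ hi) (ℕₚ.≤-trans (ℕₚ.≤-trans C₁ C≤Q) Q≤Q⁴))
        (ℕₚ.≤-reflexive (trans (sym (ℕₚ.^-distribˡ-+-* Q 100 4)) (trans (sym (ℕₚ.^-*-assoc Q 8 13))
        (cong (ℕ._^ 13) (sym Λ²)))))))) (≡⇒≤ (sym (#-P 13 Λ)))
      where
      rearrange : ∀ n c → 2 ℕ.* n ℕ.* c ≡ n ℕ.* (2 ℕ.* c)
      rearrange = NS.solve 2 (λ n c → NS.con 2 NS.:* n NS.:* c NS.:= n NS.:* (NS.con 2 NS.:* c)) refl
      Q≤Q⁴ : Q ℕ.≤ Q ℕ.^ 4
      Q≤Q⁴ = ℕₚ.≤-trans (ℕₚ.≤-reflexive (sym (ℕₚ.*-identityʳ Q))) (ℕₚ.*-monoʳ-≤ Q (1≤pow 3))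

    K⁸≤n : K ℕ.^ 8 ℕ.≤ n
    K⁸≤n = ℕₚ.≤-trans (ℕₚ.≤-reflexive (trans (cong (ℕ._^ 8) K≡) (ℕₚ.^-*-assoc Q 10 8))) Q⁸⁰≤n

    n-large : 9 ℕ.* d ℕ.* (18 ℕ.* K ℕ.* suc (4 ℕ.* β ℕ.* m ℕ.+ 2) ℕ.^ (x ℕ.^ 3)) ℕ.≤ n
    n-large = ℕₚ.≤-trans (ℕₚ.≤-reflexive (rearrange (9 ℕ.* d) K _)) (ℕₚ.≤-trans
        (ℕₚ.*-mono-≤ (ℕₚ.≤-trans C₃ C≤Q) (ℕₚ.≤-reflexive K≡)) (ℕₚ.≤-trans
        (ℕₚ.≤-trans (ℕₚ.m≤m*n (Q ℕ.^ 11) (Q ℕ.^ 69) {{ℕ.>-nonZero (1≤pow 69)}})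
        (ℕₚ.≤-reflexive (sym (ℕₚ.^-distribˡ-+-* Q 11 69)))) Q⁸⁰≤n))
      where
      rearrange : ∀ a k N → a ℕ.* (18 ℕ.* k ℕ.* N) ≡ a ℕ.* (18 ℕ.* N) ℕ.* k
      rearrange = NS.solve 3 (λ a k N → a NS.:* (NS.con 18 NS.:* k NS.:* N) NS.:= a NS.:* (NS.con 18 NS.:* N) NS.:* k) refl

    K-large : # 9 * (# e * # e * # e) * (# κ + # n) ≤ # K * # n
    K-large = ≤-trans (≡⇒≤ (trans (cong₂ (λ a b → # 9 * a * b) (sym (trans (#-* (e ℕ.* e) e) (cong (_* # e) (#-* e e))))
        (sym (#-+ κ n))) (trans (cong (_* # (κ ℕ.+ n)) (sym (#-* 9 (e ℕ.* e ℕ.* e))))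
        (sym (#-* (9 ℕ.* (e ℕ.* e ℕ.* e)) (κ ℕ.+ n))))))
      (≤-trans (#-mono (K-large-ℕ (e ℕ.* e ℕ.* e) (twiceSp G) n Q (Λ ℕ.* Λ) t≤ (ℕₚ.≤-trans C₂ C≤Q) 1≤Q
          (ℕₚ.*-mono-≤ (1≤pow 4) (1≤pow 4)))) (≡⇒≤ (#-* K n)))

    κ≡ : # κ ≡ # 4 * # (2 ℕ.* twiceSp G) * (# Λ * # Λ) + # n
    κ≡ = trans (#-+ (4 ℕ.* (2 ℕ.* twiceSp G) ℕ.* (Λ ℕ.* Λ)) n) (+-congˡ
        (trans (#-* (4 ℕ.* (2 ℕ.* twiceSp G)) (Λ ℕ.* Λ)) (cong₂ _*_ (#-* 4 (2 ℕ.* twiceSp G)) (#-* Λ Λ))))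

    not-far : ∀ ε → # 2 ≤ ε * # e → FarFromCliqueUnions ε G → ⊥
    not-far = Assembly.not-far G 1≤n e d x β m 13 Λ K κ 1≤e d≡ 2≤x x≡ 1≤β β-large 1≤m m-large (1≤pow 4) Λ-large κ≡
        (ℕₚ.*-mono-≤ 1≤Q (ℕₚ.*-mono-≤ 1≤Q (ℕₚ.*-mono-≤ (1≤pow 4) (1≤pow 4)))) K⁸≤n n-large K-large

  -- If ε = p/(q + 1), then p ≥ 1, and twice the denominator serves as `e`.
  resolution : ∀ ε → # 0 < ε → Σ ℕ λ e → (1 ℕ.≤ e) × (# 2 ≤ ε * # e)
  resolution ε 0<ε = 2 ℕ.* suc q , ℕ.s≤s ℕ.z≤n , (# 2 =⟨ sym (*-identityʳ (# 2)) ⟩ # 2 * # 1 ≤⟨ *-monoˡ (0≤# 2) (#-mono 1≤p) ⟩ #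
      2 * # p =⟨ trans (cong (# 2 *_) (sym eq)) (trans (solve 2 (λ x q → con (+ 2) :* (x :* q) := x :* (con (+ 2) :* q)) refl ε
      (# (suc q))) (cong (ε *_) (sym (#-* 2 (suc q))))) ⟩ ε * # (2 ℕ.* suc q) ∎)
    where
    fr : Σ ℤ λ p → Σ ℕ λ q → ε * # (suc q) ≡ ι p
    fr = fraction ε
    q p : ℕ
    q = proj₁ (proj₂ fr)
    nat : Σ ℕ λ m → proj₁ fr ≡ + m
    nat = ι-nonneg (proj₁ fr) (subst (# 0 ≤_) (proj₂ (proj₂ fr)) (*-nonneg (<⇒≤ 0<ε) (0≤# (suc q))))
    p = proj₁ nat
    eq : ε * # (suc q) ≡ # p
    eq = trans (proj₂ (proj₂ fr)) (cong ι (proj₂ nat))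
    1≤p : 1 ℕ.≤ p
    1≤p = ℕₚ.≰⇒> (λ h → ≤∧>⇒⊥ (≤-trans (≡⇒≤ eq) (#-mono h)) (*-pos 0<ε (0<#suc q)))

  root≥ : ∀ k C n q → C ℕ.^ suc k ℕ.≤ n → n ℕ.< suc q ℕ.^ suc k → C ℕ.≤ q
  root≥ k C n q C≤ hi with C ℕ.≤? q
  ... | yes h = h
  ... | no h = ⊥-elim (ℕₚ.<⇒≱ (ℕₚ.≤-<-trans C≤ hi) (ℕₚ.^-monoˡ-≤ (suc k) (ℕₚ.≰⇒> h)))

  -- Denying the conclusion yields `twiceSp G` ≤ 2nQ, which `contra` refutes. The exponent stays a
  -- variable so that no hundredth power is unfolded.
  large-surplus : ∀ k C {n} (G : Graph n) → (∀ q Q → Q ≡ suc q → C ℕ.≤ q → q ℕ.^ suc k ℕ.≤ n → n ℕ.< Q ℕ.^ suc k → twiceSp G ℕ.≤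
      2 ℕ.* n ℕ.* Q → ⊥) →
    C ℕ.^ suc k ℕ.≤ n → 2 ℕ.^ suc k ℕ.* n ℕ.^ suc (suc k) ℕ.≤ twiceSp G ℕ.^ suc k
  large-surplus k C {n} G contra n≥ = ℕₚ.≮⇒≥ λ small → contra (proj₁ rt) (suc (proj₁ rt)) refl
      (root≥ k C n (proj₁ rt) n≥ (proj₂ (proj₂ rt))) (proj₁ (proj₂ rt)) (proj₂ (proj₂ rt))
      (surplus-bound (suc k) (twiceSp G) n (suc (proj₁ rt)) small (proj₂ (proj₂ rt)))
    where
    rt : Σ ℕ λ q → (q ℕ.^ suc k ℕ.≤ n) × (n ℕ.< suc q ℕ.^ suc k)
    rt = root k n

  module Threshold (ε : ℚ) (0<ε : # 0 < ε) where
    e : ℕ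
    e = proj₁ (resolution ε 0<ε)

    Pa : Parameters e
    Pa = parameters e (proj₁ (proj₂ (resolution ε 0<ε)))

    threshold : ℕ
    threshold = Parameters.C Pa ℕ.^ 100

    surplus : ∀ n → threshold ℕ.≤ n → (G : Graph n) → FarFromCliqueUnions ε G → 2 ℕ.^ 100 ℕ.* n ℕ.^ 101 ℕ.≤ twiceSp G ℕ.^ 100
    surplus n n≥ G far = large-surplus 99 (Parameters.C Pa) G (λ q Q Q≡ q≥ lo hi t≤ → Final.not-far e
        (proj₁ (proj₂ (resolution ε 0<ε))) Pa G q Q Q≡ q≥ lo hi t≤ ε (proj₂ (proj₂ (resolution ε 0<ε))) far) n≥

open import Defs
open import Data.Nat using (ℕ; _≥_; _*_; _^_)
open import Data.Rational using (ℚ; Positive)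
open import Data.Product using (∃; _,_)

theorem1p5 : (ε : ℚ) → Positive ε →
    ∃ λ (n₀ : ℕ) → (n : ℕ) → n ≥ n₀ → (G : Graph n) →
    FarFromCliqueUnions ε G →
    twiceSp G ^ 100 ≥ 2 ^ 100 * n ^ 101
theorem1p5 ε pos = threshold , surplus
  where open Development.Threshold ε (Development.positive⇒0< pos)
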